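{- There exists a randomized algorithm that, for every satisfiable 3-CNF formula $F$ on $n$ variables, finds a satisfying assignment of $F$ with expected running time $O\left(1.32065^{n}\right)$.
   Context: A literal is a propositional variable $x$ or its complement $\bar x$. A clause is a finite set of literals over pairwise distinct variables; a CNF formula is a finite set of clauses. A 3-CNF formula is a CNF formula in which every clause has at most 3 literals. $n$ is the number of variables occurring in the input formula. An assignment of truth values $0,1$ to the variables satisfies $F$ if every clause of $F$ contains a literal $x$ with $x$ assigned $1$ or a literal $\bar x$ with $x$ assigned $0$; $F$ is satisfiable if such an assignment exists. The expectation is over the algorithm's internal randomness, and the constant hidden in $O$ is uniform over all inputs $F$. -}

module Defs where

open import Algebra.Definitions.RawSemiring using () renaming (_^_ to pow)
open import Data.Bool using (Bool; true; false; if_then_else_)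
open import Data.Fin using (Fin; zero; toℕ)
open import Data.Integer using (+_)
open import Data.List using (List; []; _∷_; map; length; foldr)
open import Data.List.Membership.Propositional using (_∈_)
open import Data.List.Relation.Binary.BagAndSetEquality using (_∼[_]_; set)
open import Data.List.Relation.Unary.All using (All)
open import Data.List.Relation.Unary.AllPairs using (AllPairs)
open import Data.List.Relation.Unary.Any using (Any)
open import Data.List.Relation.Unary.Unique.Propositional using (Unique)
open import Data.Nat using (ℕ; zero; suc; _≤_)
open import Data.Product using (_×_; _,_; proj₁; proj₂; ∃-syntax)
open import Data.Rational using (ℚ; ½; _/_) renaming (_+_ to _+ℚ_; _*_ to _*ℚ_; _≤_ to _≤ℚ_)
open import Data.Rational.Base using (+-*-rawSemiring)
open import Data.Vec using (Vec; []; _∷_; lookup; replicate; toList; _[_]≔_)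
open import Relation.Binary.PropositionalEquality using (_≡_)
open import Relation.Nullary using (¬_)

------------------------------------------------------------------------
-- Formulas

-- (x , true) is the variable x, (x , false) its complement.
Literal : ℕ → Set
Literal n = Fin n × Bool

var : ∀ {n} → Literal n → Fin n
var = proj₁

record Clause (n : ℕ) : Set where
  field
    literals     : List (Literal n)
    distinctVars : Unique (map var literals)

open Clause public

SameClause : ∀ {n} → Clause n → Clause n → Set
SameClause c d = literals c ∼[ set ] literals d

-- Finite sets are given by duplicate-free lists, in any order.  The
-- variables are named by Fin n and all of them occur, so n is the number
-- of variables occurring in the formula.  (Names must be bounded in some
-- such way: otherwise the time needed to read a formula would not be
-- bounded in terms of n.)
record CNF (n : ℕ) : Set where
  field
    clauses         : List (Clause n)
    distinctClauses : AllPairs (λ c d → ¬ SameClause c d) clauses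
    allVarsOccur    : ∀ (x : Fin n) → Any (λ c → x ∈ map var (literals c)) clauses

open CNF public

Is3CNF : ∀ {n} → CNF n → Set
Is3CNF F = All (λ c → length (literals c) ≤ 3) (clauses F)

Assignment : ℕ → Set
Assignment n = Vec Bool n

_Satisfies_ : ∀ {n} → Assignment n → CNF n → Set
α Satisfies F = All (λ c → Any (λ l → lookup α (var l) ≡ proj₂ l) (literals c)) (clauses F)

Satisfiable : ∀ {n} → CNF n → Set
Satisfiable F = ∃[ α ] α Satisfies F

------------------------------------------------------------------------
-- Randomized algorithms: while-programs with coin flips, whose finitely
-- many registers hold binary trees (Lisp-style linked data).  Each step
-- below is O(1) pointer operations; in particular there is no arithmetic
-- and no tree comparison at unit cost.

data Tree : Set where
  nil  : Tree
  cons : Tree → Tree → Tree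

hd : Tree → Tree
hd nil        = nil
hd (cons s _) = s

tl : Tree → Tree
tl nil        = nil
tl (cons _ t) = t

isCons : Tree → Bool
isCons nil        = false
isCons (cons _ _) = true

fromBool : Bool → Tree
fromBool false = nil
fromBool true  = cons nil nil

infixr 4 _⨾_
infix  5 _≔_

data Expr (r : ℕ) : Set where
  `nil  : Expr r
  `copy : Fin r → Expr r
  `cons : Fin r → Fin r → Expr r
  `hd   : Fin r → Expr r
  `tl   : Fin r → Expr r
  `flip : Expr r

data Command (r : ℕ) : Set where
  _≔_    : Fin r → Expr r → Command r
  _⨾_    : Command r → Command r → Command r
  `if    : Fin r → Command r → Command r → Command r
  `while : Fin r → Command r → Command r

Store : ℕ → Set
Store r = Vec Tree r

-- The list is the stack of commands still to be executed.
Config : ℕ → Set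
Config r = List (Command r) × Store r

eval : ∀ {r} → Bool → Store r → Expr r → Tree
eval b σ `nil        = nil
eval b σ (`copy x)   = lookup σ x
eval b σ (`cons x y) = cons (lookup σ x) (lookup σ y)
eval b σ (`hd x)     = hd (lookup σ x)
eval b σ (`tl x)     = tl (lookup σ x)
eval b σ `flip       = fromBool b

-- Every step is supplied with a fresh fair coin, which only `flip reads.
step : ∀ {r} → Bool → Config r → Config r
step b ([]             , σ) = [] , σ
step b ((x ≔ e)    ∷ K , σ) = K , (σ [ x ]≔ eval b σ e)
step b ((c ⨾ d)    ∷ K , σ) = c ∷ d ∷ K , σ
step b (`if x c d  ∷ K , σ) = (if isCons (lookup σ x) then c else d) ∷ K , σ
step b (`while x c ∷ K , σ) = (if isCons (lookup σ x) then c ∷ `while x c ∷ K else K) , σ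

run : ∀ {r N} → Vec Bool N → Config r → Config r
run []      κ = κ
run (b ∷ ω) κ = run ω (step b κ)

-- The minimum of T and N, where T is the number of steps until the command stack is
-- empty and N the number of coins supplied.
time : ∀ {r N} → Vec Bool N → Config r → ℕ
time []      κ              = 0
time (b ∷ ω) ([]      , σ)  = 0
time (b ∷ ω) (c ∷ K   , σ)  = suc (time ω (step b (c ∷ K , σ)))

-- A program has at least one register; register 0 holds the input at the
-- start, with all others nil, and the output at the end.
record Program : Set where
  field
    extraRegisters : ℕ
    body           : Command (suc extraRegisters)

open Program public

start : (P : Program) → Tree → Config (suc (extraRegisters P))
start P t = body P ∷ [] , (t ∷ replicate (extraRegisters P) nil)

-- Expectation over N independent fair coins.
𝔼 : (N : ℕ) → (Vec Bool N → ℚ) → ℚ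
𝔼 zero    f = f []
𝔼 (suc N) f = ½ *ℚ (𝔼 N (λ ω → f (false ∷ ω)) +ℚ 𝔼 N (λ ω → f (true ∷ ω)))

-- E[T] ≤ B, phrased without reals: by monotone convergence E[T], possibly
-- infinite, is the supremum over N of E[min (T , N)].
ExpectedTime_on_AtMost_ : Program → Tree → ℚ → Set
ExpectedTime P on t AtMost B = ∀ N → 𝔼 N (λ ω → + time ω (start P t) / 1) ≤ℚ B

------------------------------------------------------------------------
-- Input and output conventions

encodeList : List Tree → Tree
encodeList = foldr cons nil

encodeℕ : ℕ → Tree
encodeℕ zero    = nil
encodeℕ (suc m) = cons nil (encodeℕ m)

encodeLiteral : ∀ {n} → Literal n → Tree
encodeLiteral (x , s) = cons (encodeℕ (toℕ x)) (fromBool s)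

encodeClause : ∀ {n} → Clause n → Tree
encodeClause c = encodeList (map encodeLiteral (literals c))

encodeCNF : ∀ {n} → CNF n → Tree
encodeCNF {n} F = cons (encodeℕ n) (encodeList (map encodeClause (clauses F)))

encodeAssignment : ∀ {n} → Assignment n → Tree
encodeAssignment α = encodeList (map fromBool (toList α))

-- Whenever P halts on F, it has output a satisfying assignment.  (That it
-- halts with probability 1 follows from a finite expected running time.)
FindsSatisfyingAssignment : ∀ {n} → Program → CNF n → Set
FindsSatisfyingAssignment P F =
  ∀ N (ω : Vec Bool N) → let (K , σ) = run ω (start P (encodeCNF F)) in
  K ≡ [] → ∃[ α ] (α Satisfies F × lookup σ zero ≡ encodeAssignment α)

infixr 8 _^_
_^_ : ℚ → ℕ → ℚ
_^_ = pow +-*-rawSemiring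

module Submission where

-- The algorithm is PPSZ.  A trial goes 512 times through the variables; each
-- time, a variable that is still unassigned is picked with probability 1/64,
-- and then gets its forced value, if the formula with the opposite value is
-- refuted by branching on clauses to depth 60, and a random bit otherwise.
-- What is left is guessed.  Trials are repeated until one succeeds.
--
-- The success probability is bounded below following Hertli.  Call a variable
-- frozen if all satisfying assignments extending the current partial one agree
-- on it, and liquid otherwise.  For a frozen variable and a fixed satisfying
-- assignment, branching on clauses follows a critical clause tree: every node
-- has at most two children, and the variable is forced as soon as the revealed
-- variables cut all paths.  By Harris' inequality the cuts of the two subtrees
-- are positively correlated, so the probability that the variable is not
-- forced in time is at most that for a complete binary tree with independent
-- nodes.  Liquid variables are charged a fixed cost instead; averaging over
-- the satisfying assignments with weights that favour setting liquid variables
-- makes the total cost c decrease as required, and gives success probability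
-- about 2^(-c) with c at most 0.394 n.

open import Defs
open import Data.Bool using (Bool; _xor_; _∧_; _∨_; false; if_then_else_; not; true)
open import Data.Bool.ListAction using (all; any)
open import Data.Bool.Properties using (T-∧; T-∨; T-≡; not-involutive; not-¬; ¬-not) renaming (_≟_ to _≟ᵇ_)
open import Data.Empty using (⊥; ⊥-elim)
open import Data.Fin as Fin using (Fin; suc; toℕ; zero)
open import Data.Fin.Properties using (combine-injective; pigeonhole; suc-injective; toℕ<n)
open import Data.List using (List; []; _++_; _∷_; allFin; foldl; foldr; length; map; tabulate)
open import Data.List.Membership.Propositional using (_∈_; _∉_; find; lose)
open import Data.List.Membership.Propositional.Properties using (∈-++⁺ʳ; ∈-++⁺ˡ; ∈-++⁻; ∈-allFin; ∈-lookup; ∈-∃++)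
open import Data.List.Properties using (++-assoc; length-++; length-map; length-tabulate; map-tabulate; map-∘; tabulate-cong; ∷-injective)
open import Data.List.Relation.Unary.All as All using (All; []; _∷_)
open import Data.List.Relation.Unary.All.Properties using (all⁺; all⁻; ¬All⇒Any¬; ¬Any⇒All¬)
open import Data.List.Relation.Unary.AllPairs using (AllPairs; []; _∷_)
open import Data.List.Relation.Unary.Any as Any using (Any; any?; here; there)
open import Data.List.Relation.Unary.Any.Properties using (any⁺; any⁻)
open import Data.List.Relation.Unary.Unique.Propositional using (Unique)
open import Data.List.Relation.Unary.Unique.Propositional.Properties using (allFin⁺)
open import Data.Maybe using (Maybe; fromMaybe; just; nothing)
open import Data.Maybe.Properties using (just-injective)
open import Data.Product using (_,_; _×_; proj₁; proj₂; Σ-syntax; ∃-syntax)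
open import Data.Sum using (_⊎_; inj₁; inj₂)
open import Data.Unit using (tt)
open import Data.Vec using (Vec; []; _[_]≔_; _∷_; lookup; toList)
open import Data.Vec.Properties using ([]≔-commutes; []≔-idempotent; []≔-lookup; lookup-replicate; lookup∘update; lookup∘update′)
open import Function using (_∘_; case_of_; id)
open import Function.Bundles using (Equivalence)
open import Relation.Binary.PropositionalEquality
open import Relation.Nullary using (Dec; dec⇒maybe; does; isYes; no; yes; ¬_)
open import Relation.Nullary.Decidable using (_×-dec_; fromWitness; map′; toWitness)
open Equivalence using (to; from)

-- Visiting the variables in rounds replaces the random order of PPSZ. The picks are independent, so
-- Harris' inequality is an induction over the script, and six coins realise 1/64 exactly. The
-- chance 1 - (63/64)^m of having been picked within m rounds plays the part of a uniform position
-- in [0, 1]. As the picking probability tends to 0 and the depth grows, a frozen variable costs 2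
-- ln 2 - 1 ≈ 0.3863, which 0.394 exceeds to cover the finite parameters. The base 1.32065 ≈ 2^0.401
-- leaves room for two more losses: the rational substitute (1 - u c)^N for 2^(-c), and a factor
-- 1.002^n that absorbs every polynomial. All that is asked of (1 - u c)^N is that it decreases, is
-- convex, at least halves when c grows by 1, and loses at most a factor 1 + 1/64 when c grows by
-- the slack δ granted at a liquid variable. Refutation to constant depth is polynomial, if of huge
-- degree, since there are at most (2n + 1)^3 clauses. To read the polynomial off the syntax, the
-- algorithm is written in a fold language all of whose loops last exactly as long as a common
-- clock.

-- Rational inequalities, two-point averages, finite sums and expectations.

module Arithmetic where

  open import Data.Integer as ℤ using (+_)
  import Data.Integer.Properties as ℤP
  open import Data.Nat as ℕ using (ℕ; zero; suc)
  open import Data.Rational hiding (NonNegative)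
  open import Data.Rational.Properties
  import Data.Rational.Unnormalised as ℚᵘ
  import Data.Rational.Unnormalised.Properties as ℚᵘP
  open import Tactic.RingSolver
  open import Tactic.RingSolver.Core.AlmostCommutativeRing using (AlmostCommutativeRing; fromCommutativeRing)

  ℚ-ring : AlmostCommutativeRing _ _
  ℚ-ring = fromCommutativeRing +-*-commutativeRing (λ x → dec⇒maybe (0ℚ ≟ x))

  0≤1 : 0ℚ ≤ 1ℚ
  0≤1 = ≤ᵇ⇒≤ _

  0≤½ : 0ℚ ≤ ½
  0≤½ = ≤ᵇ⇒≤ _

  *-monoˡ : ∀ {c a b} → 0ℚ ≤ c → a ≤ b → c * a ≤ c * b
  *-monoˡ {c} 0≤c = *-monoˡ-≤-nonNeg c {{nonNegative 0≤c}}

  *-monoʳ : ∀ {c a b} → 0ℚ ≤ c → a ≤ b → a * c ≤ b * c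
  *-monoʳ {c} 0≤c = *-monoʳ-≤-nonNeg c {{nonNegative 0≤c}}

  *-mono : ∀ {a b c d} → 0ℚ ≤ a → 0ℚ ≤ d → a ≤ b → c ≤ d → a * c ≤ b * d
  *-mono 0≤a 0≤d a≤b c≤d = ≤-trans (*-monoˡ 0≤a c≤d) (*-monoʳ 0≤d a≤b)

  0≤+ : ∀ {a b} → 0ℚ ≤ a → 0ℚ ≤ b → 0ℚ ≤ a + b
  0≤+ = +-mono-≤

  0≤* : ∀ {a b} → 0ℚ ≤ a → 0ℚ ≤ b → 0ℚ ≤ a * b
  0≤* {a} {b} 0≤a 0≤b = subst (_≤ a * b) (*-zeroʳ a) (*-monoˡ 0≤a 0≤b)

  private
    cancel₁ : ∀ a b → (b - a) + a ≡ b
    cancel₁ = solve-∀ ℚ-ring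

  ≤⇒0≤- : ∀ {a b} → a ≤ b → 0ℚ ≤ b - a
  ≤⇒0≤- {a} {b} a≤b = subst (_≤ b - a) (+-inverseʳ a) (+-monoˡ-≤ (- a) a≤b)

  0≤-⇒≤ : ∀ {a b} → 0ℚ ≤ b - a → a ≤ b
  0≤-⇒≤ {a} {b} h = subst₂ _≤_ (+-identityˡ a) (cancel₁ a b) (+-monoˡ-≤ a h)

  ≤-by : ∀ {a b} d → 0ℚ ≤ d → b ≡ a + d → a ≤ b
  ≤-by {a} d 0≤d refl = subst (_≤ a + d) (+-identityʳ a) (+-monoʳ-≤ a 0≤d)

  x-y≤x : ∀ {x y} → 0ℚ ≤ y → x - y ≤ x
  x-y≤x {x} {y} 0≤y = ≤-by y 0≤y (sym (cancel₁ y x))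

  mix : ℚ → ℚ → ℚ → ℚ
  mix q a b = (1ℚ - q) * a + q * b

  record Prob (q : ℚ) : Set where
    constructor prob
    field
      lo : 0ℚ ≤ q
      hi : q ≤ 1ℚ
  open Prob public

  private
    cheb : ∀ q a b c d → ((1ℚ - q) * (a * c) + q * (b * d))
         ≡ ((1ℚ - q) * a + q * b) * ((1ℚ - q) * c + q * d) + q * (1ℚ - q) * ((b - a) * (d - c))
    cheb = solve-∀ ℚ-ring
    neg*neg : ∀ a b c d → (a - b) * (c - d) ≡ (b - a) * (d - c)
    neg*neg = solve-∀ ℚ-ring

  mix-id : ∀ q a → mix q a a ≡ a
  mix-id = lem
    where
    lem : ∀ q a → (1ℚ - q) * a + q * a ≡ a
    lem = solve-∀ ℚ-ring

  mix-add : ∀ q a b c d → mix q (a + c) (b + d) ≡ mix q a b + mix q c d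
  mix-add = lem
    where
    lem : ∀ q a b c d → (1ℚ - q) * (a + c) + q * (b + d) ≡ ((1ℚ - q) * a + q * b) + ((1ℚ - q) * c + q * d)
    lem = solve-∀ ℚ-ring

  mix-scale : ∀ q k a b → mix q (k * a) (k * b) ≡ k * mix q a b
  mix-scale = lem
    where
    lem : ∀ q k a b → (1ℚ - q) * (k * a) + q * (k * b) ≡ k * ((1ℚ - q) * a + q * b)
    lem = solve-∀ ℚ-ring

  mix-mono : ∀ {q a b c d} → Prob q → a ≤ c → b ≤ d → mix q a b ≤ mix q c d
  mix-mono p a≤c b≤d = +-mono-≤ (*-monoˡ (≤⇒0≤- (hi p)) a≤c) (*-monoˡ (lo p) b≤d)

  mix-≥0 : ∀ {q a b} → Prob q → 0ℚ ≤ a → 0ℚ ≤ b → 0ℚ ≤ mix q a b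
  mix-≥0 p 0≤a 0≤b = 0≤+ (0≤* (≤⇒0≤- (hi p)) 0≤a) (0≤* (lo p) 0≤b)

  mix-≤ : ∀ {q a b c} → Prob q → a ≤ c → b ≤ c → mix q a b ≤ c
  mix-≤ {q} {c = c} p a≤c b≤c = subst (_ ≤_) (mix-id q c) (mix-mono p a≤c b≤c)

  mix-≥ : ∀ {q a b c} → Prob q → c ≤ a → c ≤ b → c ≤ mix q a b
  mix-≥ {q} {c = c} p c≤a c≤b = subst (_≤ _) (mix-id q c) (mix-mono p c≤a c≤b)

  -- The two sides differ by the covariance `q * (1ℚ - q) * ((b - a) * (d - c))`.
  mix-cheb : ∀ {q a b c d} → Prob q → a ≤ b → c ≤ d → mix q a b * mix q c d ≤ mix q (a * c) (b * d)
  mix-cheb {q} {a} {b} {c} {d} p a≤b c≤d =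
    ≤-by (q * (1ℚ - q) * ((b - a) * (d - c)))
      (0≤* (0≤* (lo p) (≤⇒0≤- (hi p))) (0≤* (≤⇒0≤- a≤b) (≤⇒0≤- c≤d))) (cheb q a b c d)

  private
    cheb-anti : ∀ q a b c d → ((1ℚ - q) * a + q * b) * ((1ℚ - q) * c + q * d)
              ≡ ((1ℚ - q) * (a * c) + q * (b * d)) + q * (1ℚ - q) * ((b - a) * (c - d))
    cheb-anti = solve-∀ ℚ-ring

  mix-cheb-anti : ∀ {q a b c d} → Prob q → a ≤ b → d ≤ c → mix q (a * c) (b * d) ≤ mix q a b * mix q c d
  mix-cheb-anti {q} {a} {b} {c} {d} p a≤b d≤c =
    ≤-by (q * (1ℚ - q) * ((b - a) * (c - d)))
      (0≤* (0≤* (lo p) (≤⇒0≤- (hi p))) (0≤* (≤⇒0≤- a≤b) (≤⇒0≤- d≤c))) (cheb-anti q a b c d)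

  ^-≥0 : ∀ {x} n → 0ℚ ≤ x → 0ℚ ≤ x ^ n
  ^-≥0 zero    _   = 0≤1
  ^-≥0 (suc n) 0≤x = 0≤* 0≤x (^-≥0 n 0≤x)

  ^-mono : ∀ {x y} n → 0ℚ ≤ x → x ≤ y → x ^ n ≤ y ^ n
  ^-mono zero    _   _   = ≤-refl
  ^-mono (suc n) 0≤x x≤y = *-mono 0≤x (^-≥0 n (≤-trans 0≤x x≤y)) x≤y (^-mono n 0≤x x≤y)

  1^ : ∀ n → 1ℚ ^ n ≡ 1ℚ
  1^ zero    = refl
  1^ (suc n) = trans (*-identityˡ _) (1^ n)

  private
    swap4 : ∀ a b c d → (a * b) * (c * d) ≡ (a * c) * (b * d)
    swap4 = solve-∀ ℚ-ring

  ^-distrib-* : ∀ x y n → (x * y) ^ n ≡ x ^ n * y ^ n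
  ^-distrib-* x y zero    = refl
  ^-distrib-* x y (suc n) = trans (cong (x * y *_) (^-distrib-* x y n)) (swap4 x y (x ^ n) (y ^ n))

  ^-+ : ∀ x m n → x ^ (m ℕ.+ n) ≡ x ^ m * x ^ n
  ^-+ x zero    n = sym (*-identityˡ _)
  ^-+ x (suc m) n = trans (cong (x *_) (^-+ x m n)) (sym (*-assoc x _ _))

  ^-* : ∀ x m n → x ^ (m ℕ.* n) ≡ (x ^ n) ^ m
  ^-* x zero    n = refl
  ^-* x (suc m) n = trans (^-+ x n (m ℕ.* n)) (cong (x ^ n *_) (^-* x m n))

  ^-≤1 : ∀ {x} n → 0ℚ ≤ x → x ≤ 1ℚ → x ^ n ≤ 1ℚ
  ^-≤1 {x} n 0≤x x≤1 = subst (x ^ n ≤_) (1^ n) (^-mono n 0≤x x≤1)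

  -- By induction, with Chebyshev's sum inequality.
  mix-^ : ∀ {q a b} n → Prob q → 0ℚ ≤ a → 0ℚ ≤ b → mix q a b ^ n ≤ mix q (a ^ n) (b ^ n)
  mix-^ {q} zero p _ _ = ≤-reflexive (sym (mix-id q 1ℚ))
  mix-^ {q} {a} {b} (suc n) p 0≤a 0≤b =
    ≤-trans (*-monoˡ (mix-≥0 p 0≤a 0≤b) (mix-^ n p 0≤a 0≤b)) (aux (≤-total a b))
    where
    aux : a ≤ b ⊎ b ≤ a → mix q a b * mix q (a ^ n) (b ^ n) ≤ mix q (a * a ^ n) (b * b ^ n)
    aux (inj₁ a≤b) = mix-cheb p a≤b (^-mono n 0≤a a≤b)
    aux (inj₂ b≤a) = ≤-by (q * (1ℚ - q) * ((b - a) * (b ^ n - a ^ n)))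
      (0≤* (0≤* (lo p) (≤⇒0≤- (hi p)))
        (subst (0ℚ ≤_) (neg*neg a b (a ^ n) (b ^ n)) (0≤* (≤⇒0≤- b≤a) (≤⇒0≤- (^-mono n 0≤b b≤a)))))
      (cheb q a b (a ^ n) (b ^ n))

  -- Recursive, so that `ι (suc n)` unfolds to `1ℚ + ι n` in ring equations; `/1≡ι` links it to the
  -- fractions in the definition of expected time.
  ι : ℕ → ℚ
  ι zero    = 0ℚ
  ι (suc n) = 1ℚ + ι n

  0≤ι : ∀ n → 0ℚ ≤ ι n
  0≤ι zero    = ≤-refl
  0≤ι (suc n) = 0≤+ 0≤1 (0≤ι n)

  ι-+ : ∀ m n → ι (m ℕ.+ n) ≡ ι m + ι n
  ι-+ zero    n = sym (+-identityˡ _)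
  ι-+ (suc m) n = trans (cong (λ z → 1ℚ + z) (ι-+ m n)) (sym (+-assoc 1ℚ (ι m) (ι n)))

  private
    dist1 : ∀ a b → b + a * b ≡ (1ℚ + a) * b
    dist1 = solve-∀ ℚ-ring

  ι-* : ∀ m n → ι (m ℕ.* n) ≡ ι m * ι n
  ι-* zero    n = sym (*-zeroˡ (ι n))
  ι-* (suc m) n = trans (ι-+ n (m ℕ.* n)) (trans (cong (λ z → ι n + z) (ι-* m n)) (dist1 (ι m) (ι n)))

  ι-^ : ∀ m n → ι (m ℕ.^ n) ≡ ι m ^ n
  ι-^ m zero    = +-identityʳ 1ℚ
  ι-^ m (suc n) = trans (ι-* m (m ℕ.^ n)) (cong (ι m *_) (ι-^ m n))

  ι-mono : ∀ {m n} → m ℕ.≤ n → ι m ≤ ι n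
  ι-mono {n = n} ℕ.z≤n = 0≤ι n
  ι-mono (ℕ.s≤s m≤n) = +-monoʳ-≤ 1ℚ (ι-mono m≤n)

  /1≡ι : ∀ n → + n / 1 ≡ ι n
  /1≡ι zero    = refl
  /1≡ι (suc n) = trans eqℚ (cong (λ z → 1ℚ + z) (/1≡ι n))
    where
    eqℚ : + suc n / 1 ≡ 1ℚ + + n / 1
    eqℚ = toℚᵘ-injective (ℚᵘP.≃-trans (toℚᵘ-fromℚᵘ (ℚᵘ.mkℚᵘ (+ suc n) 0))
      (ℚᵘP.≃-trans (ℚᵘ.*≡* eq)
      (ℚᵘP.≃-sym (ℚᵘP.≃-trans (toℚᵘ-homo-+ 1ℚ (+ n / 1)) (ℚᵘP.+-congʳ ℚᵘ.1ℚᵘ (toℚᵘ-fromℚᵘ (ℚᵘ.mkℚᵘ (+ n) 0)))))))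
      where
      eq : + suc n ℤ.* + 1 ≡ (+ 1 ℤ.* + 1 ℤ.+ + n ℤ.* + 1) ℤ.* + 1
      eq = cong (ℤ._* + 1) (cong (λ z → + 1 ℤ.+ z) (sym (ℤP.*-identityʳ (+ n))))

  /≡ι* : ∀ a b .{{_ : ℕ.NonZero b}} → (+ a / b) * ι b ≡ ι a
  /≡ι* a b@(suc b-1) = trans (cong (+ a / b *_) (sym (/1≡ι b))) (trans eqℚ (/1≡ι a))
    where
    eqℚ : (+ a / b) * (+ b / 1) ≡ + a / 1
    eqℚ = toℚᵘ-injective (ℚᵘP.≃-trans (toℚᵘ-homo-* (+ a / b) (+ b / 1))
      (ℚᵘP.≃-trans (ℚᵘP.*-cong (toℚᵘ-fromℚᵘ (ℚᵘ.mkℚᵘ (+ a) b-1)) (toℚᵘ-fromℚᵘ (ℚᵘ.mkℚᵘ (+ b) 0)))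
      (ℚᵘP.≃-trans (ℚᵘ.*≡* eq) (ℚᵘP.≃-sym (toℚᵘ-fromℚᵘ (ℚᵘ.mkℚᵘ (+ a) 0))))))
      where
      eq : + a ℤ.* + b ℤ.* + 1 ≡ + a ℤ.* (+ b ℤ.* + 1)
      eq = ℤP.*-assoc (+ a) (+ b) (+ 1)

  -- Shared by sums over `Fin n`, sums over assignments or solutions, coin expectations and `avgs`.
  record Functional {A : Set} (L : (A → ℚ) → ℚ) : Set where
    field
      add   : ∀ f g → L (λ x → f x + g x) ≡ L f + L g
      scale : ∀ c f → L (λ x → c * f x) ≡ c * L f
      mono  : ∀ {f g} → (∀ x → f x ≤ g x) → L f ≤ L g

    ext : ∀ {f g} → (∀ x → f x ≡ g x) → L f ≡ L g
    ext f≡g = ≤-antisym (mono (λ x → ≤-reflexive (f≡g x))) (mono (λ x → ≤-reflexive (sym (f≡g x))))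

    zero-on : ∀ {f} → (∀ x → f x ≡ 0ℚ) → L f ≡ 0ℚ
    zero-on {f} f≡0 = trans (ext (λ x → trans (f≡0 x) (sym (*-zeroˡ 0ℚ))))
                            (trans (scale 0ℚ (λ _ → 0ℚ)) (*-zeroˡ (L (λ _ → 0ℚ))))

    ≥0 : ∀ {f} → (∀ x → 0ℚ ≤ f x) → 0ℚ ≤ L f
    ≥0 {f} h = subst (_≤ L f) (zero-on (λ _ → refl)) (mono h)

    mixed : ∀ q f g → L (λ x → mix q (f x) (g x)) ≡ mix q (L f) (L g)
    mixed q f g = trans (add (λ x → (1ℚ - q) * f x) (λ x → q * g x)) (cong₂ _+_ (scale (1ℚ - q) f) (scale q g))

  ∑F : ∀ n → (Fin n → ℚ) → ℚ
  ∑F zero    f = 0ℚ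
  ∑F (suc n) f = f zero + ∑F n (f ∘ suc)

  ∑V : ∀ n → (Vec Bool n → ℚ) → ℚ
  ∑V zero    f = f []
  ∑V (suc n) f = ∑V n (λ v → f (false ∷ v)) + ∑V n (λ v → f (true ∷ v))

  private
    swap+ : ∀ a b c d → (a + b) + (c + d) ≡ (a + c) + (b + d)
    swap+ = solve-∀ ℚ-ring

  ∑F-functional : ∀ n → Functional (∑F n)
  ∑F-functional zero = record { add = λ _ _ → refl ; scale = λ c _ → sym (*-zeroʳ c) ; mono = λ _ → ≤-refl }
  ∑F-functional (suc n) = record
    { add = λ f g → trans (cong (λ z → f zero + g zero + z) (add (f ∘ suc) (g ∘ suc))) (swap+ (f zero) (g zero) (∑F n (f ∘ suc)) (∑F n (g ∘ suc)))
    ; scale = λ c f → trans (cong (λ z → c * f zero + z) (scale c (f ∘ suc))) (sym (*-distribˡ-+ c (f zero) (∑F n (f ∘ suc))))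
    ; mono = λ h → +-mono-≤ (h zero) (mono (λ i → h (suc i)))
    } where open Functional (∑F-functional n)

  ∑V-functional : ∀ n → Functional (∑V n)
  ∑V-functional zero = record { add = λ _ _ → refl ; scale = λ _ _ → refl ; mono = λ h → h [] }
  ∑V-functional (suc n) = record
    { add = λ f g → trans (cong₂ _+_ (add (λ v → f (false ∷ v)) (λ v → g (false ∷ v))) (add (λ v → f (true ∷ v)) (λ v → g (true ∷ v)))) (swap+ (∑V n (λ v → f (false ∷ v))) (∑V n (λ v → g (false ∷ v))) (∑V n (λ v → f (true ∷ v))) (∑V n (λ v → g (true ∷ v))))
    ; scale = λ c f → trans (cong₂ _+_ (scale c (λ v → f (false ∷ v))) (scale c (λ v → f (true ∷ v)))) (sym (*-distribˡ-+ c (∑V n (λ v → f (false ∷ v))) (∑V n (λ v → f (true ∷ v)))))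
    ; mono = λ h → +-mono-≤ (mono (λ v → h (false ∷ v))) (mono (λ v → h (true ∷ v)))
    } where open Functional (∑V-functional n)

  𝔼-functional : ∀ n → Functional (𝔼 n)
  𝔼-functional zero = record { add = λ _ _ → refl ; scale = λ _ _ → refl ; mono = λ h → h [] }
  𝔼-functional (suc n) = record
    { add = λ f g → trans (cong (½ *_) (trans (cong₂ _+_ (add (λ v → f (false ∷ v)) (λ v → g (false ∷ v))) (add (λ v → f (true ∷ v)) (λ v → g (true ∷ v)))) (swap+ (𝔼 n (λ v → f (false ∷ v))) (𝔼 n (λ v → g (false ∷ v))) (𝔼 n (λ v → f (true ∷ v))) (𝔼 n (λ v → g (true ∷ v)))))) (*-distribˡ-+ ½ (𝔼 n (λ v → f (false ∷ v)) + 𝔼 n (λ v → f (true ∷ v))) (𝔼 n (λ v → g (false ∷ v)) + 𝔼 n (λ v → g (true ∷ v))))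
    ; scale = λ c f → trans (cong (½ *_) (trans (cong₂ _+_ (scale c (λ v → f (false ∷ v))) (scale c (λ v → f (true ∷ v)))) (sym (*-distribˡ-+ c (𝔼 n (λ v → f (false ∷ v))) (𝔼 n (λ v → f (true ∷ v))))))) (com ½ c (𝔼 n (λ v → f (false ∷ v)) + 𝔼 n (λ v → f (true ∷ v))))
    ; mono = λ h → *-monoˡ 0≤½ (+-mono-≤ (mono (λ v → h (false ∷ v))) (mono (λ v → h (true ∷ v))))
    } where
      open Functional (𝔼-functional n)
      com : ∀ a b c → a * (b * c) ≡ b * (a * c)
      com = solve-∀ ℚ-ring

  ½-avg : ∀ a → ½ * (a + a) ≡ a
  ½-avg a = trans (lem ½ a) (*-identityˡ a)
    where
    lem : ∀ h a → h * (a + a) ≡ (h + h) * a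
    lem = solve-∀ ℚ-ring

  𝔼-const : ∀ n c → 𝔼 n (λ _ → c) ≡ c
  𝔼-const zero    c = refl
  𝔼-const (suc n) c = trans (cong (λ z → ½ * (z + z)) (𝔼-const n c)) (½-avg c)

  ∑F-bound : ∀ n {f c} → (∀ i → f i ≤ c) → ∑F n f ≤ ι n * c
  ∑F-bound zero    {c = c} h = ≤-reflexive (sym (*-zeroˡ c))
  ∑F-bound (suc n) {c = c} h = subst (_ ≤_) (dist1 (ι n) c) (+-mono-≤ (h zero) (∑F-bound n (λ i → h (suc i))))

  indicator : Bool → ℚ
  indicator b = if b then 1ℚ else 0ℚ

  0≤indicator : ∀ b → 0ℚ ≤ indicator b
  0≤indicator false = ≤-refl
  0≤indicator true  = 0≤1

  indicator≤1 : ∀ b → indicator b ≤ 1ℚ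
  indicator≤1 false = 0≤1
  indicator≤1 true  = ≤-refl

  indicator-mono : ∀ {a b} → (a ≡ true → b ≡ true) → indicator a ≤ indicator b
  indicator-mono {false} {b} h = 0≤indicator b
  indicator-mono {true}  {b} h rewrite h refl = ≤-refl

-- Partial assignments and refutation by branching to bounded depth.

module Refutation where

  open import Data.Bool using (T)
  open import Data.Fin using (_≟_)
  open import Data.Nat using (ℕ; zero; suc)

  Formula : ℕ → Set
  Formula n = List (List (Literal n))

  True : ∀ {n} → Assignment n → Literal n → Set
  True α l = lookup α (var l) ≡ proj₂ l

  Models : ∀ {n} → Assignment n → Formula n → Set
  Models α Φ = All (Any (True α)) Φ

  Partial : ℕ → Set
  Partial n = Vec (Maybe Bool) n

  assign : ∀ {n} → Partial n → Literal n → Partial n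
  assign ρ (x , b) = ρ [ x ]≔ just b

  infix 4 _⊑_ _≼_

  record _⊑_ {n} (ρ σ : Partial n) : Set where
    constructor extends
    field keeps : ∀ x b → lookup ρ x ≡ just b → lookup σ x ≡ just b

  record _≼_ {n} (ρ : Partial n) (α : Assignment n) : Set where
    constructor agrees
    field at : ∀ x b → lookup ρ x ≡ just b → lookup α x ≡ b

  open _⊑_ public
  open _≼_ public

  falsified : ∀ {n} → Partial n → Literal n → Bool
  falsified ρ (x , b) with lookup ρ x
  ... | just c  = b xor c
  ... | nothing = false

  -- Takes the place of bounded-width resolution: it derives no new clauses, and a refutation found
  -- for some clause tree of depth `d` remains one when more variables are assigned
  -- (`refuted-mono`).
  refuted : ∀ {n} → Formula n → ℕ → Partial n → Bool
  refuted Φ zero    ρ = false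
  refuted Φ (suc d) ρ = any (all (λ l → falsified ρ l ∨ refuted Φ d (assign ρ l))) Φ

  assign-same : ∀ {n} (ρ : Partial n) x b → lookup (assign ρ (x , b)) x ≡ just b
  assign-same ρ x b = lookup∘update x ρ (just b)

  assign-other : ∀ {n} (ρ : Partial n) {x z} b → x ≢ z → lookup (assign ρ (x , b)) z ≡ lookup ρ z
  assign-other ρ b x≢z = lookup∘update′ (x≢z ∘ sym) ρ (just b)

  ⊑-trans : ∀ {n} {ρ σ τ : Partial n} → ρ ⊑ σ → σ ⊑ τ → ρ ⊑ τ
  ⊑-trans h k = extends λ x b eq → keeps k x b (keeps h x b eq)

  ⊑-≼-trans : ∀ {n} {ρ σ : Partial n} {α} → ρ ⊑ σ → σ ≼ α → ρ ≼ α
  ⊑-≼-trans h k = agrees λ x b eq → at k x b (keeps h x b eq)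

  assign-mono : ∀ {n} {ρ σ : Partial n} l → ρ ⊑ σ → assign ρ l ⊑ assign σ l
  assign-mono {ρ = ρ} {σ} (x , c) h = extends kept
    where
    kept : ∀ z b → lookup (assign ρ (x , c)) z ≡ just b → lookup (assign σ (x , c)) z ≡ just b
    kept z b eq with x ≟ z
    ... | yes refl = trans (assign-same σ x c) (trans (sym (assign-same ρ x c)) eq)
    ... | no x≢z   = trans (assign-other σ c x≢z) (keeps h z b (trans (sym (assign-other ρ c x≢z)) eq))

  assign-≼ : ∀ {n} {ρ : Partial n} {α} l → ρ ≼ α → True α l → assign ρ l ≼ α
  assign-≼ {ρ = ρ} {α} (x , c) h t = agrees agreed
    where
    agreed : ∀ z b → lookup (assign ρ (x , c)) z ≡ just b → lookup α z ≡ b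
    agreed z b eq with x ≟ z
    ... | yes refl = trans t (just-injective (trans (sym (assign-same ρ x c)) eq))
    ... | no x≢z   = at h z b (trans (sym (assign-other ρ c x≢z)) eq)

  xor-not : ∀ b → (b xor not b) ≡ true
  xor-not false = refl
  xor-not true  = refl

  xor-self : ∀ b → (b xor b) ≡ false
  xor-self false = refl
  xor-self true  = refl

  falsified-just : ∀ {n} (ρ : Partial n) {x c} b → lookup ρ x ≡ just c → falsified ρ (x , b) ≡ (b xor c)
  falsified-just ρ {x} b eq with lookup ρ x
  falsified-just ρ b refl | just _ = refl

  falsified-mono : ∀ {n} {ρ σ : Partial n} l → ρ ⊑ σ → T (falsified ρ l) → T (falsified σ l)
  falsified-mono {ρ = ρ} {σ} (x , b) h t with lookup ρ x in eq
  ... | just c rewrite falsified-just σ b (keeps h x c eq) = t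

  falsified-sound : ∀ {n} {ρ : Partial n} {α} l → ρ ≼ α → T (falsified ρ l) → ¬ True α l
  falsified-sound {ρ = ρ} (x , b) h t e with lookup ρ x in eq
  ... | just c with trans (sym e) (at h x c eq)
  ... | refl rewrite xor-self b = t

  refuted-mono : ∀ {n} (Φ : Formula n) d {ρ σ} → ρ ⊑ σ → T (refuted Φ d ρ) → T (refuted Φ d σ)
  refuted-mono Φ (suc d) {ρ} {σ} h t =
    any⁺ _ (Any.map (λ {C} u → all⁻ _ (All.map (λ {l} → literal l) (all⁺ _ C u))) (any⁻ _ Φ t))
    where
    literal : ∀ l → T (falsified ρ l ∨ refuted Φ d (assign ρ l)) → T (falsified σ l ∨ refuted Φ d (assign σ l))
    literal l u with to T-∨ u
    ... | inj₁ f = from T-∨ (inj₁ (falsified-mono {ρ = ρ} {σ} l h f))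
    ... | inj₂ r = from T-∨ (inj₂ (refuted-mono Φ d (assign-mono {ρ = ρ} {σ} l h) r))

  -- A model makes some literal of the refuted clause true, and neither falsification nor, by
  -- induction, a refutation of that branch is possible.
  refuted-sound : ∀ {n} {Φ : Formula n} {α} d {ρ} → Models α Φ → ρ ≼ α → ¬ T (refuted Φ d ρ)
  refuted-sound {Φ = Φ} {α} (suc d) {ρ} m h t = contradictory m (any⁻ _ Φ t)
    where
    clause : ∀ {C} → Any (True α) C → All (λ l → T (falsified ρ l ∨ refuted Φ d (assign ρ l))) C → ⊥
    clause {l ∷ _} (here e) (u ∷ _) with to T-∨ u
    ... | inj₁ f = falsified-sound {ρ = ρ} l h f e
    ... | inj₂ r = refuted-sound d m (assign-≼ {ρ = ρ} l h e) r
    clause (there a) (_ ∷ us) = clause a us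
    contradictory : ∀ {Ψ} → All (Any (True α)) Ψ → Any (λ C → T (all (λ l → falsified ρ l ∨ refuted Φ d (assign ρ l)) C)) Ψ → ⊥
    contradictory (c ∷ _) (here {x = C} u) = clause c (all⁺ _ C u)
    contradictory (_ ∷ cs) (there u) = contradictory cs u

  reveal : ∀ {n} → Assignment n → Fin n → Partial n → Partial n
  reveal α x ρ = ρ [ x ]≔ just (lookup α x)

  reveal-≼ : ∀ {n} {ρ : Partial n} {α} x → ρ ≼ α → reveal α x ρ ≼ α
  reveal-≼ {ρ = ρ} {α} x h = assign-≼ {ρ = ρ} (x , lookup α x) h refl

  reveal-⊑ : ∀ {n} {ρ : Partial n} {α} x → ρ ≼ α → ρ ⊑ reveal α x ρ
  reveal-⊑ {ρ = ρ} {α} x h = extends kept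
    where
    kept : ∀ z b → lookup ρ z ≡ just b → lookup (reveal α x ρ) z ≡ just b
    kept z b eq with x ≟ z
    ... | yes refl = trans (assign-same ρ x _) (cong just (at h z b eq))
    ... | no x≢z   = trans (assign-other ρ _ x≢z) eq

  reveal-comm : ∀ {n} (ρ : Partial n) α x z → reveal α x (reveal α z ρ) ≡ reveal α z (reveal α x ρ)
  reveal-comm ρ α x z with x ≟ z
  ... | yes refl = refl
  ... | no x≢z   = []≔-commutes ρ z x (x≢z ∘ sym)

  reveal-known : ∀ {n} {ρ : Partial n} {α} x {b} → ρ ≼ α → lookup ρ x ≡ just b → reveal α x ρ ≡ ρ
  reveal-known {ρ = ρ} {α} x h eq =
    trans (cong (ρ [ x ]≔_) (trans (cong just (at h x _ eq)) (sym eq))) ([]≔-lookup ρ x)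

  forced : ∀ {n} → Formula n → ℕ → Partial n → Fin n → Maybe Bool
  forced Φ d ρ x with refuted Φ d (assign ρ (x , true)) | refuted Φ d (assign ρ (x , false))
  ... | true  | _     = just false
  ... | false | true  = just true
  ... | false | false = nothing

  forced-sound : ∀ {n} {Φ : Formula n} {α} d {ρ x b} → Models α Φ → ρ ≼ α → forced Φ d ρ x ≡ just b → lookup α x ≡ b
  forced-sound {Φ = Φ} {α} d {ρ} {x} m h eq
    with refuted Φ d (assign ρ (x , true)) in t | refuted Φ d (assign ρ (x , false)) in f | lookup α x in e
  forced-sound d {ρ} {x} m h refl | true  | _    | false = refl
  forced-sound d {ρ} {x} m h refl | true  | _    | true  =
    ⊥-elim (refuted-sound d m (assign-≼ {ρ = ρ} (x , true) h e) (from T-≡ t))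
  forced-sound d {ρ} {x} m h refl | false | true | true  = refl
  forced-sound d {ρ} {x} m h refl | false | true | false =
    ⊥-elim (refuted-sound d m (assign-≼ {ρ = ρ} (x , false) h e) (from T-≡ f))

  forced-complete : ∀ {n} {Φ : Formula n} {d ρ} x b → T (refuted Φ d (assign ρ (x , b))) → forced Φ d ρ x ≢ nothing
  forced-complete {Φ = Φ} {d} {ρ} x b t eq
    with refuted Φ d (assign ρ (x , true)) in r | refuted Φ d (assign ρ (x , false)) in r′
  forced-complete x false t eq | false | false rewrite r′ = t
  forced-complete x true  t eq | false | false rewrite r  = t

-- Critical clause trees and Harris' inequality.

module Cuts where

  open Arithmetic
  open Refutation
  open import Data.Bool using (T)
  open import Data.Fin using (_≟_)
  open import Data.Nat as ℕ using (ℕ; zero; suc)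
  open import Data.Rational hiding (_≟_)
  open import Data.Rational.Properties hiding (_≟_)
  open import Tactic.RingSolver

  -- A product measure: each visit acts independently of the others, and revealing a variable for
  -- the second time changes nothing.
  avgs : ∀ {n} → ℚ → Assignment n → List (Fin n) → (Partial n → ℚ) → Partial n → ℚ
  avgs q α []      h ρ = h ρ
  avgs q α (x ∷ s) h ρ = mix q (avgs q α s h ρ) (avgs q α s h (reveal α x ρ))

  chance : ∀ {n} → ℚ → List (Fin n) → Fin n → ℚ
  chance q []      z = 0ℚ
  chance q (x ∷ s) z with x ≟ z
  ... | yes _ = mix q (chance q s z) 1ℚ
  ... | no  _ = chance q s z

  private
    mix-0 : ∀ a b → (1ℚ - 0ℚ) * a + 0ℚ * b ≡ a
    mix-0 = solve-∀ ℚ-ring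
    mix-nest : ∀ q r e → (1ℚ - ((1ℚ - q) * r + q * 1ℚ)) * e + ((1ℚ - q) * r + q * 1ℚ) * 1ℚ
             ≡ (1ℚ - q) * ((1ℚ - r) * e + r * 1ℚ) + q * 1ℚ
    mix-nest = solve-∀ ℚ-ring
    mix-swap : ∀ q r a b → (1ℚ - r) * ((1ℚ - q) * a + q * b) + r * 1ℚ
             ≡ (1ℚ - q) * ((1ℚ - r) * a + r * 1ℚ) + q * ((1ℚ - r) * b + r * 1ℚ)
    mix-swap = solve-∀ ℚ-ring
    mix-up : ∀ r c e → (1ℚ - c) * e + c * 1ℚ ≡ ((1ℚ - r) * e + r * 1ℚ) + (c - r) * (1ℚ - e)
    mix-up = solve-∀ ℚ-ring

  mix1-mono : ∀ {r c e f} → Prob r → r ≤ c → e ≤ f → f ≤ 1ℚ → mix r e 1ℚ ≤ mix c f 1ℚ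
  mix1-mono {r} {c} {e} {f} pr r≤c e≤f f≤1 = ≤-trans (mix-mono pr e≤f ≤-refl)
    (≤-by ((c - r) * (1ℚ - f)) (0≤* (≤⇒0≤- r≤c) (≤⇒0≤- f≤1)) (mix-up r c f))

  mix-prob : ∀ {q r s} → Prob q → Prob r → Prob s → Prob (mix q r s)
  mix-prob q r s = prob (mix-≥0 q (lo r) (lo s)) (mix-≤ q (hi r) (hi s))

  prob0 : Prob 0ℚ
  prob0 = prob ≤-refl 0≤1

  prob1 : Prob 1ℚ
  prob1 = prob 0≤1 ≤-refl

  chance-prob : ∀ {n q} → Prob q → ∀ s (z : Fin n) → Prob (chance q s z)
  chance-prob p []      z = prob0
  chance-prob p (x ∷ s) z with x ≟ z
  ... | yes _ = mix-prob p (chance-prob p s z) prob1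
  ... | no  _ = chance-prob p s z

  module _ {n : ℕ} (q : ℚ) (pq : Prob q) (α : Assignment n) where

    avgs-functional : ∀ s ρ → Functional (λ h → avgs q α s h ρ)
    avgs-functional [] ρ = record { add = λ _ _ → refl ; scale = λ _ _ → refl ; mono = λ h → h ρ }
    avgs-functional (x ∷ s) ρ = record
      { add = λ f g → trans (cong₂ (mix q) (A.add f g) (B.add f g))
                            (mix-add q (avgs q α s f ρ) (avgs q α s f ρ′) (avgs q α s g ρ) (avgs q α s g ρ′))
      ; scale = λ c f → trans (cong₂ (mix q) (A.scale c f) (B.scale c f)) (mix-scale q c (avgs q α s f ρ) (avgs q α s f ρ′))
      ; mono = λ h → mix-mono pq (A.mono h) (B.mono h) }
      where
      ρ′ = reveal α x ρ
      module A = Functional (avgs-functional s ρ)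
      module B = Functional (avgs-functional s ρ′)

    avgs-const : ∀ s c ρ → avgs q α s (λ _ → c) ρ ≡ c
    avgs-const []      c ρ = refl
    avgs-const (x ∷ s) c ρ = trans (cong₂ (mix q) (avgs-const s c ρ) (avgs-const s c (reveal α x ρ))) (mix-id q c)

    avgs-++ : ∀ s t h ρ → avgs q α (s ++ t) h ρ ≡ avgs q α s (avgs q α t h) ρ
    avgs-++ []      t h ρ = refl
    avgs-++ (x ∷ s) t h ρ = cong₂ (mix q) (avgs-++ s t h ρ) (avgs-++ s t h (reveal α x ρ))

    avgs-mono : ∀ s {g h ρ} → ρ ≼ α → (∀ σ → ρ ⊑ σ → σ ≼ α → g σ ≤ h σ) → avgs q α s g ρ ≤ avgs q α s h ρ
    avgs-mono []      {ρ = ρ} ρ≼α g≤h = g≤h ρ (extends λ _ _ e → e) ρ≼α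
    avgs-mono (x ∷ s) {ρ = ρ} ρ≼α g≤h = mix-mono pq (avgs-mono s ρ≼α g≤h)
      (avgs-mono s (reveal-≼ x ρ≼α) λ σ r → g≤h σ (⊑-trans (reveal-⊑ x ρ≼α) r))

    Increasing : (Partial n → ℚ) → Set
    Increasing h = ∀ ρ x → ρ ≼ α → h ρ ≤ h (reveal α x ρ)

    avgs-increasing : ∀ s {h} → Increasing h → Increasing (avgs q α s h)
    avgs-increasing []      inc = inc
    avgs-increasing (x ∷ s) {h} inc ρ z ρ≼α = mix-mono pq (avgs-increasing s inc ρ z ρ≼α)
      (subst (λ σ → avgs q α s h (reveal α x ρ) ≤ avgs q α s h σ) (reveal-comm ρ α z x)
        (avgs-increasing s inc (reveal α x ρ) z (reveal-≼ x ρ≼α)))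

    -- Induction over the visits: conditioned on one visit the two averages are still increasing, so
    -- `mix-cheb` handles the two-point distribution of that visit.
    harris : ∀ s {g h ρ} → Increasing g → Increasing h → ρ ≼ α →
             avgs q α s g ρ * avgs q α s h ρ ≤ avgs q α s (λ σ → g σ * h σ) ρ
    harris []      _  _  _ = ≤-refl
    harris (x ∷ s) {ρ = ρ} ig ih ρ≼α = ≤-trans
      (mix-cheb pq (avgs-increasing s ig ρ x ρ≼α) (avgs-increasing s ih ρ x ρ≼α))
      (mix-mono pq (harris s ig ih ρ≼α) (harris s ig ih (reveal-≼ x ρ≼α)))

    avgs-invariant : ∀ s {h} z → (∀ ρ → h (reveal α z ρ) ≡ h ρ) → ∀ ρ → avgs q α s h (reveal α z ρ) ≡ avgs q α s h ρ
    avgs-invariant []      z inv ρ = inv ρ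
    avgs-invariant (x ∷ s) {h} z inv ρ = cong₂ (mix q) (avgs-invariant s z inv ρ)
      (trans (cong (avgs q α s h) (reveal-comm ρ α x z)) (avgs-invariant s z inv (reveal α x ρ)))

    -- Conditioning on whether `z` gets revealed: afterwards `g` is at least 1, and otherwise at
    -- least `e`, whose average does not depend on this event because `e` ignores `z`.
    avgs-reveal : ∀ s {g e : Partial n → ℚ} z →
      (∀ σ b → σ ≼ α → lookup σ z ≡ just b → 1ℚ ≤ g σ) → (∀ σ → e σ ≤ g σ) → (∀ σ → e (reveal α z σ) ≡ e σ) →
      ∀ {ρ} → ρ ≼ α → mix (chance q s z) (avgs q α s e ρ) 1ℚ ≤ avgs q α s g ρ
    avgs-reveal [] {g} {e} z 1≤g e≤g inv {ρ} ρ≼α = subst (_≤ g ρ) (sym (mix-0 (e ρ) 1ℚ)) (e≤g ρ)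
    avgs-reveal (x ∷ s) {g} {e} z 1≤g e≤g inv {ρ} ρ≼α with x ≟ z
    ... | yes refl = subst (_≤ avgs q α (x ∷ s) g ρ)
      (sym (trans (cong (λ w → mix (mix q r 1ℚ) w 1ℚ)
             (trans (cong (mix q E) (avgs-invariant s x inv ρ)) (mix-id q E)))
           (mix-nest q r E)))
      (mix-mono pq (avgs-reveal s z 1≤g e≤g inv ρ≼α)
        (subst (_≤ avgs q α s g (reveal α x ρ)) (avgs-const s 1ℚ (reveal α x ρ))
          (avgs-mono s (reveal-≼ x ρ≼α) λ σ r h → 1≤g σ (lookup α x) h (keeps r x _ (assign-same ρ x _)))))
      where r = chance q s z ; E = avgs q α s e ρ
    ... | no _ = subst (_≤ avgs q α (x ∷ s) g ρ)
      (sym (mix-swap q (chance q s z) (avgs q α s e ρ) (avgs q α s e (reveal α x ρ))))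
      (mix-mono pq (avgs-reveal s z 1≤g e≤g inv ρ≼α) (avgs-reveal s z 1≤g e≤g inv (reveal-≼ x ρ≼α)))

    product : List ℚ → ℚ
    product = foldr _*_ 1ℚ

    harris-all : ∀ s {A : Set} (φ : Partial n → A → Bool) →
      (∀ ρ x → ρ ≼ α → ∀ a → T (φ ρ a) → T (φ (reveal α x ρ) a)) → ∀ {ρ} → ρ ≼ α → ∀ C →
      product (map (λ a → avgs q α s (λ σ → indicator (φ σ a)) ρ) C) ≤ avgs q α s (λ σ → indicator (all (φ σ) C)) ρ
    harris-all s φ inc {ρ} ρ≼α [] = ≤-reflexive (sym (avgs-const s 1ℚ ρ))
    harris-all s φ inc {ρ} ρ≼α (a ∷ C) = ≤-trans
      (*-monoˡ (Functional.≥0 (avgs-functional s ρ) (λ σ → 0≤indicator (φ σ a))) (harris-all s φ inc ρ≼α C))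
      (≤-trans (harris s (λ σ x h → ind (inc σ x h a)) (λ σ x h → ind (allinc σ x h)) ρ≼α)
        (≤-reflexive (Functional.ext (avgs-functional s ρ) (λ σ → and (φ σ a) (all (φ σ) C)))))
      where
      ind : ∀ {a b} → (T a → T b) → indicator a ≤ indicator b
      ind h = indicator-mono λ e → to T-≡ (h (from T-≡ e))
      allinc : ∀ σ x → σ ≼ α → T (all (φ σ) C) → T (all (φ (reveal α x σ)) C)
      allinc σ x h t = all⁻ _ (All.map (λ {a} → inc σ x h a) (all⁺ _ C t))
      and : ∀ a b → indicator a * indicator b ≡ indicator (a ∧ b)
      and false b = *-zeroˡ (indicator b)
      and true  b = *-identityˡ (indicator b)

  product-≥ : ∀ {x vs} m → Prob x → All (x ≤_) vs → length vs ℕ.≤ m → x ^ m ≤ foldr _*_ 1ℚ vs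
  product-≥ m px [] _ = ^-≤1 m (lo px) (hi px)
  product-≥ (suc m) px (x≤v ∷ h) (ℕ.s≤s l) = *-mono (lo px) (≤-trans (^-≥0 m (lo px)) rest) x≤v rest
    where rest = product-≥ m px h l

  -- For critical clauses: the literal that is true under `α` contributes the factor 1, which leaves
  -- at most two children in a clause of three literals.
  product-≥-skip : ∀ {x vs} m → Prob x → All (x ≤_) vs → Any (1ℚ ≤_) vs → length vs ℕ.≤ suc m → x ^ m ≤ foldr _*_ 1ℚ vs
  product-≥-skip {x} {v ∷ vs} m px (_ ∷ h) (here 1≤v) (ℕ.s≤s l) = subst (_≤ v * foldr _*_ 1ℚ vs) (*-identityˡ (x ^ m))
    (*-mono 0≤1 (≤-trans (^-≥0 m (lo px)) rest) 1≤v rest)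
    where rest = product-≥ m px h l
  product-≥-skip {vs = v ∷ w ∷ vs} (suc m) px (x≤v ∷ h) (there a) (ℕ.s≤s l) = *-mono (lo px) (≤-trans (^-≥0 m (lo px)) rest) x≤v rest
    where rest = product-≥-skip m px h a l

  -- The probability that each root-to-leaf path of the complete binary
  -- tree of depth d has a revealed node below the root, if each node is
  -- revealed with probability r.
  cut : ℕ → ℚ → ℚ
  cut zero    r = 0ℚ
  cut (suc d) r = mix r (cut d r) 1ℚ ^ 2

  cut-prob : ∀ d {r} → Prob r → Prob (cut d r)
  cut-prob zero    pr = prob0
  cut-prob (suc d) pr = prob (^-≥0 2 (lo p)) (^-≤1 2 (lo p) (hi p))
    where p = mix-prob pr (cut-prob d pr) prob1

  -- The assignment at a node of the critical clause tree, `Y` being the variables on the path from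
  -- the root. The flipped values are written last, so they override whatever has been revealed;
  -- `flip-total` is the total version that selects the clause at the node.
  flipped : ∀ {n} → Assignment n → List (Fin n) → Partial n → Partial n
  flipped α []      ρ = ρ
  flipped α (z ∷ Y) ρ = assign (flipped α Y ρ) (z , not (lookup α z))

  flip-total : ∀ {n} → Assignment n → List (Fin n) → Assignment n
  flip-total α []      = α
  flip-total α (z ∷ Y) = flip-total α Y [ z ]≔ not (lookup α z)

  module _ {n : ℕ} (α : Assignment n) where

    flipped-mono : ∀ Y {ρ σ} → ρ ⊑ σ → flipped α Y ρ ⊑ flipped α Y σ
    flipped-mono []      h = h
    flipped-mono (z ∷ Y) h = assign-mono (z , not (lookup α z)) (flipped-mono Y h)

    flipped-absorbs : ∀ Y z u v ρ → flipped α Y (ρ [ z ]≔ u) [ z ]≔ v ≡ flipped α Y ρ [ z ]≔ v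
    flipped-absorbs []      z u v ρ = []≔-idempotent ρ z
    flipped-absorbs (w ∷ Y) z u v ρ with w ≟ z
    ... | yes refl = trans ([]≔-idempotent _ w) (trans (flipped-absorbs Y w u v ρ) (sym ([]≔-idempotent _ w)))
    ... | no w≢z = trans ([]≔-commutes _ w z w≢z)
      (trans (cong (_[ w ]≔ _) (flipped-absorbs Y z u v ρ)) ([]≔-commutes _ z w (w≢z ∘ sym)))

    flipped-in : ∀ {Y z} ρ → z ∈ Y → lookup (flipped α Y ρ) z ≡ just (not (lookup α z))
    flipped-in {w ∷ Y} {z} ρ z∈ with w ≟ z
    flipped-in {w ∷ Y} ρ z∈ | yes refl = lookup∘update w (flipped α Y ρ) _
    flipped-in {w ∷ Y} ρ (here e) | no w≢z = ⊥-elim (w≢z (sym e))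
    flipped-in {w ∷ Y} ρ (there z∈) | no w≢z = trans (lookup∘update′ (w≢z ∘ sym) (flipped α Y ρ) _) (flipped-in ρ z∈)

    flipped-out : ∀ {Y z} ρ → z ∉ Y → lookup (flipped α Y ρ) z ≡ lookup ρ z
    flipped-out {[]}    ρ z∉ = refl
    flipped-out {w ∷ Y} ρ z∉ = trans (lookup∘update′ (z∉ ∘ here) (flipped α Y ρ) _) (flipped-out ρ (z∉ ∘ there))

    flip-total-in : ∀ {Y z} → z ∈ Y → lookup (flip-total α Y) z ≡ not (lookup α z)
    flip-total-in {w ∷ Y} {z} z∈ with w ≟ z
    flip-total-in {w ∷ Y} z∈ | yes refl = lookup∘update w (flip-total α Y) _
    flip-total-in {w ∷ Y} (here e) | no w≢z = ⊥-elim (w≢z (sym e))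
    flip-total-in {w ∷ Y} (there z∈) | no w≢z = trans (lookup∘update′ (w≢z ∘ sym) (flip-total α Y) _) (flip-total-in z∈)

    flip-total-out : ∀ {Y z} → z ∉ Y → lookup (flip-total α Y) z ≡ lookup α z
    flip-total-out {[]}    z∉ = refl
    flip-total-out {w ∷ Y} z∉ = trans (lookup∘update′ (z∉ ∘ here) (flip-total α Y) _) (flip-total-out (z∉ ∘ there))

  Frozen : ∀ {n} → Formula n → Assignment n → Partial n → Fin n → Set
  Frozen Φ α ρ y = ∀ β → Models β Φ → ρ ≼ β → lookup β y ≡ lookup α y

  module _ {n : ℕ} (q : ℚ) (pq : Prob q) (Φ : Formula n) (3cnf : All (λ C → length C ℕ.≤ 3) Φ)
           (α : Assignment n) (models : Models α Φ) where

    private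
      event : ℕ → List (Fin n) → Partial n → Literal n → Bool
      event d Y σ l = falsified (flipped α Y σ) l ∨ refuted Φ d (assign (flipped α Y σ) l)

      event-mono : ∀ d Y σ x → σ ≼ α → ∀ l → T (event d Y σ l) → T (event d Y (reveal α x σ) l)
      event-mono d Y σ x h l t with to T-∨ t
      ... | inj₁ f = from T-∨ (inj₁ (falsified-mono l (flipped-mono α Y (reveal-⊑ x h)) f))
      ... | inj₂ r = from T-∨ (inj₂ (refuted-mono Φ d (assign-mono l (flipped-mono α Y (reveal-⊑ x h))) r))

      T⇒1≤ : ∀ {b} → T b → 1ℚ ≤ indicator b
      T⇒1≤ {true} _ = ≤-refl

    module _ {ρ : Partial n} (ρ≼α : ρ ≼ α) (y : Fin n) (frozen : Frozen Φ α ρ y)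
             (s : List (Fin n)) (r : ℚ) (pr : Prob r) (r≤ : ∀ z → z ≢ y → r ≤ chance q s z) where

      violated : ∀ Y → y ∈ Y → (∀ {z} → z ∈ Y → lookup ρ z ≡ nothing) → ¬ Models (flip-total α Y) Φ
      violated Y y∈Y free m = not-¬ {lookup α y} refl (trans (sym (frozen _ m ρ≼β)) (flip-total-in α y∈Y))
        where
        ρ≼β : ρ ≼ flip-total α Y
        ρ≼β = agrees λ x b eq → trans (flip-total-out α λ x∈Y → case trans (sym (free x∈Y)) eq of λ ()) (at ρ≼α x b eq)

      avgs-1≤ : ∀ {h} → (∀ σ → ρ ⊑ σ → σ ≼ α → 1ℚ ≤ h σ) → 1ℚ ≤ avgs q α s h ρ
      avgs-1≤ {h} 1≤h = subst (_≤ avgs q α s h ρ) (avgs-const q pq α s 1ℚ ρ) (avgs-mono q pq α s ρ≼α 1≤h)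

      -- As `y` is frozen and lies on the path `Y`, flipping `α` on `Y` violates a clause `C`, which
      -- labels the node. Its literals on `Y` or known in `ρ` are falsified for certain, and one of
      -- them is the literal that `α` satisfies. Each of the other literals, at most two, is dealt
      -- with if its variable is revealed or its own subtree is cut; Harris' inequality multiplies
      -- these chances.
      cut-≤ : ∀ d Y → y ∈ Y → (∀ {z} → z ∈ Y → lookup ρ z ≡ nothing) →
              cut d r ≤ avgs q α s (λ σ → indicator (refuted Φ d (flipped α Y σ))) ρ
      cut-≤ zero Y y∈Y free = ≤-reflexive (sym (avgs-const q pq α s 0ℚ ρ))
      cut-≤ (suc d) Y y∈Y free with find (¬All⇒Any¬ (any? (λ l → lookup (flip-total α Y) (var l) ≟ᵇ proj₂ l)) Φ (violated Y y∈Y free))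
      ... | C , C∈Φ , ¬C = ≤-trans
        (product-≥-skip 2 px (mapAll (λ l l∈ → proj₁ (factor l (All.lookup (¬Any⇒All¬ C ¬C) l∈))))
          (mapAny (λ l l∈ t → proj₂ (factor l (All.lookup (¬Any⇒All¬ C ¬C) l∈)) t) (All.lookup models C∈Φ))
          (subst (ℕ._≤ 3) (sym (length-map _ C)) (All.lookup 3cnf C∈Φ)))
        (≤-trans (harris-all q pq α s (event d Y) (event-mono d Y) ρ≼α C)
          (avgs-mono q pq α s ρ≼α λ σ _ _ → indicator-mono λ t → to T-≡ (any⁺ _ (lose C∈Φ (from T-≡ t)))))
        where
        β = flip-total α Y
        x = mix r (cut d r) 1ℚ
        px : Prob x
        px = mix-prob pr (cut-prob d pr) prob1
        v : Literal n → ℚ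
        v l = avgs q α s (λ σ → indicator (event d Y σ l)) ρ
        mapAll : ∀ {D} → (∀ l → l ∈ D → x ≤ v l) → All (x ≤_) (map v D)
        mapAll {[]}    h = []
        mapAll {l ∷ D} h = h l (here refl) ∷ mapAll (λ k k∈ → h k (there k∈))
        mapAny : ∀ {D} → (∀ l → l ∈ D → True α l → 1ℚ ≤ v l) → Any (True α) D → Any (1ℚ ≤_) (map v D)
        mapAny h (here t)  = here (h _ (here refl) t)
        mapAny h (there a) = there (mapAny (λ l l∈ → h l (there l∈)) a)
        both : ∀ {l} → 1ℚ ≤ v l → (x ≤ v l) × (True α l → 1ℚ ≤ v l)
        both 1≤v = ≤-trans (hi px) 1≤v , λ _ → 1≤v
        factor : ∀ l → ¬ True β l → (x ≤ v l) × (True α l → 1ℚ ≤ v l)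
        factor (z , b) ¬t with any? (z ≟_) Y
        ... | yes z∈Y = both (avgs-1≤ λ σ _ _ → T⇒1≤ (from T-∨ (inj₁ (from T-≡
                (trans (falsified-just (flipped α Y σ) b (flipped-in α σ z∈Y)) fals)))))
          where
          fals : (b xor not (lookup α z)) ≡ true
          fals = subst (λ c → (b xor c) ≡ true) (sym (¬-not {x = not (lookup α z)} {y = b} (λ e → ¬t (trans (flip-total-in α z∈Y) e)))) (xor-not b)
        ... | no z∉Y with lookup ρ z in known
        ...   | just c = both (avgs-1≤ λ σ r h → T⇒1≤ (from T-∨ (inj₁ (from T-≡
                (trans (falsified-just (flipped α Y σ) b (trans (flipped-out α σ z∉Y) (keeps r z c known))) fals)))))
          where
          fals : (b xor c) ≡ true
          fals = subst (λ c → (b xor c) ≡ true) (sym (¬-not {x = c} {y = b} (λ e → ¬t (trans (flip-total-out α z∉Y) (trans (at ρ≼α z c known) e))))) (xor-not b)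
        -- Here `b` is opposite to the value of `α`, so revealing `z` falsifies the literal.
        -- Otherwise `z` joins the path, where its flipped value overrides anything revealed; hence
        -- the invariance that `avgs-reveal` demands. The bound `r` applies as `z` is off the path
        -- and so differs from `y`.
        ...   | nothing = ≤-trans
                (mix1-mono pr (r≤ z λ { refl → z∉Y y∈Y }) (cut-≤ d (z ∷ Y) (there y∈Y) free′) avg≤1)
                (avgs-reveal q pq α s z seen implied (λ σ → cong (indicator ∘ refuted Φ d) (flipped-absorbs α Y z _ _ σ)) ρ≼α)
              , λ t → ⊥-elim (¬t (trans (flip-total-out α z∉Y) t))
          where
          b≡ : b ≡ not (lookup α z)
          b≡ = sym (trans (cong not (¬-not {x = lookup α z} {y = b} λ e → ¬t (trans (flip-total-out α z∉Y) e))) (not-involutive b))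
          avg≤1 = subst (avgs q α s (λ σ → indicator (refuted Φ d (flipped α (z ∷ Y) σ))) ρ ≤_) (avgs-const q pq α s 1ℚ ρ)
            (avgs-mono q pq α s ρ≼α λ σ _ _ → indicator≤1 _)
          free′ : ∀ {w} → w ∈ z ∷ Y → lookup ρ w ≡ nothing
          free′ (here refl) = known
          free′ (there w∈)  = free w∈
          seen : ∀ σ c → σ ≼ α → lookup σ z ≡ just c → 1ℚ ≤ indicator (event d Y σ (z , b))
          seen σ c h eq = T⇒1≤ (from T-∨ (inj₁ (from T-≡
            (trans (falsified-just (flipped α Y σ) b (trans (flipped-out α σ z∉Y) eq))
              (subst₂ (λ b c → (b xor c) ≡ true) (sym b≡) (at h z c eq) (xor-not′ (lookup α z)))))))
            where
            xor-not′ : ∀ b → (not b xor b) ≡ true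
            xor-not′ false = refl
            xor-not′ true  = refl
          implied : ∀ σ → indicator (refuted Φ d (flipped α (z ∷ Y) σ)) ≤ indicator (event d Y σ (z , b))
          implied σ = indicator-mono λ t → to T-≡ (from T-∨ (inj₂ (from T-≡ (subst (λ c → refuted Φ d (assign (flipped α Y σ) (z , c)) ≡ true) (sym b≡) t))))

-- Expected number of coins spent on a frozen variable.

module Spending where

  open Arithmetic
  open Refutation
  open Cuts
  open import Data.Bool using (T)
  open import Data.Fin using (_≟_)
  open import Data.Nat as ℕ using (ℕ; zero; suc)
  open import Data.Rational hiding (_≟_)
  open import Data.Rational.Properties hiding (_≟_)
  open import Tactic.RingSolver

  unassigned : ∀ {n} → Partial n → Fin n → Bool
  unassigned ρ y with lookup ρ y
  ... | just _  = false
  ... | nothing = true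

  unforced : ∀ {n} → Formula n → ℕ → Fin n → Partial n → Bool
  unforced Φ d y ρ with lookup ρ y | forced Φ d ρ y
  ... | just _  | _       = false
  ... | nothing | just _  = false
  ... | nothing | nothing = true

  -- The expected number of coins spent on y when the variables are revealed along s with probability q each.
  spent : ∀ {n} → ℚ → Formula n → ℕ → Assignment n → List (Fin n) → Fin n → Partial n → ℚ
  spent q Φ d α []      y ρ = indicator (unassigned ρ y)
  spent q Φ d α (x ∷ s) y ρ with x ≟ y
  ... | yes _ = mix q (spent q Φ d α s y ρ) (indicator (unforced Φ d y ρ))
  ... | no  _ = mix q (spent q Φ d α s y ρ) (spent q Φ d α s y (reveal α x ρ))

  -- Here `m` turns are left, and `r` is a chance that every other variable has to be revealed
  -- before the next of them. For `r = 0ℚ` this discretises 1 - ∫ cut over [0, 1], which tends to 2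
  -- ln 2 - 1 as `q` tends to 0, `d` to infinity and `q` times `m` to infinity.
  bound : ℚ → ℕ → ℕ → ℚ → ℚ
  bound q d zero    r = 1ℚ
  bound q d (suc m) r = mix q (bound q d m (mix q r 1ℚ)) (1ℚ - cut d r)

  turns : ∀ {n} → List (Fin n) → Fin n → ℕ
  turns []      y = 0
  turns (x ∷ s) y with x ≟ y
  ... | yes _ = suc (turns s y)
  ... | no  _ = turns s y

  rounds : ∀ n → ℕ → List (Fin n)
  rounds n zero    = []
  rounds n (suc m) = allFin n ++ rounds n m

  unassigned-just : ∀ {n} {ρ : Partial n} {y b} → lookup ρ y ≡ just b → unassigned ρ y ≡ false
  unassigned-just {ρ = ρ} {y} eq with lookup ρ y
  ... | just _ = refl

  unforced-just : ∀ {n} {Φ : Formula n} {d ρ y b} → lookup ρ y ≡ just b → unforced Φ d y ρ ≡ false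
  unforced-just {ρ = ρ} {y} eq with lookup ρ y
  ... | just _ = refl

  unforced-forced : ∀ {n} {Φ : Formula n} {d ρ y b} → forced Φ d ρ y ≡ just b → unforced Φ d y ρ ≡ false
  unforced-forced {Φ = Φ} {d} {ρ} {y} eq with lookup ρ y | forced Φ d ρ y
  ... | just _  | _      = refl
  ... | nothing | just _ = refl

  unforced-free : ∀ {n} {Φ : Formula n} {d ρ y} → lookup ρ y ≡ nothing → forced Φ d ρ y ≡ nothing → unforced Φ d y ρ ≡ true
  unforced-free {Φ = Φ} {d} {ρ} {y} eq f rewrite eq | f = refl

  private
    mix00 : ∀ q → mix q 0ℚ 0ℚ ≡ 0ℚ
    mix00 q = mix-id q 0ℚ

  module _ {n : ℕ} (q : ℚ) (pq : Prob q) (Φ : Formula n) (d : ℕ) (α : Assignment n) where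

    spent-assigned : ∀ s y {ρ b} → ρ ≼ α → lookup ρ y ≡ just b → spent q Φ d α s y ρ ≡ 0ℚ
    spent-assigned [] y {ρ} h eq = cong indicator (unassigned-just {ρ = ρ} eq)
    spent-assigned (x ∷ s) y {ρ} h eq with x ≟ y
    ... | yes _ = trans (cong₂ (mix q) (spent-assigned s y h eq) (cong indicator (unforced-just {Φ = Φ} {d} {ρ} eq))) (mix00 q)
    ... | no _ = trans (cong₂ (mix q) (spent-assigned s y h eq)
                   (spent-assigned s y (reveal-≼ x h) (keeps (reveal-⊑ x h) y _ eq))) (mix00 q)

    spent-≥0 : ∀ s y ρ → 0ℚ ≤ spent q Φ d α s y ρ
    spent-≥0 [] y ρ = 0≤indicator _
    spent-≥0 (x ∷ s) y ρ with x ≟ y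
    ... | yes _ = mix-≥0 pq (spent-≥0 s y ρ) (0≤indicator _)
    ... | no _ = mix-≥0 pq (spent-≥0 s y ρ) (spent-≥0 s y (reveal α x ρ))

    unforced-antitone : ∀ y {ρ} x → ρ ≼ α → indicator (unforced Φ d y (reveal α x ρ)) ≤ indicator (unforced Φ d y ρ)
    unforced-antitone y {ρ} x h = indicator-mono imp
      where
      σ = reveal α x ρ
      imp : unforced Φ d y σ ≡ true → unforced Φ d y ρ ≡ true
      imp e with lookup ρ y in eqρ
      imp e | just b with trans (sym e) (unforced-just {Φ = Φ} {d} {σ} (keeps (reveal-⊑ x h) y b eqρ))
      ... | ()
      imp e | nothing with forced Φ d ρ y in eqf
      ... | nothing = refl
      ... | just b = ⊥-elim (some (assign-forces b eqf))
        where
        assign-forces : ∀ b → forced Φ d ρ y ≡ just b → T (refuted Φ d (assign ρ (y , not b)))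
        assign-forces b eq with refuted Φ d (assign ρ (y , true)) in t | refuted Φ d (assign ρ (y , false)) in f
        assign-forces .false refl | true  | _    rewrite t = _
        assign-forces .true  refl | false | true rewrite f = _
        isForced : forced Φ d σ y ≢ nothing → unforced Φ d y σ ≡ false
        isForced ne with lookup σ y | forced Φ d σ y
        ... | just _  | _       = refl
        ... | nothing | just _  = refl
        ... | nothing | nothing = ⊥-elim (ne refl)
        some : T (refuted Φ d (assign ρ (y , not b))) → ⊥
        some t with trans (sym e) (isForced (forced-complete {Φ = Φ} {d} {σ} y (not b)
                      (refuted-mono Φ d (assign-mono (y , not b) (reveal-⊑ x h)) t)))
        ... | ()

    -- Revealing more can only turn a guess into a forced value, by `refuted-mono`.
    spent-antitone : ∀ s y {ρ} z → ρ ≼ α → spent q Φ d α s y (reveal α z ρ) ≤ spent q Φ d α s y ρ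
    spent-antitone [] y {ρ} z h = indicator-mono imp
      where
      imp : unassigned (reveal α z ρ) y ≡ true → unassigned ρ y ≡ true
      imp e with lookup ρ y in eq
      ... | nothing = refl
      ... | just b with trans (sym e) (unassigned-just {ρ = reveal α z ρ} (keeps (reveal-⊑ z h) y b eq))
      ...   | ()
    spent-antitone (x ∷ s) y {ρ} z h with x ≟ y
    ... | yes _ = mix-mono pq (spent-antitone s y z h) (unforced-antitone y z h)
    ... | no _ = mix-mono pq (spent-antitone s y z h)
      (subst (λ σ → spent q Φ d α s y σ ≤ spent q Φ d α s y (reveal α x ρ)) (reveal-comm ρ α z x)
        (spent-antitone s y z (reveal-≼ x h)))

    spent-skip : ∀ u t {y} → y ∉ u → ∀ ρ → spent q Φ d α (u ++ t) y ρ ≡ avgs q α u (spent q Φ d α t y) ρ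
    spent-skip []      t y∉ ρ = refl
    spent-skip (x ∷ u) t {y} y∉ ρ with x ≟ y
    ... | yes refl = ⊥-elim (y∉ (here refl))
    ... | no _ = cong₂ (mix q) (spent-skip u t (y∉ ∘ there) ρ) (spent-skip u t (y∉ ∘ there) (reveal α x ρ))

    spent-turn : ∀ s y ρ → spent q Φ d α (y ∷ s) y ρ ≡ mix q (spent q Φ d α s y ρ) (indicator (unforced Φ d y ρ))
    spent-turn s y ρ with y ≟ y
    ... | yes _ = refl
    ... | no ne = ⊥-elim (ne refl)

    module _ (3cnf : All (λ C → length C ℕ.≤ 3) Φ) (models : Models α Φ)
             {ρ : Partial n} (ρ≼α : ρ ≼ α) (y : Fin n) (frozen : Frozen Φ α ρ y) where

      -- With the path reduced to its root, `flipped` sets just `y` against `α`; if this is refuted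
      -- then `y` is forced, and `cut-≤` bounds the chance of that from below.
      unforced-≤ : lookup ρ y ≡ nothing → ∀ s r → Prob r → (∀ z → z ≢ y → r ≤ chance q s z) →
                   avgs q α s (λ σ → indicator (unforced Φ d y σ)) ρ ≤ 1ℚ - cut d r
      unforced-≤ free s r pr r≤ = ≤-trans
        (Functional.mono (avgs-functional q pq α s ρ) {g = λ σ → 1ℚ + (- 1ℚ) * e σ} pointwise)
        (subst (_≤ 1ℚ - cut d r) (sym eq) (+-monoʳ-≤ 1ℚ (subst (_≤ - cut d r) (negate (avgs q α s e ρ))
          (neg-antimono-≤ (cut-≤ q pq Φ 3cnf α models ρ≼α y frozen s r pr r≤ d (y ∷ []) (here refl) λ { (here refl) → free })))))
        where
        e : Partial n → ℚ
        e σ = indicator (refuted Φ d (flipped α (y ∷ []) σ))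
        negate : ∀ a → - a ≡ (- 1ℚ) * a
        negate = solve-∀ ℚ-ring
        eq : avgs q α s (λ σ → 1ℚ + (- 1ℚ) * e σ) ρ ≡ 1ℚ + (- 1ℚ) * avgs q α s e ρ
        eq = trans (Functional.add (avgs-functional q pq α s ρ) (λ _ → 1ℚ) (λ σ → (- 1ℚ) * e σ))
          (cong₂ _+_ (avgs-const q pq α s 1ℚ ρ) (Functional.scale (avgs-functional q pq α s ρ) (- 1ℚ) e))
        pointwise : ∀ σ → indicator (unforced Φ d y σ) ≤ 1ℚ + (- 1ℚ) * e σ
        pointwise σ with refuted Φ d (flipped α (y ∷ []) σ) in r
        ... | false = indicator≤1 (unforced Φ d y σ)
        ... | true with lookup σ y | forced Φ d σ y in f
        ...   | just _  | _       = ≤-refl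
        ...   | nothing | just _  = ≤-refl
        ...   | nothing | nothing = ⊥-elim (forced-complete {Φ = Φ} {d} {σ} y (not (lookup α y)) (from T-≡ r) f)

  private
    mix-comm1 : ∀ q r → (1ℚ - q) * r + q * 1ℚ ≡ (1ℚ - r) * q + r * 1ℚ
    mix-comm1 = solve-∀ ℚ-ring
    mix-assoc1 : ∀ q a b → (1ℚ - q) * ((1ℚ - a) * b + a * 1ℚ) + q * 1ℚ ≡ (1ℚ - ((1ℚ - q) * a + q * 1ℚ)) * b + ((1ℚ - q) * a + q * 1ℚ) * 1ℚ
    mix-assoc1 = solve-∀ ℚ-ring
    mix0b : ∀ b → b ≡ (1ℚ - 0ℚ) * b + 0ℚ * 1ℚ
    mix0b = solve-∀ ℚ-ring

  module _ {n : ℕ} (q : ℚ) (pq : Prob q) where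

    chance-++ : ∀ s t (z : Fin n) → chance q (s ++ t) z ≡ mix (chance q s z) (chance q t z) 1ℚ
    chance-++ []      t z = mix0b (chance q t z)
    chance-++ (x ∷ s) t z with x ≟ z
    ... | yes _ = trans (cong (λ c → mix q c 1ℚ) (chance-++ s t z)) (mix-assoc1 q (chance q s z) (chance q t z))
    ... | no  _ = chance-++ s t z

    chance-∈ : ∀ {s} {z : Fin n} → z ∈ s → q ≤ chance q s z
    chance-∈ {x ∷ s} {z} z∈ with x ≟ z
    chance-∈ {x ∷ s} {z} z∈ | yes _ = subst (_≤ mix q (chance q s z) 1ℚ) (lem q) (mix-mono {b = 1ℚ} {d = 1ℚ} pq (lo (chance-prob pq s z)) ≤-refl)
      where
      lem : ∀ q → (1ℚ - q) * 0ℚ + q * 1ℚ ≡ q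
      lem = solve-∀ ℚ-ring
    chance-∈ {x ∷ s} (here e)   | no ne = ⊥-elim (ne (sym e))
    chance-∈ {x ∷ s} (there z∈) | no _  = chance-∈ z∈

    chance-grow : ∀ s t {r} (z : Fin n) → Prob r → r ≤ chance q s z → q ≤ chance q t z → mix q r 1ℚ ≤ chance q (s ++ t) z
    chance-grow s t {r} z pr r≤ q≤ = subst₂ _≤_ (mix-comm1 r q) (sym (chance-++ s t z))
      (mix1-mono pr r≤ q≤ (hi (chance-prob pq t z)))

  module _ {n : ℕ} (q : ℚ) (pq : Prob q) (Φ : Formula n) (d : ℕ) (α : Assignment n)
           (3cnf : All (λ C → length C ℕ.≤ 3) Φ) (models : Models α Φ)
           {ρ : Partial n} (ρ≼α : ρ ≼ α) (y : Fin n) (frozen : Frozen Φ α ρ y) (free : lookup ρ y ≡ nothing)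
           (u v : List (Fin n)) (split : allFin n ≡ u ++ y ∷ v) (y∉u : y ∉ u) (y∉v : y ∉ v) where

    private
      avgs-turn : ∀ s t r → Prob r → (∀ z → z ≢ y → r ≤ chance q s z) → ∀ {c} → avgs q α s (spent q Φ d α t y) ρ ≤ c →
                  avgs q α s (spent q Φ d α (y ∷ t) y) ρ ≤ mix q c (1ℚ - cut d r)
      avgs-turn s t r pr r≤ h = ≤-trans
        (≤-reflexive (trans (F.ext (spent-turn q pq Φ d α t y)) (F.mixed q (spent q Φ d α t y) (λ σ → indicator (unforced Φ d y σ)))))
        (mix-mono pq h (unforced-≤ q pq Φ d α 3cnf models ρ≼α y frozen free s r pr r≤))
        where module F = Functional (avgs-functional q pq α s ρ)

      covers : ∀ z → z ≢ y → z ∈ u ⊎ z ∈ v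
      covers z z≢y with ∈-++⁻ u (subst (z ∈_) split (∈-allFin z))
      ... | inj₁ z∈u         = inj₁ z∈u
      ... | inj₂ (here z≡y)  = ⊥-elim (z≢y z≡y)
      ... | inj₂ (there z∈v) = inj₂ z∈v

      skip : ∀ pre w t → y ∉ w → avgs q α pre (spent q Φ d α (w ++ t) y) ρ ≡ avgs q α (pre ++ w) (spent q Φ d α t y) ρ
      skip pre w t y∉w = trans (Functional.ext (avgs-functional q pq α pre ρ) (spent-skip q pq Φ d α w t y∉w))
        (sym (avgs-++ q pq α pre w (spent q Φ d α t y) ρ))

    spent-≤1 : ∀ pre → avgs q α pre (spent q Φ d α [] y) ρ ≤ 1ℚ
    spent-≤1 pre = subst (avgs q α pre (spent q Φ d α [] y) ρ ≤_) (avgs-const q pq α pre 1ℚ ρ)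
      (Functional.mono (avgs-functional q pq α pre ρ) (λ σ → indicator≤1 _))

    -- The list `pre` collects the visits already made. From one turn of `y` to the next the script
    -- runs through `v ++ u`, where every other variable occurs; this replaces `r` by `mix q r 1ℚ`.
    spent-rounds : ∀ m pre r → Prob r → (∀ z → z ≢ y → r ≤ chance q (pre ++ u) z) →
                   avgs q α pre (spent q Φ d α (rounds n m) y) ρ ≤ bound q d m r
    spent-rounds zero    pre r pr r≤ = spent-≤1 pre
    spent-rounds (suc m) pre r pr r≤ = subst (_≤ bound q d (suc m) r)
      (sym (trans (cong (λ w → avgs q α pre (spent q Φ d α w y) ρ) eq) (skip pre u (y ∷ v ++ rounds n m) y∉u)))
      (avgs-turn (pre ++ u) (v ++ rounds n m) r pr r≤
        (subst (_≤ bound q d m (mix q r 1ℚ)) (sym (skip (pre ++ u) v (rounds n m) y∉v))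
          (spent-rounds m ((pre ++ u) ++ v) (mix q r 1ℚ) (mix-prob pq pr prob1) grow)))
      where
      eq : allFin n ++ rounds n m ≡ u ++ y ∷ v ++ rounds n m
      eq = trans (cong (_++ rounds n m) split) (++-assoc u (y ∷ v) (rounds n m))
      grow : ∀ z → z ≢ y → mix q r 1ℚ ≤ chance q (((pre ++ u) ++ v) ++ u) z
      grow z z≢y = subst (λ w → mix q r 1ℚ ≤ chance q w z) (sym (++-assoc (pre ++ u) v u))
        (chance-grow q pq (pre ++ u) (v ++ u) z pr (r≤ z z≢y) (chance-∈ q pq mem))
        where
        mem : z ∈ v ++ u
        mem with covers z z≢y
        ... | inj₁ z∈u = ∈-++⁺ʳ v z∈u
        ... | inj₂ z∈v = ∈-++⁺ˡ z∈v

    spent-after-turn : ∀ m w → y ∉ w → spent q Φ d α (w ++ rounds n m) y ρ ≤ bound q d m 0ℚ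
    spent-after-turn m w y∉w = subst (_≤ bound q d m 0ℚ) (sym (skip [] w (rounds n m) y∉w))
      (spent-rounds m w 0ℚ prob0 λ z _ → lo (chance-prob pq (w ++ u) z))

    -- The first round is truncated, so nothing is claimed about visits before the first turn of
    -- `y`, hence `0ℚ`. By its second turn, every other variable has been visited in `v` or in the
    -- next round's `a ++ w`.
    spent-before-turn : ∀ m a w → u ≡ a ++ w → spent q Φ d α (w ++ y ∷ v ++ rounds n m) y ρ ≤ bound q d (suc m) 0ℚ
    spent-before-turn m a w refl = subst (_≤ bound q d (suc m) 0ℚ) (sym (skip [] w (y ∷ v ++ rounds n m) (y∉u ∘ ∈-++⁺ʳ a)))
      (avgs-turn w (v ++ rounds n m) 0ℚ prob0 (λ z _ → lo (chance-prob pq w z))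
        (subst (_≤ bound q d m (mix q 0ℚ 1ℚ)) (sym (skip w v (rounds n m) y∉v))
          (spent-rounds m (w ++ v) (mix q 0ℚ 1ℚ) (mix-prob pq prob0 prob1) grow)))
      where
      grow : ∀ z → z ≢ y → mix q 0ℚ 1ℚ ≤ chance q ((w ++ v) ++ a ++ w) z
      grow z z≢y = chance-grow q pq [] ((w ++ v) ++ a ++ w) z prob0 ≤-refl (chance-∈ q pq mem)
        where
        mem : z ∈ (w ++ v) ++ a ++ w
        mem with covers z z≢y
        ... | inj₁ z∈u = ∈-++⁺ʳ (w ++ v) z∈u
        ... | inj₂ z∈v = ∈-++⁺ˡ (∈-++⁺ʳ w z∈v)

  turns-++ : ∀ {n} s t (y : Fin n) → turns (s ++ t) y ≡ turns s y ℕ.+ turns t y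
  turns-++ []      t y = refl
  turns-++ (x ∷ s) t y with x ≟ y
  ... | yes _ = cong suc (turns-++ s t y)
  ... | no  _ = turns-++ s t y

  turns-∉ : ∀ {n} {s} {y : Fin n} → y ∉ s → turns s y ≡ 0
  turns-∉ {s = []} _ = refl
  turns-∉ {s = x ∷ s} {y} y∉ with x ≟ y
  ... | yes refl = ⊥-elim (y∉ (here refl))
  ... | no  _ = turns-∉ (y∉ ∘ there)

  turns-self : ∀ {n} s (y : Fin n) → turns (y ∷ s) y ≡ suc (turns s y)
  turns-self s y with y ≟ y
  ... | yes _ = refl
  ... | no ne = ⊥-elim (ne refl)

  unique-split : ∀ {n} u {v} {y : Fin n} → Unique (u ++ y ∷ v) → y ∉ u × y ∉ v
  unique-split []      (h ∷ _) = (λ ()) , λ y∈ → All.lookup h y∈ refl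
  unique-split (x ∷ u) {v} {y} (h ∷ hs) with unique-split u hs
  ... | y∉u , y∉v = (λ { (here refl) → All.lookup h (∈-++⁺ʳ u (here refl)) refl ; (there y∈) → y∉u y∈ }) , y∉v

  turns-rounds : ∀ n m (y : Fin n) → turns (rounds n m) y ≡ m
  turns-rounds n zero    y = refl
  turns-rounds n (suc m) y with ∈-∃++ (∈-allFin y)
  ... | u , v , split = trans (turns-++ (allFin n) (rounds n m) y)
    (cong₂ ℕ._+_ (trans (cong (λ w → turns w y) split) (trans (turns-++ u (y ∷ v) y)
        (cong₂ ℕ._+_ (turns-∉ (proj₁ nin)) (trans (turns-self v y) (cong suc (turns-∉ (proj₂ nin)))))))
      (turns-rounds n m y))
    where nin = unique-split u (subst Unique split (allFin⁺ n))

  suffix-split : ∀ {A : Set} (a t l r : List A) → a ++ t ≡ l ++ r →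
    (Σ[ s ∈ List A ] (l ≡ a ++ s × t ≡ s ++ r)) ⊎ (Σ[ s ∈ List A ] (a ≡ l ++ s × s ++ t ≡ r))
  suffix-split []      t l       r eq = inj₁ (l , refl , eq)
  suffix-split (x ∷ a) t []      r eq = inj₂ (x ∷ a , refl , eq)
  suffix-split (x ∷ a) t (y ∷ l) r eq with ∷-injective eq
  ... | refl , eq′ with suffix-split a t l r eq′
  ...   | inj₁ (s , e , f) = inj₁ (s , cong (x ∷_) e , f)
  ...   | inj₂ (s , e , f) = inj₂ (s , cong (x ∷_) e , f)

  module _ {n : ℕ} (q : ℚ) (pq : Prob q) (Φ : Formula n) (d : ℕ) (α : Assignment n)
           (3cnf : All (λ C → length C ℕ.≤ 3) Φ) (models : Models α Φ)
           {ρ : Partial n} (ρ≼α : ρ ≼ α) (y : Fin n) (frozen : Frozen Φ α ρ y) (free : lookup ρ y ≡ nothing) where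

    -- Stepping through a trial leaves arbitrary suffixes of the script. The cases are whether the
    -- suffix starts in a later round and, if not, whether `y` still has a turn in the truncated
    -- one.
    spent-bound : ∀ R a t → a ++ t ≡ rounds n R → spent q Φ d α t y ρ ≤ bound q d (turns t y) 0ℚ
    spent-bound zero [] [] eq = subst (_≤ 1ℚ) refl (indicator≤1 (unassigned ρ y))
    spent-bound (suc m) a t eq with suffix-split a t (allFin n) (rounds n m) eq
    ... | inj₂ (s , _ , e) = spent-bound m s t e
    ... | inj₁ (w , split , refl) with any? (y ≟_) w
    ...   | no y∉w with ∈-++⁻ a (subst (y ∈_) split (∈-allFin y))
    ...     | inj₂ y∈w = ⊥-elim (y∉w y∈w)
    ...     | inj₁ y∈a with ∈-∃++ y∈a
    ...       | a₁ , a₂ , refl = subst (λ k → spent q Φ d α (w ++ rounds n m) y ρ ≤ bound q d k 0ℚ)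
                (sym (trans (turns-++ w (rounds n m) y) (cong₂ ℕ._+_ (turns-∉ y∉w) (turns-rounds n m y))))
                (spent-after-turn q pq Φ d α 3cnf models ρ≼α y frozen free a₁ (a₂ ++ w) split′ (proj₁ nin) (proj₂ nin) m w y∉w)
      where
      split′ = trans split (++-assoc a₁ (y ∷ a₂) w)
      nin = unique-split a₁ (subst Unique split′ (allFin⁺ n))
    spent-bound (suc m) a t eq | inj₁ (w , split , refl) | yes y∈w with ∈-∃++ y∈w
    ... | u , v , refl = subst₂ (λ s k → spent q Φ d α s y ρ ≤ bound q d k 0ℚ)
        (sym (++-assoc u (y ∷ v) (rounds n m))) (sym count)
        (spent-before-turn q pq Φ d α 3cnf models ρ≼α y frozen free (a ++ u) v split′ (proj₁ nin) (proj₂ nin) m a u refl)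
      where
      split′ = trans split (sym (++-assoc a u (y ∷ v)))
      nin = unique-split (a ++ u) (subst Unique split′ (allFin⁺ n))
      count : turns ((u ++ y ∷ v) ++ rounds n m) y ≡ suc m
      count = trans (turns-++ (u ++ y ∷ v) (rounds n m) y) (cong₂ ℕ._+_ (trans (turns-++ u (y ∷ v) y)
        (cong₂ ℕ._+_ (turns-∉ (proj₁ nin ∘ ∈-++⁺ʳ a)) (trans (turns-self v y) (cong suc (turns-∉ (proj₂ nin)))))) (turns-rounds n m y))

-- Hertli's cost function: liquid and frozen variables, weighted solutions.

module Costs where

  open Arithmetic
  open Refutation
  open Cuts
  open Spending
  open import Data.Fin using (_≟_)
  open import Data.Fin.Properties using (all?)
  open import Data.Nat as ℕ using (ℕ; zero; suc)
  open import Data.Rational hiding (_≟_)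
  open import Data.Rational.Properties hiding (_≟_)
  open import Tactic.RingSolver

  Solution : ∀ {n} → Formula n → Partial n → Assignment n → Set
  Solution Φ ρ α = Models α Φ × ρ ≼ α

  module _ {n : ℕ} (Φ : Formula n) where

    models? : ∀ α → Dec (Models α Φ)
    models? α = All.all? (any? (λ l → lookup α (var l) ≟ᵇ proj₂ l)) Φ

    agrees? : ∀ (ρ : Partial n) (α : Assignment n) → Dec (ρ ≼ α)
    agrees? ρ α = map′ agrees at (all? at?)
      where
      at? : ∀ x → Dec (∀ b → lookup ρ x ≡ just b → lookup α x ≡ b)
      at? x with lookup ρ x
      ... | nothing = yes λ _ ()
      ... | just c with lookup α x ≟ᵇ c
      ...   | yes e = yes λ { .c refl → e }
      ...   | no ne = no λ h → ne (h c refl)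

    abstract
      solution? : ∀ ρ α → Dec (Solution Φ ρ α)
      solution? ρ α = models? α ×-dec agrees? ρ α

  search : ∀ {n} {P : Assignment n → Set} → (∀ α → Dec (P α)) → Dec (∃[ α ] P α)
  search {zero} P? with P? []
  ... | yes p = yes ([] , p)
  ... | no np = no λ { ([] , p) → np p }
  search {suc n} P? with search (P? ∘ (false ∷_)) | search (P? ∘ (true ∷_))
  ... | yes (α , p) | _           = yes (false ∷ α , p)
  ... | no _        | yes (α , p) = yes (true ∷ α , p)
  ... | no nf       | no nt       = no λ { (false ∷ α , p) → nf (α , p) ; (true ∷ α , p) → nt (α , p) }

  ∑V-≥ : ∀ n {f} → (∀ v → 0ℚ ≤ f v) → ∀ v → f v ≤ ∑V n f
  ∑V-≥ zero    h [] = ≤-refl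
  ∑V-≥ (suc n) {f} h (false ∷ v) = ≤-trans (∑V-≥ n (h ∘ (false ∷_)) v)
    (≤-by (∑V n (f ∘ (true ∷_))) (Functional.≥0 (∑V-functional n) (h ∘ (true ∷_))) refl)
  ∑V-≥ (suc n) {f} h (true ∷ v) = ≤-trans (∑V-≥ n (h ∘ (true ∷_)) v)
    (≤-by (∑V n (f ∘ (false ∷_))) (Functional.≥0 (∑V-functional n) (h ∘ (false ∷_)))
      (+-comm (∑V n (f ∘ (false ∷_))) (∑V n (f ∘ (true ∷_)))))

  -- Totalised by 0 at 0, so that weights can be written down without a proof that a solution
  -- exists.
  inverse : ℚ → ℚ
  inverse x with x Data.Rational.≟ 0ℚ
  ... | yes _ = 0ℚ
  ... | no ne = (1/ x) {{≢-nonZero ne}}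

  private
    positive-≢0 : ∀ {x} → 1ℚ ≤ x → x ≢ 0ℚ
    positive-≢0 h refl with ≤⇒≤ᵇ h
    ... | ()

  inverse-* : ∀ {x} → 1ℚ ≤ x → inverse x * x ≡ 1ℚ
  inverse-* {x} h with x Data.Rational.≟ 0ℚ
  ... | yes e = ⊥-elim (positive-≢0 h e)
  ... | no ne = *-inverseˡ x {{≢-nonZero ne}}

  0≤inverse : ∀ {x} → 1ℚ ≤ x → 0ℚ ≤ inverse x
  0≤inverse {x} h with ≤-total 0ℚ (inverse x)
  ... | inj₁ p = p
  ... | inj₂ neg = ⊥-elim (1≰0 (subst (_≤ 0ℚ) (inverse-* h) (≤-trans (*-monoʳ (≤-trans 0≤1 h) neg) (≤-reflexive (*-zeroˡ x)))))
    where
    1≰0 : ¬ (1ℚ ≤ 0ℚ)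
    1≰0 p with ≤⇒≤ᵇ p
    ... | ()

  inverse-antitone : ∀ {x y} → 1ℚ ≤ x → x ≤ y → inverse y ≤ inverse x
  inverse-antitone {x} {y} 1≤x x≤y = subst₂ _≤_
    (trans (cong (inverse y *_) (inverse-* 1≤x)) (*-identityʳ (inverse y)))
    (trans (lem (inverse y) (inverse x) y) (trans (cong (inverse x *_) (inverse-* 1≤y)) (*-identityʳ (inverse x))))
    (*-monoˡ (0≤inverse 1≤y) (*-monoˡ (0≤inverse 1≤x) x≤y))
    where
    1≤y = ≤-trans 1≤x x≤y
    lem : ∀ a b c → a * (b * c) ≡ b * (a * c)
    lem = solve-∀ ℚ-ring

  ∑F-single : ∀ n (x : Fin n) c → ∑F n (λ y → c * indicator (does (x ≟ y))) ≡ c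
  ∑F-single (suc n) zero c = trans (cong₂ _+_ (*-identityʳ c)
    (Functional.zero-on (∑F-functional n) (λ _ → *-zeroʳ c))) (+-identityʳ c)
  ∑F-single (suc n) (suc x) c = trans (cong₂ _+_ (*-zeroʳ c) (trans (Functional.ext (∑F-functional n) eq) (∑F-single n x c))) (+-identityˡ c)
    where
    eq : ∀ y → c * indicator (does (suc x ≟ suc y)) ≡ c * indicator (does (x ≟ y))
    eq y with x ≟ y
    ... | yes _ = refl
    ... | no _  = refl

  module _ {n : ℕ} (Φ : Formula n) where

    restricted : Partial n → (Assignment n → ℚ) → Assignment n → ℚ
    restricted ρ h α = if does (solution? Φ ρ α) then h α else 0ℚ

    ∑S : Partial n → (Assignment n → ℚ) → ℚ
    ∑S ρ h = ∑V n (restricted ρ h)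

    private module V = Functional (∑V-functional n)

    ∑S-≤ : ∀ {ρ g h} → (∀ α → Solution Φ ρ α → g α ≤ h α) → ∑S ρ g ≤ ∑S ρ h
    ∑S-≤ {ρ} {g} {h} le = V.mono pointwise
      where
      pointwise : ∀ α → restricted ρ g α ≤ restricted ρ h α
      pointwise α with solution? Φ ρ α
      ... | yes s = le α s
      ... | no _  = ≤-refl

    ∑S-functional : ∀ ρ → Functional (∑S ρ)
    ∑S-functional ρ = record
      { add   = λ f g → trans (V.ext (add′ f g)) (V.add (restricted ρ f) (restricted ρ g))
      ; scale = λ c f → trans (V.ext (scale′ c f)) (V.scale c (restricted ρ f))
      ; mono  = λ h → ∑S-≤ (λ α _ → h α) }
      where
      add′ : ∀ f g α → restricted ρ (λ x → f x + g x) α ≡ restricted ρ f α + restricted ρ g α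
      add′ f g α with does (solution? Φ ρ α)
      ... | true  = refl
      ... | false = refl
      scale′ : ∀ c f α → restricted ρ (λ x → c * f x) α ≡ c * restricted ρ f α
      scale′ c f α with does (solution? Φ ρ α)
      ... | true  = refl
      ... | false = sym (*-zeroʳ c)

    ∑S-≡ : ∀ {ρ g h} → (∀ α → Solution Φ ρ α → g α ≡ h α) → ∑S ρ g ≡ ∑S ρ h
    ∑S-≡ {ρ} {g} {h} eq = ≤-antisym (∑S-≤ (λ α s → ≤-reflexive (eq α s))) (∑S-≤ (λ α s → ≤-reflexive (sym (eq α s))))

    ∑S-0 : ∀ {ρ h} → (∀ α → Solution Φ ρ α → h α ≡ 0ℚ) → ∑S ρ h ≡ 0ℚ
    ∑S-0 {ρ} {h} eq = trans (∑S-≡ eq) (Functional.zero-on (∑S-functional ρ) λ _ → refl)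

    count : Partial n → ℚ
    count ρ = ∑S ρ (λ _ → 1ℚ)

    count-≥1 : ∀ {ρ α} → Solution Φ ρ α → 1ℚ ≤ count ρ
    count-≥1 {ρ} {α} s = ≤-trans (le s) (∑V-≥ n nonneg α)
      where
      nonneg : ∀ β → 0ℚ ≤ restricted ρ (λ _ → 1ℚ) β
      nonneg β with does (solution? Φ ρ β)
      ... | true  = 0≤1
      ... | false = ≤-refl
      le : Solution Φ ρ α → 1ℚ ≤ restricted ρ (λ _ → 1ℚ) α
      le s with solution? Φ ρ α
      ... | yes _ = ≤-refl
      ... | no ns = ⊥-elim (ns s)

    count-antitone : ∀ {ρ σ} → ρ ⊑ σ → count σ ≤ count ρ
    count-antitone {ρ} {σ} h = V.mono pointwise
      where
      pointwise : ∀ α → restricted σ (λ _ → 1ℚ) α ≤ restricted ρ (λ _ → 1ℚ) α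
      pointwise α with solution? Φ σ α | solution? Φ ρ α
      ... | yes _       | yes _ = ≤-refl
      ... | yes (m , s) | no ns = ⊥-elim (ns (m , ⊑-≼-trans h s))
      ... | no _        | yes _ = 0≤1
      ... | no _        | no _  = ≤-refl

    assign-⊑ : ∀ {ρ : Partial n} {x b} → lookup ρ x ≡ nothing → ρ ⊑ assign ρ (x , b)
    assign-⊑ {ρ} {x} {b} free = extends kept
      where
      kept : ∀ z c → lookup ρ z ≡ just c → lookup (assign ρ (x , b)) z ≡ just c
      kept z c eq with x ≟ z
      ... | no x≢z = trans (assign-other ρ b x≢z) eq
      ... | yes refl with trans (sym free) eq
      ...   | ()

    solution-assign : ∀ {ρ x b α} → lookup ρ x ≡ nothing → Solution Φ (assign ρ (x , b)) α → Solution Φ ρ α × lookup α x ≡ b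
    solution-assign {ρ} {x} {b} free (m , h) = (m , ⊑-≼-trans (assign-⊑ free) h) , at h x b (assign-same ρ x b)

    assign-solution : ∀ {ρ x b α} → Solution Φ ρ α → lookup α x ≡ b → Solution Φ (assign ρ (x , b)) α
    assign-solution {ρ} {x} {b} (m , h) e = m , assign-≼ (x , b) h e

    -- Each solution survives in exactly one branch, the one that gives `x` its own value.
    ∑S-branch : ∀ ρ x → lookup ρ x ≡ nothing → ∀ (h : Partial n → Assignment n → ℚ) →
      ∑S ρ (λ α → h (reveal α x ρ) α) ≡
      ∑S (assign ρ (x , true)) (h (assign ρ (x , true))) + ∑S (assign ρ (x , false)) (h (assign ρ (x , false)))
    ∑S-branch ρ x free h = trans (V.ext pointwise) (V.add (side true) (side false))
      where
      side : Bool → Assignment n → ℚ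
      side b = restricted (assign ρ (x , b)) (h (assign ρ (x , b)))
      this : ∀ α b → lookup α x ≡ b → restricted ρ (λ β → h (reveal β x ρ) β) α ≡ side b α
      this α b e with solution? Φ ρ α | solution? Φ (assign ρ (x , b)) α
      ... | yes _ | yes _ = cong (λ c → h (assign ρ (x , c)) α) e
      ... | yes s | no ns = ⊥-elim (ns (assign-solution s e))
      ... | no ns | yes s = ⊥-elim (ns (proj₁ (solution-assign free s)))
      ... | no _  | no _  = refl
      other : ∀ α b → lookup α x ≢ b → side b α ≡ 0ℚ
      other α b ne with solution? Φ (assign ρ (x , b)) α
      ... | yes s = ⊥-elim (ne (proj₂ (solution-assign free s)))
      ... | no _  = refl
      pointwise : ∀ α → restricted ρ (λ β → h (reveal β x ρ) β) α ≡ side true α + side false α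
      pointwise α = by (lookup α x) refl
        where
        by : ∀ b → lookup α x ≡ b → restricted ρ (λ β → h (reveal β x ρ) β) α ≡ side true α + side false α
        by true e = trans (this α true e) (trans (sym (+-identityʳ (side true α)))
          (cong (λ z → side true α + z) (sym (other α false λ f → case trans (sym e) f of λ ()))))
        by false e = trans (this α false e) (trans (sym (+-identityˡ (side false α)))
          (cong (λ z → z + side false α) (sym (other α true λ f → case trans (sym e) f of λ ()))))

    Can : Partial n → Fin n → Bool → Set
    Can ρ x b = ∃[ α ] (Solution Φ ρ α × lookup α x ≡ b)

    can? : ∀ ρ x b → Dec (Can ρ x b)
    can? ρ x b = search λ α → solution? Φ ρ α ×-dec (lookup α x ≟ᵇ b)

    Liquid : Partial n → Fin n → Set
    Liquid ρ x = Can ρ x true × Can ρ x false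

    abstract
      liquid? : ∀ ρ x → Dec (Liquid ρ x)
      liquid? ρ x = can? ρ x true ×-dec can? ρ x false

    liquid-⊒ : ∀ {ρ σ x} → ρ ⊑ σ → Liquid σ x → Liquid ρ x
    liquid-⊒ h ((α , (m , s) , e) , (β , (k , t) , f)) = (α , (m , ⊑-≼-trans h s) , e) , (β , (k , ⊑-≼-trans h t) , f)

    liquid-free : ∀ {ρ x} → Liquid ρ x → lookup ρ x ≡ nothing
    liquid-free {ρ} {x} ((α , (m , s) , e) , (β , (k , t) , f)) with lookup ρ x in eq
    ... | nothing = refl
    ... | just b with trans (sym e) (trans (at s x b eq) (trans (sym (at t x b eq)) f))
    ...   | ()

    ¬liquid-frozen : ∀ {ρ x α} → ¬ Liquid ρ x → Solution Φ ρ α → Frozen Φ α ρ x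
    ¬liquid-frozen {ρ} {x} {α} nl s β m h with lookup β x in e | lookup α x in f
    ... | true  | true  = refl
    ... | false | false = refl
    ... | true  | false = ⊥-elim (nl ((β , (m , h) , e) , (α , s , f)))
    ... | false | true  = ⊥-elim (nl ((α , s , f) , (β , (m , h) , e)))

  indicator-≟ : ∀ {n} (x : Fin n) → indicator (does (x ≟ x)) ≡ 1ℚ
  indicator-≟ x with x ≟ x
  ... | yes _ = refl
  ... | no ne = ⊥-elim (ne refl)

  indicator-≢ : ∀ {n} {x y : Fin n} → x ≢ y → indicator (does (x ≟ y)) ≡ 0ℚ
  indicator-≢ {x = x} {y} ne with x ≟ y
  ... | yes e = ⊥-elim (ne e)
  ... | no _  = refl

  module Cost {n : ℕ} (q : ℚ) (pq : Prob q) (ν : ℚ) (0≤ν : 0ℚ ≤ ν) (ν≤1 : ν ≤ 1ℚ) (ν-inverse : ν * (1ℚ + q) ≡ 1ℚ)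
              (Φ : Formula n) (d : ℕ) where

    Sat : Partial n → Set
    Sat ρ = ∃[ α ] Solution Φ ρ α

    -- When a liquid variable is revealed, both branches have total weight 1. Unnormalised, the
    -- total would thus be `(1ℚ - q) + q * (1ℚ + 1ℚ)`, that is `1ℚ + q`, of which `ν` is the
    -- inverse.
    discount : Partial n → Fin n → ℚ
    discount ρ x = if does (liquid? Φ ρ x) then ν else 1ℚ

    discount-≥0 : ∀ ρ x → 0ℚ ≤ discount ρ x
    discount-≥0 ρ x with does (liquid? Φ ρ x)
    ... | true  = 0≤ν
    ... | false = 0≤1

    discount-mono : ∀ {ρ σ} x → ρ ⊑ σ → discount ρ x ≤ discount σ x
    discount-mono {ρ} {σ} x h with liquid? Φ ρ x | liquid? Φ σ x
    ... | yes _ | yes _ = ≤-refl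
    ... | yes _ | no _  = ν≤1
    ... | no nl | yes l = ⊥-elim (nl (liquid-⊒ Φ h l))
    ... | no _  | no _  = ≤-refl

    -- The probability of ending at `α` if a visited frozen variable gets its only value with
    -- probability `q`, a liquid one gets a fair bit with the larger probability 2q / (1 + q), and
    -- one of the solutions left at the end is drawn uniformly.
    weight : List (Fin n) → Partial n → Assignment n → ℚ
    weight []      ρ α = inverse (count Φ ρ)
    weight (x ∷ s) ρ α = discount ρ x * mix q (weight s ρ α) (weight s (reveal α x ρ) α)

    reveal-solution : ∀ {ρ α} x → Solution Φ ρ α → Solution Φ (reveal α x ρ) α
    reveal-solution x (m , h) = m , reveal-≼ x h

    weight-≥0 : ∀ s {ρ α} → Solution Φ ρ α → 0ℚ ≤ weight s ρ α
    weight-≥0 []      sol = 0≤inverse (count-≥1 Φ sol)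
    weight-≥0 (x ∷ s) {ρ} sol = 0≤* (discount-≥0 ρ x) (mix-≥0 pq (weight-≥0 s sol) (weight-≥0 s (reveal-solution x sol)))

    -- Revealing a value of `α` discards only rival solutions, and fewer variables are liquid
    -- afterwards.
    weight-mono : ∀ s {ρ α} z → Solution Φ ρ α → weight s ρ α ≤ weight s (reveal α z ρ) α
    weight-mono [] z sol = inverse-antitone (count-≥1 Φ (reveal-solution z sol)) (count-antitone Φ (reveal-⊑ z (proj₂ sol)))
    weight-mono (x ∷ s) {ρ} {α} z sol = *-mono (discount-≥0 ρ x)
      (mix-≥0 pq (weight-≥0 s (reveal-solution z sol)) (weight-≥0 s (reveal-solution x (reveal-solution z sol))))
      (discount-mono x (reveal-⊑ z (proj₂ sol)))
      (mix-mono pq (weight-mono s z sol)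
        (subst (λ σ → weight s (reveal α x ρ) α ≤ weight s σ α) (reveal-comm ρ α z x) (weight-mono s z (reveal-solution x sol))))

    private
      liq-eq : ∀ q → (1ℚ - q) * 1ℚ + q * (1ℚ + 1ℚ) ≡ 1ℚ + q
      liq-eq = solve-∀ ℚ-ring

    known-value : ∀ {ρ} x {b} → lookup ρ x ≡ just b → ∀ (h : Partial n → Assignment n → ℚ) →
                  ∑S Φ ρ (λ α → h (reveal α x ρ) α) ≡ ∑S Φ ρ (h ρ)
    known-value x eq h = ∑S-≡ Φ λ α sol → cong (λ σ → h σ α) (reveal-known x (proj₂ sol) eq)

    unsat-0 : ∀ {ρ} h → ¬ Sat ρ → ∑S Φ ρ h ≡ 0ℚ
    unsat-0 h ns = ∑S-0 Φ λ α sol → ⊥-elim (ns (α , sol))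

    single-value : ∀ {ρ} x b → lookup ρ x ≡ nothing → ¬ Sat (assign ρ (x , not b)) → ∀ (h : Partial n → Assignment n → ℚ) →
                   ∑S Φ ρ (λ α → h (reveal α x ρ) α) ≡ ∑S Φ (assign ρ (x , b)) (h (assign ρ (x , b)))
    single-value {ρ} x true free ns h = trans (∑S-branch Φ ρ x free h)
      (trans (cong (λ z → ∑S Φ (assign ρ (x , true)) (h (assign ρ (x , true))) + z) (unsat-0 (h (assign ρ (x , false))) ns)) (+-identityʳ (∑S Φ (assign ρ (x , true)) (h (assign ρ (x , true))))))
    single-value {ρ} x false free ns h = trans (∑S-branch Φ ρ x free h)
      (trans (cong (λ z → z + ∑S Φ (assign ρ (x , false)) (h (assign ρ (x , false)))) (unsat-0 (h (assign ρ (x , true))) ns)) (+-identityˡ (∑S Φ (assign ρ (x , false)) (h (assign ρ (x , false))))))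

    sat-assign : ∀ {ρ x b} → Can Φ ρ x b → Sat (assign ρ (x , b))
    sat-assign (α , sol , e) = α , assign-solution Φ sol e

    ¬liquid-unsat : ∀ {ρ x b} → lookup ρ x ≡ nothing → ¬ Liquid Φ ρ x → Can Φ ρ x b → ¬ Sat (assign ρ (x , not b))
    ¬liquid-unsat {b = true}  free nl c (β , s) = nl (c , (β , solution-assign Φ free s))
    ¬liquid-unsat {b = false} free nl c (β , s) = nl ((β , solution-assign Φ free s) , c)

    weight-total : ∀ s ρ → Sat ρ → ∑S Φ ρ (weight s ρ) ≡ 1ℚ
    weight-total [] ρ (α , sol) = trans (Functional.ext (∑S-functional Φ ρ) (λ _ → sym (*-identityʳ (inverse (count Φ ρ)))))
      (trans (Functional.scale (∑S-functional Φ ρ) (inverse (count Φ ρ)) (λ _ → 1ℚ)) (inverse-* (count-≥1 Φ sol)))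
    weight-total (x ∷ s) ρ (α , sol) = trans
      (F.scale (discount ρ x) (λ β → mix q (weight s ρ β) (weight s (reveal β x ρ) β)))
      (trans (cong (discount ρ x *_) (trans (F.mixed q (weight s ρ) (λ β → weight s (reveal β x ρ) β))
          (cong (λ w → mix q w R) (weight-total s ρ (α , sol)))))
        final)
      where
      module F = Functional (∑S-functional Φ ρ)
      R = ∑S Φ ρ (λ β → weight s (reveal β x ρ) β)
      final : discount ρ x * mix q 1ℚ R ≡ 1ℚ
      final with liquid? Φ ρ x
      ... | yes l@(ct , cf) = trans (cong (ν *_) (trans (cong (mix q 1ℚ) two) (liq-eq q))) ν-inverse
        where
        two : R ≡ 1ℚ + 1ℚ
        two = trans (∑S-branch Φ ρ x (liquid-free Φ l) (weight s)) (cong₂ _+_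
          (weight-total s (assign ρ (x , true)) (sat-assign ct))
          (weight-total s (assign ρ (x , false)) (sat-assign cf)))
      ... | no nl = trans (*-identityˡ (mix q 1ℚ R)) (trans (cong (mix q 1ℚ) one) (mix-id q 1ℚ))
        where
        one : R ≡ 1ℚ
        one with lookup ρ x in eq
        ... | just b = trans (known-value x eq (weight s)) (weight-total s ρ (α , sol))
        ... | nothing = trans (single-value x (lookup α x) eq (¬liquid-unsat eq nl (α , sol , refl)) (weight s))
              (weight-total s (assign ρ (x , lookup α x)) (sat-assign (α , sol , refl)))

    K : List (Fin n) → Fin n → Partial n → Assignment n → ℚ
    K s y ρ α = spent q Φ d α s y ρ

    frozen-cost : List (Fin n) → Partial n → Fin n → ℚ
    frozen-cost s ρ y = ∑S Φ ρ (λ α → weight s ρ α * K s y ρ α)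

    frozen-cost-branches : List (Fin n) → Partial n → Fin n → Fin n → ℚ
    frozen-cost-branches s ρ x y = ∑S Φ ρ (λ α → weight s (reveal α x ρ) α * K s y (reveal α x ρ) α)

    spent-other : ∀ s {x y} ρ α → x ≢ y → K (x ∷ s) y ρ α ≡ mix q (K s y ρ α) (K s y (reveal α x ρ) α)
    spent-other s {x} {y} ρ α x≢y with x ≟ y
    ... | yes e = ⊥-elim (x≢y e)
    ... | no _  = refl

    -- The weights grow and the costs shrink as variables are revealed, so
    -- averaging them separately only increases the product.
    frozen-cost-other : ∀ s {ρ x y} → x ≢ y →
      discount ρ x * mix q (frozen-cost s ρ y) (frozen-cost-branches s ρ x y) ≤ frozen-cost (x ∷ s) ρ y
    frozen-cost-other s {ρ} {x} {y} x≢y = subst (_≤ frozen-cost (x ∷ s) ρ y)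
      (trans (F.scale (discount ρ x) (λ α → mix q (f α) (g α))) (cong (discount ρ x *_) (F.mixed q f g)))
      (∑S-≤ Φ λ α sol → subst (discount ρ x * mix q (f α) (g α) ≤_)
        (trans (sym (*-assoc (discount ρ x) (mix q (weight s ρ α) (weight s (reveal α x ρ) α)) (mix q (K s y ρ α) (K s y (reveal α x ρ) α))))
               (cong (weight (x ∷ s) ρ α *_) (sym (spent-other s ρ α x≢y))))
        (*-monoˡ (discount-≥0 ρ x) (mix-cheb-anti pq (weight-mono s x sol) (spent-antitone q pq Φ d α s y x (proj₂ sol)))))
      where
      module F = Functional (∑S-functional Φ ρ)
      f g : Assignment n → ℚ
      f α = weight s ρ α * K s y ρ α
      g α = weight s (reveal α x ρ) α * K s y (reveal α x ρ) α

    weight-¬liquid : ∀ s {ρ x α} → ¬ Liquid Φ ρ x → Solution Φ ρ α → weight s ρ α ≤ weight (x ∷ s) ρ α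
    weight-¬liquid s {ρ} {x} {α} nl sol with liquid? Φ ρ x
    ... | yes l = ⊥-elim (nl l)
    ... | no _  = subst (weight s ρ α ≤_) (sym (*-identityˡ (mix q (weight s ρ α) (weight s (reveal α x ρ) α))))
                    (mix-≥ pq ≤-refl (weight-mono s x sol))

    -- Whether `x` is unforced does not depend on the solution, so in that part the weights sum to
    -- 1; in the other part they are at least the weights for `s`, as `x` brings no discount.
    frozen-cost-same : ∀ s {ρ x} → ¬ Liquid Φ ρ x → Sat ρ →
      mix q (frozen-cost s ρ x) (indicator (unforced Φ d x ρ)) ≤ frozen-cost (x ∷ s) ρ x
    frozen-cost-same s {ρ} {x} nl sat = ≤-trans (mix-mono pq mono₁ (≤-reflexive eq₂)) (≤-reflexive (sym (trans (∑S-≡ Φ expand) (F.mixed q f g))))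
      where
      module F = Functional (∑S-functional Φ ρ)
      u = indicator (unforced Φ d x ρ)
      f g : Assignment n → ℚ
      f α = weight (x ∷ s) ρ α * K s x ρ α
      g α = weight (x ∷ s) ρ α * u
      expand : ∀ α → Solution Φ ρ α → weight (x ∷ s) ρ α * K (x ∷ s) x ρ α ≡ mix q (f α) (g α)
      expand α sol = trans (cong (weight (x ∷ s) ρ α *_) (spent-turn q pq Φ d α s x ρ)) (sym (mix-scale q (weight (x ∷ s) ρ α) (K s x ρ α) u))
      mono₁ : frozen-cost s ρ x ≤ ∑S Φ ρ f
      mono₁ = ∑S-≤ Φ λ α sol → *-monoʳ (spent-≥0 q pq Φ d α s x ρ) (weight-¬liquid s nl sol)
      eq₂ : u ≡ ∑S Φ ρ g
      eq₂ = sym (trans (F.ext (λ α → *-comm (weight (x ∷ s) ρ α) u)) (trans (F.scale u (weight (x ∷ s) ρ))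
        (trans (cong (u *_) (weight-total (x ∷ s) ρ sat)) (*-identityʳ u))))

    frozen-cost-assigned : ∀ s {ρ y b} → lookup ρ y ≡ just b → frozen-cost s ρ y ≡ 0ℚ
    frozen-cost-assigned s {ρ} {y} eq = ∑S-0 Φ λ α sol → trans (cong (weight s ρ α *_) (spent-assigned q pq Φ d α s y (proj₂ sol) eq)) (*-zeroʳ (weight s ρ α))

    frozen-cost-≥0 : ∀ s ρ y → 0ℚ ≤ frozen-cost s ρ y
    frozen-cost-≥0 s ρ y = subst (_≤ frozen-cost s ρ y) (Functional.zero-on (∑S-functional Φ ρ) {f = λ _ → 0ℚ} λ _ → refl)
      (∑S-≤ Φ λ α sol → 0≤* (weight-≥0 s sol) (spent-≥0 q pq Φ d α s y ρ))

    frozen-cost-≤ : ∀ s {ρ y c} → Sat ρ → (∀ α → Solution Φ ρ α → K s y ρ α ≤ c) → frozen-cost s ρ y ≤ c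
    frozen-cost-≤ s {ρ} {y} {c} sat h = ≤-trans (∑S-≤ Φ λ α sol → *-monoˡ (weight-≥0 s sol) (h α sol))
      (≤-reflexive (trans (F.ext (λ α → *-comm (weight s ρ α) c)) (trans (F.scale c (weight s ρ))
        (trans (cong (c *_) (weight-total s ρ sat)) (*-identityʳ c)))))
      where module F = Functional (∑S-functional Φ ρ)

    module _ (S : ℕ → ℚ) (0≤S : ∀ m → 0ℚ ≤ S m) where

      -- The charge for a liquid variable depends only on its number of turns left. `Bounded` makes
      -- the same charge an upper bound for frozen variables, so turning frozen never raises a cost.
      cost : List (Fin n) → Partial n → Fin n → ℚ
      cost s ρ y = if does (liquid? Φ ρ y) then S (turns s y) else frozen-cost s ρ y

      total : List (Fin n) → Partial n → ℚ
      total s ρ = ∑F n (cost s ρ)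

      Bounded : List (Fin n) → Set
      Bounded s = ∀ {α ρ y} → Models α Φ → ρ ≼ α → Frozen Φ α ρ y → lookup ρ y ≡ nothing → K s y ρ α ≤ S (turns s y)

      cost-≥0 : ∀ s ρ y → 0ℚ ≤ cost s ρ y
      cost-≥0 s ρ y with does (liquid? Φ ρ y)
      ... | true  = 0≤S (turns s y)
      ... | false = frozen-cost-≥0 s ρ y

      cost-assigned : ∀ s {ρ y b} → lookup ρ y ≡ just b → cost s ρ y ≡ 0ℚ
      cost-assigned s {ρ} {y} eq with liquid? Φ ρ y
      ... | no _ = frozen-cost-assigned s eq
      ... | yes l with trans (sym eq) (liquid-free Φ l)
      ...   | ()

      cost-≤ : ∀ s {ρ} y → Bounded s → Sat ρ → cost s ρ y ≤ S (turns s y)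
      cost-≤ s {ρ} y bd sat with liquid? Φ ρ y
      ... | yes _ = ≤-refl
      ... | no nl with lookup ρ y in eq
      ...   | just _  = ≤-trans (≤-reflexive (frozen-cost-assigned s eq)) (0≤S (turns s y))
      ...   | nothing = frozen-cost-≤ s sat λ α sol → bd (proj₁ sol) (proj₂ sol) (¬liquid-frozen Φ nl sol) eq

      total-≥0 : ∀ s ρ → 0ℚ ≤ total s ρ
      total-≥0 s ρ = Functional.≥0 (∑F-functional n) (cost-≥0 s ρ)

      turns-other : ∀ s {x y : Fin n} → x ≢ y → turns (x ∷ s) y ≡ turns s y
      turns-other s {x} {y} x≢y with x ≟ y
      ... | yes e = ⊥-elim (x≢y e)
      ... | no _  = refl

      -- Costs are compared variable by variable: a y ≢ x is either liquid,
      -- and then its cost cannot rise, or it stays frozen.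
      cost-known : ∀ x s {ρ b} → lookup ρ x ≡ just b → ∀ y → cost s ρ y ≤ cost (x ∷ s) ρ y
      cost-known x s {ρ} eq y = by (x ≟ y)
        where
        by : Dec (x ≡ y) → cost s ρ y ≤ cost (x ∷ s) ρ y
        eq′ : discount ρ x * mix q (frozen-cost s ρ y) (frozen-cost-branches s ρ x y) ≡ frozen-cost s ρ y
        by (yes refl) = ≤-trans (≤-reflexive (cost-assigned s eq)) (cost-≥0 (x ∷ s) ρ x)
        by (no x≢y) with does (liquid? Φ ρ y)
        ... | true = ≤-reflexive (cong S (sym (turns-other s x≢y)))
        ... | false = subst (_≤ frozen-cost (x ∷ s) ρ y) eq′ (frozen-cost-other s x≢y)
        disc : discount ρ x ≡ 1ℚ
        disc with liquid? Φ ρ x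
        ... | no _ = refl
        ... | yes l with trans (sym eq) (liquid-free Φ l)
        ...   | ()
        eq′ = trans (cong₂ _*_ disc (trans (cong (mix q (frozen-cost s ρ y)) (known-value x eq (λ σ α → weight s σ α * K s y σ α))) (mix-id q (frozen-cost s ρ y))))
          (*-identityˡ (frozen-cost s ρ y))

      total-known : ∀ x s {ρ b} → lookup ρ x ≡ just b → total s ρ ≤ total (x ∷ s) ρ
      total-known x s eq = Functional.mono (∑F-functional n) (cost-known x s eq)

      cost-¬liquid : ∀ s {ρ y} → ¬ Liquid Φ ρ y → cost s ρ y ≡ frozen-cost s ρ y
      cost-¬liquid s {ρ} {y} nl with liquid? Φ ρ y
      ... | yes l = ⊥-elim (nl l)
      ... | no _  = refl

      -- Only the summand of `x` itself pays for the coin. For another frozen `y` all solutions lie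
      -- in the branch `b`; for a liquid `y` both costs on the left are at most its charge.
      total-frozen : ∀ x s {ρ b} → Bounded s → lookup ρ x ≡ nothing → ¬ Liquid Φ ρ x → Can Φ ρ x b →
        mix q (total s ρ) (total s (assign ρ (x , b)) + indicator (unforced Φ d x ρ)) ≤ total (x ∷ s) ρ
      total-frozen x s {ρ} {b} bd free nl can@(α , sol , _) = subst (_≤ total (x ∷ s) ρ) sums (F.mono each)
        where
        module F = Functional (∑F-functional n)
        σ = assign ρ (x , b)
        u = indicator (unforced Φ d x ρ)
        extra : Fin n → ℚ
        extra y = u * indicator (does (x ≟ y))
        sums : ∑F n (λ y → mix q (cost s ρ y) (cost s σ y + extra y)) ≡ mix q (total s ρ) (total s σ + u)
        sums = trans (F.mixed q (cost s ρ) (λ y → cost s σ y + extra y))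
          (cong (mix q (total s ρ)) (trans (F.add (cost s σ) extra) (cong (λ z → total s σ + z) (∑F-single n x u))))
        disc : discount ρ x ≡ 1ℚ
        disc with liquid? Φ ρ x
        ... | no _  = refl
        ... | yes l = ⊥-elim (nl l)
        each : ∀ y → mix q (cost s ρ y) (cost s σ y + extra y) ≤ cost (x ∷ s) ρ y
        each y = by (x ≟ y)
          where
          by : Dec (x ≡ y) → mix q (cost s ρ y) (cost s σ y + extra y) ≤ cost (x ∷ s) ρ y
          by (yes refl) = subst₂ _≤_
            (cong₂ (mix q) (sym (cost-¬liquid s nl)) (trans (sym (trans (cong (λ z → z + u) (cost-assigned s (assign-same ρ x b))) (+-identityˡ u)))
              (cong (λ z → cost s σ x + z) (sym (trans (cong (u *_) (indicator-≟ x)) (*-identityʳ u))))))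
            (sym (cost-¬liquid (x ∷ s) nl)) (frozen-cost-same s nl (α , sol))
          by (no x≢y) = subst (λ z → mix q (cost s ρ y) z ≤ cost (x ∷ s) ρ y)
            (sym (trans (cong (λ z → cost s σ y + z) (trans (cong (u *_) (indicator-≢ x≢y)) (*-zeroʳ u))) (+-identityʳ (cost s σ y)))) (go (liquid? Φ ρ y))
            where
            go : Dec (Liquid Φ ρ y) → mix q (cost s ρ y) (cost s σ y) ≤ cost (x ∷ s) ρ y
            go (yes l) = subst (mix q (cost s ρ y) (cost s σ y) ≤_) (sym costS)
                (mix-≤ pq (cost-≤ s y bd (α , sol)) (cost-≤ s y bd (sat-assign can)))
              where
              costS : cost (x ∷ s) ρ y ≡ S (turns s y)
              costS with liquid? Φ ρ y
              ... | yes _ = cong S (turns-other s x≢y)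
              ... | no nl = ⊥-elim (nl l)
            go (no nly) = subst₂ _≤_
              (trans (trans (cong (_* mix q (frozen-cost s ρ y) (frozen-cost-branches s ρ x y)) disc) (*-identityˡ (mix q (frozen-cost s ρ y) (frozen-cost-branches s ρ x y))))
                (cong₂ (mix q) (sym (cost-¬liquid s nly))
                  (trans (single-value x b free (¬liquid-unsat free nl can) (λ σ α → weight s σ α * K s y σ α))
                    (sym (cost-¬liquid s (λ l → nly (liquid-⊒ Φ (assign-⊑ Φ free) l)))))))
              (sym (cost-¬liquid (x ∷ s) nly)) (frozen-cost-other s x≢y)

      -- The factor `1ℚ + q` cancels the discount, and then the cost of another frozen variable
      -- splits exactly into the two branches. Each branch pays one coin and sheds the charge of
      -- `x`; the condition on `S` balances the two up to `δ`.
      total-liquid : ∀ x s {ρ} δ → Bounded s → Liquid Φ ρ x →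
        (∀ m → (1ℚ - q) * S m + q * (1ℚ + 1ℚ) ≤ (1ℚ + q) * (S (suc m) + δ)) →
        (1ℚ - q) * total s ρ + q * ((total s (assign ρ (x , true)) + 1ℚ) + (total s (assign ρ (x , false)) + 1ℚ))
          ≤ (1ℚ + q) * (total (x ∷ s) ρ + δ)
      total-liquid x s {ρ} δ bd l@(ct@(α , sol , _) , cf) step-S = subst₂ _≤_ sumsˡ sumsʳ (F.mono each)
        where
        module F = Functional (∑F-functional n)
        σ = assign ρ (x , true)
        τ = assign ρ (x , false)
        free = liquid-free Φ l
        one eps : Fin n → ℚ
        one y = 1ℚ * indicator (does (x ≟ y))
        eps y = δ * indicator (does (x ≟ y))
        sumsˡ : ∑F n (λ y → mix q (cost s ρ y) ((cost s σ y + one y) + (cost s τ y + one y)))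
              ≡ (1ℚ - q) * total s ρ + q * ((total s σ + 1ℚ) + (total s τ + 1ℚ))
        sumsˡ = trans (F.mixed q (cost s ρ) (λ y → (cost s σ y + one y) + (cost s τ y + one y))) (cong (mix q (total s ρ))
          (trans (F.add (λ y → cost s σ y + one y) (λ y → cost s τ y + one y)) (cong₂ _+_
            (trans (F.add (cost s σ) one) (cong (λ z → total s σ + z) (∑F-single n x 1ℚ)))
            (trans (F.add (cost s τ) one) (cong (λ z → total s τ + z) (∑F-single n x 1ℚ))))))
        sumsʳ : ∑F n (λ y → (1ℚ + q) * (cost (x ∷ s) ρ y + eps y)) ≡ (1ℚ + q) * (total (x ∷ s) ρ + δ)
        sumsʳ = trans (F.scale (1ℚ + q) (λ y → cost (x ∷ s) ρ y + eps y)) (cong ((1ℚ + q) *_)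
          (trans (F.add (cost (x ∷ s) ρ) eps) (cong (λ z → total (x ∷ s) ρ + z) (∑F-single n x δ))))
        expand : ∀ q c → (1ℚ - q) * c + q * (c + c) ≡ (1ℚ + q) * c
        expand = solve-∀ ℚ-ring
        cost-liquid : ∀ s {y} → Liquid Φ ρ y → cost s ρ y ≡ S (turns s y)
        cost-liquid s {y} l with liquid? Φ ρ y
        ... | yes _ = refl
        ... | no nl = ⊥-elim (nl l)
        drop : ∀ c k → c + k * 0ℚ ≡ c
        drop = solve-∀ ℚ-ring
        at-x : ∀ c → c ≡ 0ℚ → c + 1ℚ * indicator (does (x ≟ x)) ≡ 1ℚ
        at-x c refl = trans (+-identityˡ _) (trans (*-identityˡ _) (indicator-≟ x))
        each : ∀ y → mix q (cost s ρ y) ((cost s σ y + one y) + (cost s τ y + one y)) ≤ (1ℚ + q) * (cost (x ∷ s) ρ y + eps y)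
        each y = by (x ≟ y)
          where
          c = S (turns s y)
          go : x ≢ y → Dec (Liquid Φ ρ y) → mix q (cost s ρ y) (cost s σ y + cost s τ y) ≤ (1ℚ + q) * cost (x ∷ s) ρ y
          by : Dec (x ≡ y) → mix q (cost s ρ y) ((cost s σ y + one y) + (cost s τ y + one y)) ≤ (1ℚ + q) * (cost (x ∷ s) ρ y + eps y)
          by (yes refl) = subst₂ _≤_
            (cong₂ (mix q) (sym (cost-liquid s l)) (cong₂ _+_ (sym (at-x (cost s σ x) (cost-assigned s (assign-same ρ x true))))
                                                     (sym (at-x (cost s τ x) (cost-assigned s (assign-same ρ x false))))))
            (cong₂ (λ a b → (1ℚ + q) * (a + b)) (trans (cong S (sym (turns-self s x))) (sym (cost-liquid (x ∷ s) l)))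
              (sym (trans (cong (δ *_) (indicator-≟ x)) (*-identityʳ δ))))
            (step-S (turns s x))
          by (no x≢y) = by-other
            where
            dropped : ∀ c k → c + k * indicator (does (x ≟ y)) ≡ c
            dropped c k = trans (cong (λ z → c + k * z) (indicator-≢ x≢y)) (drop c k)
            by-other = subst₂ _≤_
              (cong (mix q (cost s ρ y)) (cong₂ _+_ (sym (dropped (cost s σ y) 1ℚ)) (sym (dropped (cost s τ y) 1ℚ))))
              (cong ((1ℚ + q) *_) (sym (dropped (cost (x ∷ s) ρ y) δ))) (go x≢y (liquid? Φ ρ y))
          go x≢y (yes ly) = subst (mix q (cost s ρ y) (cost s σ y + cost s τ y) ≤_)
              (trans (expand q c) (cong ((1ℚ + q) *_) (trans (cong S (sym (turns-other s x≢y))) (sym (cost-liquid (x ∷ s) ly)))))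
              (mix-mono pq (cost-≤ s y bd (α , sol)) (+-mono-≤ (cost-≤ s y bd (sat-assign ct)) (cost-≤ s y bd (sat-assign cf))))
          go x≢y (no nly) = subst₂ _≤_ eqˡ (cong ((1ℚ + q) *_) (sym (cost-¬liquid (x ∷ s) nly)))
              (*-monoˡ (0≤+ 0≤1 (lo pq)) (frozen-cost-other s x≢y))
            where
            disc : discount ρ x ≡ ν
            disc with liquid? Φ ρ x
            ... | yes _ = refl
            ... | no nl = ⊥-elim (nl l)
            M = mix q (frozen-cost s ρ y) (frozen-cost-branches s ρ x y)
            reorder : ∀ a b c → a * (b * c) ≡ (b * a) * c
            reorder = solve-∀ ℚ-ring
            eqˡ : (1ℚ + q) * (discount ρ x * M) ≡ mix q (cost s ρ y) (cost s σ y + cost s τ y)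
            eqˡ = trans (reorder (1ℚ + q) (discount ρ x) M) (trans (cong (λ z → z * (1ℚ + q) * M) disc) (trans (cong (_* M) ν-inverse) (trans (*-identityˡ M)
              (cong₂ (mix q) (sym (cost-¬liquid s nly)) (trans (∑S-branch Φ ρ x free (λ σ α → weight s σ α * K s y σ α))
                (cong₂ _+_ (sym (cost-¬liquid s (λ l → nly (liquid-⊒ Φ (assign-⊑ Φ free) l))))
                           (sym (cost-¬liquid s (λ l → nly (liquid-⊒ Φ (assign-⊑ Φ free) l))))))))))

      cost-[] : S 0 ≡ 1ℚ → ∀ {ρ} y → Sat ρ → indicator (unassigned ρ y) ≤ cost [] ρ y
      cost-[] S0 {ρ} y sat with liquid? Φ ρ y
      ... | yes l = subst (indicator (unassigned ρ y) ≤_) (sym S0) (indicator≤1 (unassigned ρ y))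
      ... | no _  = ≤-reflexive (sym (trans (F.ext (λ α → *-comm (weight [] ρ α) i)) (trans (F.scale i (weight [] ρ))
        (trans (cong (i *_) (weight-total [] ρ sat)) (*-identityʳ i)))))
        where
        module F = Functional (∑S-functional Φ ρ)
        i = indicator (unassigned ρ y)

-- Trials as functions of their coins, and their chance of success.

module Trials where

  open Arithmetic
  open Refutation
  open Spending
  open Costs
  open import Data.Nat as ℕ using (ℕ; zero; suc)
  import Data.Nat.Properties as ℕP
  open import Data.Rational hiding (_≟_)
  open import Data.Rational.Properties hiding (_≟_)
  open import Tactic.RingSolver

  fill : ∀ {n} → Partial n → Vec Bool n → Assignment n
  fill []            []      = []
  fill (just b ∷ ρ)  (_ ∷ ω) = b ∷ fill ρ ω
  fill (nothing ∷ ρ) (b ∷ ω) = b ∷ fill ρ ω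

  select : ∀ k {m} → Vec Bool (k ℕ.+ m) → Bool × Vec Bool m
  select zero    ω       = true , ω
  select (suc k) (b ∷ ω) = b ∧ proj₁ (select k ω) , proj₂ (select k ω)

  tape : ∀ {n} → ℕ → List (Fin n) → ℕ
  tape {n} k []      = n
  tape     k (x ∷ s) = k ℕ.+ suc (tape k s)

  update : ∀ {n} → Formula n → ℕ → Partial n → Fin n → Bool → Partial n
  update Φ d ρ x g with lookup ρ x
  ... | just _  = ρ
  ... | nothing = assign ρ (x , fromMaybe g (forced Φ d ρ x))

  advance : ∀ {n} → Formula n → ℕ → Partial n → Fin n → Bool → Bool → Partial n
  advance Φ d ρ x c g = if c then update Φ d ρ x g else ρ

  trial : ∀ {n} → Formula n → (d k : ℕ) → (s : List (Fin n)) → Partial n → Vec Bool (tape k s) → Assignment n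
  trial Φ d k []      ρ ω = fill ρ ω
  trial Φ d k (x ∷ s) ρ ω with select k ω
  ... | c , g ∷ ω′ = trial Φ d k s (advance Φ d ρ x c g) ω′

  𝔼-select : ∀ k {m} (G : Bool → Vec Bool m → ℚ) →
    𝔼 (k ℕ.+ m) (λ ω → G (proj₁ (select k ω)) (proj₂ (select k ω))) ≡ mix (½ ^ k) (𝔼 m (G false)) (𝔼 m (G true))
  𝔼-select zero    {m} G = sym (lem (𝔼 m (G false)) (𝔼 m (G true)))
    where
    lem : ∀ a b → (1ℚ - 1ℚ) * a + 1ℚ * b ≡ b
    lem = solve-∀ ℚ-ring
  𝔼-select (suc k) {m} G = trans (cong (½ *_) (cong₂ _+_ (trans (𝔼-select k (λ _ → G false)) (mix-id (½ ^ k) a)) (𝔼-select k G)))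
    (lem ½ (½ ^ k) a b)
    where
    a = 𝔼 m (G false)
    b = 𝔼 m (G true)
    lem : ∀ h Q a b → h * (a + ((1ℚ - Q) * a + Q * b)) ≡ ((h + h) - h * Q) * a + (h * Q) * b
    lem = solve-∀ ℚ-ring

  module _ {n : ℕ} (Φ : Formula n) (d k : ℕ) (h : Assignment n → ℚ) where

    success : List (Fin n) → Partial n → ℚ
    success s ρ = 𝔼 (tape k s) (λ ω → h (trial Φ d k s ρ ω))

    success-∷ : ∀ x s ρ → success (x ∷ s) ρ ≡
      mix (½ ^ k) (success s ρ) (½ * (success s (update Φ d ρ x false) + success s (update Φ d ρ x true)))
    success-∷ x s ρ = trans (Functional.ext (𝔼-functional (tape k (x ∷ s))) unfold)
      (trans (𝔼-select k G) (cong (λ z → mix (½ ^ k) z (𝔼 (suc (tape k s)) (G true))) (½-avg (success s ρ))))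
      where
      G : Bool → Vec Bool (suc (tape k s)) → ℚ
      G c (g ∷ ω) = h (trial Φ d k s (advance Φ d ρ x c g) ω)
      unfold : ∀ ω → h (trial Φ d k (x ∷ s) ρ ω) ≡ G (proj₁ (select k ω)) (proj₂ (select k ω))
      unfold ω with select k ω
      ... | c , g ∷ ω′ = refl

  free : ∀ {n} → Partial n → ℕ
  free []            = 0
  free (just _ ∷ ρ)  = free ρ
  free (nothing ∷ ρ) = suc (free ρ)

  free-≤ : ∀ {n} (ρ : Partial n) → free ρ ℕ.≤ n
  free-≤ []            = ℕ.z≤n
  free-≤ (just _ ∷ ρ)  = ℕP.m≤n⇒m≤1+n (free-≤ ρ)
  free-≤ (nothing ∷ ρ) = ℕ.s≤s (free-≤ ρ)

  ∑-unassigned : ∀ {n} (ρ : Partial n) → ∑F n (λ y → indicator (unassigned ρ y)) ≡ ι (free ρ)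
  ∑-unassigned []            = refl
  ∑-unassigned (just b ∷ ρ)  = trans (cong (λ z → 0ℚ + z) (trans (Functional.ext (∑F-functional _) (same {b = b} ρ)) (∑-unassigned ρ))) (+-identityˡ (ι (free ρ)))
    where
    same : ∀ {n} {b} (ρ : Partial n) y → indicator (unassigned (just b ∷ ρ) (suc y)) ≡ indicator (unassigned ρ y)
    same ρ y with lookup ρ y
    ... | just _  = refl
    ... | nothing = refl
  ∑-unassigned (nothing ∷ ρ) = cong (λ z → 1ℚ + z) (trans (Functional.ext (∑F-functional _) (same ρ)) (∑-unassigned ρ))
    where
    same : ∀ {n} (ρ : Partial n) y → indicator (unassigned (nothing ∷ ρ) (suc y)) ≡ indicator (unassigned ρ y)
    same ρ y with lookup ρ y
    ... | just _  = refl
    ... | nothing = refl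

  fill-success : ∀ {n} (h : Assignment n → ℚ) → (∀ α → 0ℚ ≤ h α) → ∀ (ρ : Partial n) α → ρ ≼ α → 1ℚ ≤ h α →
                 ½ ^ free ρ ≤ 𝔼 n (λ ω → h (fill ρ ω))
  fill-success h 0≤h [] [] _ 1≤h = 1≤h
  fill-success {suc n} h 0≤h (just b ∷ ρ) (a ∷ α) le 1≤h with at le zero b refl
  ... | refl = subst (½ ^ free ρ ≤_) (sym (½-avg (𝔼 n (λ ω → h (b ∷ fill ρ ω)))))
    (fill-success (λ β → h (b ∷ β)) (λ β → 0≤h (b ∷ β)) ρ α (agrees λ x c → at le (suc x) c) 1≤h)
  fill-success {suc n} h 0≤h (nothing ∷ ρ) (a ∷ α) le 1≤h = *-monoˡ 0≤½ (go a 1≤h)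
    where
    E : Bool → ℚ
    E b = 𝔼 n (λ ω → h (b ∷ fill ρ ω))
    E≥0 : ∀ b → 0ℚ ≤ E b
    E≥0 b = Functional.≥0 (𝔼-functional n) (λ ω → 0≤h (b ∷ fill ρ ω))
    ih : ∀ b → 1ℚ ≤ h (b ∷ α) → ½ ^ free ρ ≤ E b
    ih b 1≤ = fill-success (λ β → h (b ∷ β)) (λ β → 0≤h (b ∷ β)) ρ α (agrees λ x c → at le (suc x) c) 1≤
    go : ∀ a → 1ℚ ≤ h (a ∷ α) → ½ ^ free ρ ≤ E false + E true
    go false 1≤ = ≤-trans (ih false 1≤) (≤-by (E true) (E≥0 true) refl)
    go true  1≤ = ≤-trans (ih true 1≤) (≤-by (E false) (E≥0 false) (+-comm (E false) (E true)))

  -- Instead of 2^(-c), which need not be rational, the success probability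
  -- is compared with (1 - u c)^N for suitable u and N.
  module _ {n : ℕ} (Φ : Formula n) (d k : ℕ) (ν : ℚ) (0≤ν : 0ℚ ≤ ν) (ν≤1 : ν ≤ 1ℚ) (ν-inverse : ν * (1ℚ + ½ ^ k) ≡ 1ℚ)
           (S : ℕ → ℚ) (0≤S : ∀ m → 0ℚ ≤ S m) (S≤1 : ∀ m → S m ≤ 1ℚ) (S0 : S 0 ≡ 1ℚ)
           (δ : ℚ) (0≤δ : 0ℚ ≤ δ) (δ≤1 : δ ≤ 1ℚ)
           (S-decrease : ∀ m → (1ℚ - ½ ^ k) * S m + ½ ^ k * (1ℚ + 1ℚ) ≤ (1ℚ + ½ ^ k) * (S (suc m) + δ))
           (u : ℚ) (0≤u : 0ℚ ≤ u) (N : ℕ) (u-small : u * (1ℚ + ι n) ≤ 1ℚ) (halves : (1ℚ - u) ^ N ≤ ½)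
           (gains : ∀ {c} → 0ℚ ≤ c → c ≤ ι n → (1ℚ - u * c) ^ N ≤ (1ℚ + ½ ^ k) * (1ℚ - u * (c + δ)) ^ N)
           (h : Assignment n → ℚ) (0≤h : ∀ α → 0ℚ ≤ h α) (1≤h : ∀ α → Models α Φ → 1ℚ ≤ h α) where

    private
      q = ½ ^ k
      pq : Prob q
      pq = prob (^-≥0 k 0≤½) (^-≤1 k 0≤½ (≤ᵇ⇒≤ _))

    open Cost q pq ν 0≤ν ν≤1 ν-inverse Φ d

    private
      E : ℚ → ℚ
      E c = (1ℚ - u * c) ^ N

      p : List (Fin n) → Partial n → ℚ
      p = success Φ d k h

      tot : List (Fin n) → Partial n → ℚ
      tot = total S 0≤S

      base-≥0 : ∀ {c} → c ≤ 1ℚ + ι n → 0ℚ ≤ 1ℚ - u * c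
      base-≥0 h = ≤⇒0≤- (≤-trans (*-monoˡ 0≤u h) u-small)

      E-≥0 : ∀ {c} → c ≤ 1ℚ + ι n → 0ℚ ≤ E c
      E-≥0 h = ^-≥0 N (base-≥0 h)

      E-anti : ∀ {b c} → b ≤ c → c ≤ 1ℚ + ι n → E c ≤ E b
      E-anti b≤c c≤ = ^-mono N (base-≥0 c≤) (+-monoʳ-≤ 1ℚ (neg-antimono-≤ (*-monoˡ 0≤u b≤c)))

      n≤1+n : ι n ≤ 1ℚ + ι n
      n≤1+n = ≤-by 1ℚ 0≤1 (+-comm 1ℚ (ι n))

      c+1 : ∀ {c} → c ≤ ι n → c + 1ℚ ≤ 1ℚ + ι n
      c+1 {c} h = subst (c + 1ℚ ≤_) (+-comm (ι n) 1ℚ) (+-monoˡ-≤ 1ℚ h)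

      -- The product `(1ℚ - u) * (1ℚ - u * c)` exceeds `1ℚ - u * (c + 1ℚ)` by the nonnegative term
      -- `u * (u * c)`.
      E-half : ∀ {c} → 0ℚ ≤ c → c ≤ ι n → E (c + 1ℚ) ≤ ½ * E c
      E-half {c} 0≤c c≤n = ≤-trans (^-mono N (base-≥0 (c+1 c≤n)) (≤-by (u * (u * c)) (0≤* 0≤u (0≤* 0≤u 0≤c)) (lem u c)))
        (≤-trans (≤-reflexive (^-distrib-* (1ℚ - u) (1ℚ - u * c) N)) (*-monoʳ (E-≥0 (≤-trans c≤n n≤1+n)) halves))
        where
        lem : ∀ u c → (1ℚ - u) * (1ℚ - u * c) ≡ (1ℚ - u * (c + 1ℚ)) + u * (u * c)
        lem = solve-∀ ℚ-ring

      -- Jensen's inequality, by `mix-^` on the bases.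
      E-convex : ∀ {r a b} → Prob r → a ≤ 1ℚ + ι n → b ≤ 1ℚ + ι n → E (mix r a b) ≤ mix r (E a) (E b)
      E-convex {r} {a} {b} pr a≤ b≤ = subst (λ z → z ^ N ≤ mix r (E a) (E b)) (lem r u a b) (mix-^ N pr (base-≥0 a≤) (base-≥0 b≤))
        where
        lem : ∀ r u a b → (1ℚ - r) * (1ℚ - u * a) + r * (1ℚ - u * b) ≡ 1ℚ - u * ((1ℚ - r) * a + r * b)
        lem = solve-∀ ℚ-ring

      E-0 : E 0ℚ ≡ 1ℚ
      E-0 = trans (cong (_^ N) (lem u)) (1^ N)
        where
        lem : ∀ u → 1ℚ - u * 0ℚ ≡ 1ℚ
        lem = solve-∀ ℚ-ring

      E-ι : ∀ m → m ℕ.≤ n → E (ι m) ≤ ½ ^ m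
      E-ι zero    _   = ≤-reflexive E-0
      E-ι (suc m) m<n = ≤-trans (subst (λ z → E z ≤ ½ * E (ι m)) (+-comm (ι m) 1ℚ) (E-half (0≤ι m) (ι-mono m≤n))) (*-monoˡ 0≤½ (E-ι m m≤n))
        where
        m≤n = ℕP.<⇒≤ m<n

      p-≥0 : ∀ s ρ → 0ℚ ≤ p s ρ
      p-≥0 s ρ = Functional.≥0 (𝔼-functional (tape k s)) (λ ω → 0≤h (trial Φ d k s ρ ω))

      tot-≤ : ∀ s ρ → Bounded S 0≤S s → Sat ρ → tot s ρ ≤ ι n
      tot-≤ s ρ bd sat = subst (tot s ρ ≤_) (*-identityʳ (ι n)) (∑F-bound n λ y → ≤-trans (cost-≤ S 0≤S s y bd sat) (S≤1 (turns s y)))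

      update-known : ∀ {ρ x b} g → lookup ρ x ≡ just b → update Φ d ρ x g ≡ ρ
      update-known {ρ} {x} g eq with lookup ρ x
      ... | just _ = refl

      update-free : ∀ {ρ x} g → lookup ρ x ≡ nothing → update Φ d ρ x g ≡ assign ρ (x , fromMaybe g (forced Φ d ρ x))
      update-free {ρ} {x} g eq with lookup ρ x
      ... | nothing = refl

    -- Every suffix of s occurs as the rest of the script during the run.
    success-≥ : ∀ s → (∀ a t → a ++ t ≡ s → Bounded S 0≤S t) → ∀ ρ → Sat ρ → E (tot s ρ) ≤ p s ρ
    success-≥ [] bd ρ (α , sol) = ≤-trans (E-anti le (≤-trans (tot-≤ [] ρ (bd [] [] refl) (α , sol)) n≤1+n))
      (≤-trans (E-ι (free ρ) (free-≤ ρ)) (fill-success h 0≤h ρ α (proj₂ sol) (1≤h α (proj₁ sol))))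
      where
      le : ι (free ρ) ≤ tot [] ρ
      le = subst (_≤ tot [] ρ) (∑-unassigned ρ) (Functional.mono (∑F-functional n) (λ y → cost-[] S 0≤S S0 y (α , sol)))
    success-≥ (x ∷ s) bd ρ sat@(α , sol) = subst (E (tot (x ∷ s) ρ) ≤_) (sym (success-∷ Φ d k h x s ρ)) (by (lookup ρ x) refl)
      where
      bd-s = bd (x ∷ []) s refl
      T = tot (x ∷ s) ρ
      T≤n = tot-≤ (x ∷ s) ρ (bd [] (x ∷ s) refl) sat
      ih : ∀ σ → Sat σ → E (tot s σ) ≤ p s σ
      ih = success-≥ s (λ a t eq → bd (x ∷ a) t (cong (x ∷_) eq))
      goal : Set
      goal = E T ≤ mix q (p s ρ) (½ * (p s (update Φ d ρ x false) + p s (update Φ d ρ x true)))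
      by : ∀ v → lookup ρ x ≡ v → goal
      by (just b) eq = subst (E T ≤_) (sym (trans (cong (mix q (p s ρ)) (trans (cong₂ (λ σ τ → ½ * (p s σ + p s τ)) (update-known false eq) (update-known true eq)) (½-avg (p s ρ)))) (mix-id q (p s ρ))))
        (≤-trans (E-anti (total-known S 0≤S x s eq) (≤-trans T≤n n≤1+n)) (ih ρ sat))
      by nothing eq = split eq (liquid? Φ ρ x)
        where
        split : lookup ρ x ≡ nothing → Dec (Liquid Φ ρ x) → goal
        split eq (no nl) = frozen (forced Φ d ρ x) refl
          where
          b = lookup α x
          σ = assign ρ (x , b)
          can : Can Φ ρ x b
          can = α , sol , refl
          satσ = sat-assign can
          T₀≤ = ≤-trans (tot-≤ s ρ bd-s sat) n≤1+n
          T₁≤n = tot-≤ s σ bd-s satσ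
          le : mix q (tot s ρ) (tot s σ + indicator (unforced Φ d x ρ)) ≤ T
          le = total-frozen S 0≤S x s bd-s eq nl can
          frozen : ∀ f → forced Φ d ρ x ≡ f → goal
          frozen (just c) f = subst (E T ≤_) (sym (cong (mix q (p s ρ)) (trans (cong₂ (λ σ τ → ½ * (p s σ + p s τ)) (upd false) (upd true)) (½-avg (p s σ)))))
            (≤-trans (E-anti (subst (λ z → mix q (tot s ρ) z ≤ T) drop le) (≤-trans T≤n n≤1+n))
            (≤-trans (E-convex pq T₀≤ (≤-trans T₁≤n n≤1+n)) (mix-mono pq (ih ρ sat) (ih σ satσ))))
            where
            upd : ∀ g → update Φ d ρ x g ≡ σ
            upd g = trans (update-free g eq) (cong (λ w → assign ρ (x , w)) (trans (cong (fromMaybe g) f) (sym (forced-sound {Φ = Φ} {α} d (proj₁ sol) (proj₂ sol) f))))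
            drop : tot s σ + indicator (unforced Φ d x ρ) ≡ tot s σ
            drop = trans (cong (λ w → tot s σ + indicator w) (unforced-forced {Φ = Φ} {d} {ρ} f)) (+-identityʳ (tot s σ))
          -- An unforced frozen variable gets its only good value with probability ½; the other
          -- branch is bounded by 0. The unit of cost saved makes up for this half.
          frozen nothing f = ≤-trans (E-anti (subst (λ z → mix q (tot s ρ) (tot s σ + z) ≤ T) (cong indicator unf) le) (≤-trans T≤n n≤1+n))
            (≤-trans (E-convex pq T₀≤ (c+1 T₁≤n)) (mix-mono pq (ih ρ sat)
              (≤-trans (E-half (total-≥0 S 0≤S s σ) T₁≤n) (*-monoˡ 0≤½ (≤-trans (ih σ satσ) (one b refl))))))
            where
            unf : unforced Φ d x ρ ≡ true
            unf = unforced-free {Φ = Φ} {d} {ρ} eq f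
            upd : ∀ g → update Φ d ρ x g ≡ assign ρ (x , g)
            upd g = trans (update-free g eq) (cong (λ w → assign ρ (x , w)) (cong (fromMaybe g) f))
            one : ∀ c → c ≡ b → p s σ ≤ p s (update Φ d ρ x false) + p s (update Φ d ρ x true)
            one false e = subst (λ τ → p s τ ≤ p s (update Φ d ρ x false) + p s (update Φ d ρ x true)) (trans (upd false) (cong (λ w → assign ρ (x , w)) e))
              (≤-by (p s (update Φ d ρ x true)) (p-≥0 s _) refl)
            one true e = subst (λ τ → p s τ ≤ p s (update Φ d ρ x false) + p s (update Φ d ρ x true)) (trans (upd true) (cong (λ w → assign ρ (x , w)) e))
              (≤-by (p s (update Φ d ρ x false)) (p-≥0 s _) (+-comm (p s (update Φ d ρ x false)) (p s (update Φ d ρ x true))))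
        -- Both values may succeed. In total this is `1ℚ + q` times an average with the probability
        -- `q′`, that is 2q / (1 + q), and `gains` trades the factor `1ℚ + q` for the excess `δ` in
        -- the cost.
        split eq (yes l@(ct , cf)) = ≤-trans (gains (total-≥0 S 0≤S (x ∷ s) ρ) T≤n)
            (≤-trans (*-monoˡ 0≤1+q (≤-trans (E-anti below (≤-trans (+-mono-≤ T≤n δ≤1) (≤-reflexive (+-comm (ι n) 1ℚ)))) (E-convex pr T₀≤ mid≤)))
            (subst (_≤ mix q (p s ρ) (½ * (p s (update Φ d ρ x false) + p s (update Φ d ρ x true)))) (sym (unmix (E (tot s ρ)) (E mid)))
              (mix-mono pq (ih ρ sat) halves₂)))
          where
          σ = assign ρ (x , true)
          τ = assign ρ (x , false)
          satσ = sat-assign ct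
          satτ = sat-assign cf
          T₀≤ = ≤-trans (tot-≤ s ρ bd-s sat) n≤1+n
          σ≤ = tot-≤ s σ bd-s satσ
          τ≤ = tot-≤ s τ bd-s satτ
          0≤1+q = 0≤+ 0≤1 (lo pq)
          q′ = ν * (q + q)
          mid = mix ½ (tot s σ + 1ℚ) (tot s τ + 1ℚ)
          ½-prob : Prob ½
          ½-prob = prob 0≤½ (≤ᵇ⇒≤ _)
          mid≤ : mid ≤ 1ℚ + ι n
          mid≤ = mix-≤ ½-prob (c+1 σ≤) (c+1 τ≤)
          pr : Prob q′
          pr = prob (0≤* 0≤ν (0≤+ (lo pq) (lo pq)))
            (subst (q′ ≤_) ν-inverse (*-monoˡ 0≤ν (+-monoˡ-≤ q (hi pq))))
          lem₁ : ∀ v q a b → (1ℚ + q) * ((1ℚ - v * (q + q)) * a + v * (q + q) * b) ≡ ((1ℚ + q) - (v * (1ℚ + q)) * (q + q)) * a + (v * (1ℚ + q)) * (q + q) * b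
          lem₁ = solve-∀ ℚ-ring
          lem₂ : ∀ q a b → ((1ℚ + q) - 1ℚ * (q + q)) * a + 1ℚ * (q + q) * b ≡ (1ℚ - q) * a + q * (b + b)
          lem₂ = solve-∀ ℚ-ring
          unmix : ∀ a b → (1ℚ + q) * mix q′ a b ≡ mix q a (b + b)
          unmix a b = trans (lem₁ ν q a b) (trans (cong (λ z → ((1ℚ + q) - z * (q + q)) * a + z * (q + q) * b) ν-inverse) (lem₂ q a b))
          lem₃ : ∀ h a b → ((1ℚ - h) * a + h * b) + ((1ℚ - h) * a + h * b) ≡ ((1ℚ - h) + (1ℚ - h)) * a + (h + h) * b
          lem₃ = solve-∀ ℚ-ring
          mid+mid : ∀ a b → mix ½ a b + mix ½ a b ≡ a + b
          mid+mid a b = trans (lem₃ ½ a b) (cong₂ _+_ (*-identityˡ a) (*-identityˡ b))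
          below : mix q′ (tot s ρ) mid ≤ T + δ
          below = subst₂ _≤_ (cancel (mix q′ (tot s ρ) mid)) (cancel (T + δ)) (*-monoˡ 0≤ν
            (subst (_≤ (1ℚ + q) * (T + δ)) (sym (trans (unmix (tot s ρ) mid) (cong (mix q (tot s ρ)) (mid+mid (tot s σ + 1ℚ) (tot s τ + 1ℚ)))))
              (total-liquid S 0≤S x s δ bd-s l S-decrease)))
            where
            cancel : ∀ a → ν * ((1ℚ + q) * a) ≡ a
            cancel a = trans (sym (*-assoc ν (1ℚ + q) a)) (trans (cong (_* a) ν-inverse) (*-identityˡ a))
          -- A liquid variable is never forced, since forcing is sound for solutions of both kinds.
          f : forced Φ d ρ x ≡ nothing
          f with forced Φ d ρ x in e
          ... | nothing = refl
          ... | just c = ⊥-elim (contra (trans (sym (proj₂ (proj₂ ct))) (trans (forced-sound {Φ = Φ} d (proj₁ (proj₁ (proj₂ ct))) (proj₂ (proj₁ (proj₂ ct))) e)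
                           (trans (sym (forced-sound {Φ = Φ} d (proj₁ (proj₁ (proj₂ cf))) (proj₂ (proj₁ (proj₂ cf))) e)) (proj₂ (proj₂ cf))))))
            where
            contra : true ≢ false
            contra ()
          upd : ∀ g → update Φ d ρ x g ≡ assign ρ (x , g)
          upd g = trans (update-free g eq) (cong (λ w → assign ρ (x , w)) (cong (fromMaybe g) f))
          halves₂ : E mid + E mid ≤ ½ * (p s (update Φ d ρ x false) + p s (update Φ d ρ x true))
          halves₂ = ≤-trans (+-mono-≤ (E-convex ½-prob (c+1 σ≤) (c+1 τ≤)) (E-convex ½-prob (c+1 σ≤) (c+1 τ≤)))
            (subst (_≤ ½ * (p s (update Φ d ρ x false) + p s (update Φ d ρ x true))) (sym (mid+mid (E (tot s σ + 1ℚ)) (E (tot s τ + 1ℚ))))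
              (subst (E (tot s σ + 1ℚ) + E (tot s τ + 1ℚ) ≤_) (trans (+-comm (½ * p s σ) (½ * p s τ)) (trans (sym (*-distribˡ-+ ½ (p s τ) (p s σ)))
                  (cong₂ (λ a b → ½ * (p s a + p s b)) (sym (upd false)) (sym (upd true)))))
                (+-mono-≤ (≤-trans (E-half (total-≥0 S 0≤S s σ) σ≤) (*-monoˡ 0≤½ (ih σ satσ)))
                          (≤-trans (E-half (total-≥0 S 0≤S s τ) τ≤) (*-monoˡ 0≤½ (ih τ satτ))))))

-- Certified numerical bound for the cost of a variable.

module FixedPoint where

  open Arithmetic
  open Cuts
  open Spending
  open import Data.Bool using (T)
  open import Data.Integer using (+_)
  open import Data.Nat as ℕ using (ℕ; zero; suc; NonZero; _∸_; _≤ᵇ_)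
  import Data.Nat.DivMod as ℕ
  import Data.Nat.Properties as ℕP
  open import Data.Rational hiding (_≟_; _≤ᵇ_; NonZero)
  open import Data.Rational.Properties hiding (_≟_)
  open import Tactic.RingSolver

  private
    lem-r : ∀ q w r → 1ℚ - w * (1ℚ - ((1ℚ - q) * r + q * 1ℚ)) ≡ 1ℚ - ((1ℚ - q) * w) * (1ℚ - r)
    lem-r = solve-∀ ℚ-ring
    lem-b : ∀ q b w c e → (1ℚ - q) * (b - q * w * c) + q * e ≡ ((1ℚ - q) * b + q * e) - q * ((1ℚ - q) * w) * c
    lem-b = solve-∀ ℚ-ring
    lem-0 : ∀ q c → (1ℚ - q) * 1ℚ + q * (1ℚ - c) ≡ 1ℚ - q * 1ℚ * c
    lem-0 = solve-∀ ℚ-ring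
    lem-1 : ∀ r → 1ℚ - 1ℚ * (1ℚ - r) ≡ r
    lem-1 = solve-∀ ℚ-ring

  -- The recursion of `bound` adds a turn in front; here it is added at the end. It is reached
  -- unpicked with probability `(1ℚ - q) ^ m`, and then `cut` is evaluated at the chance of being
  -- revealed by that time. So the bounds for all `m` come from one running sum.
  bound-suc : ∀ q d m r → bound q d (suc m) r ≡ bound q d m r - q * (1ℚ - q) ^ m * cut d (1ℚ - (1ℚ - q) ^ m * (1ℚ - r))
  bound-suc q d zero r = trans (lem-0 q (cut d r)) (cong (λ z → 1ℚ - q * 1ℚ * cut d z) (sym (lem-1 r)))
  bound-suc q d (suc m) r = trans (cong (λ z → mix q z (1ℚ - cut d r)) (bound-suc q d m r⁺))
    (trans (lem-b q (bound q d m r⁺) w (cut d (1ℚ - w * (1ℚ - r⁺))) (1ℚ - cut d r))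
      (cong (λ z → bound q d (suc m) r - q * ((1ℚ - q) * w) * cut d z) (lem-r q w r)))
    where
    w = (1ℚ - q) ^ m
    r⁺ = mix q r 1ℚ

  cut-mono : ∀ d {r c} → Prob r → Prob c → r ≤ c → cut d r ≤ cut d c
  cut-mono zero    _  _  _   = ≤-refl
  cut-mono (suc d) pr pc r≤c = ^-mono 2 (lo (mix-prob pr (cut-prob d pr) prob1))
    (mix1-mono pr r≤c (cut-mono d pr pc r≤c) (hi (cut-prob d pc)))

  -- Fixed-point arithmetic: a stands for a / M.
  cutN : (M : ℕ) .{{_ : NonZero M}} → ℕ → ℕ → ℕ
  cutN M zero    a = 0
  cutN M (suc d) a = square ((M ∸ a) ℕ.* cutN M d a ℕ./ M ℕ.+ a)
    where
    square : ℕ → ℕ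
    square m = m ℕ.* m ℕ./ M

  -- An upper bound for M · bound m 0, and bounds for M · (1 - q)^m from below and above.
  record State : Set where
    constructor state
    field s wlo whi : ℕ
  open State

  -- The guard is a multiple of the inequality between S m and S (suc m) that
  -- Trials.success-≥ asks for; with a = 630, b = 20 and k = 7 it is the one for
  -- q = 1/64 and δ = 1/50.  The second condition makes s itself admissible next.
  choose : (a b k M s s′ : ℕ) → ℕ
  choose a b k M s s′ = if (a ℕ.* s ℕ.+ k ℕ.* M ≤ᵇ (a ℕ.+ b) ℕ.* s′) ∧ (k ℕ.* M ≤ᵇ b ℕ.* s′) then s′ else s

  -- If `s` is kept, the guarded inequality reduces to the invariant `k * M ≤ b * s`, which is
  -- therefore maintained.
  choose-cases : ∀ a b k M s s′ → k ℕ.* M ℕ.≤ b ℕ.* s → let z = choose a b k M s s′ in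
    a ℕ.* s ℕ.+ k ℕ.* M ℕ.≤ (a ℕ.+ b) ℕ.* z × k ℕ.* M ℕ.≤ b ℕ.* z × (z ≡ s ⊎ z ≡ s′)
  choose-cases a b k M s s′ inv with (a ℕ.* s ℕ.+ k ℕ.* M ≤ᵇ (a ℕ.+ b) ℕ.* s′) ∧ (k ℕ.* M ≤ᵇ b ℕ.* s′) in eq
  ... | true with to T-∧ (subst T (sym eq) tt)
  ...   | u , v = ℕP.≤ᵇ⇒≤ (a ℕ.* s ℕ.+ k ℕ.* M) ((a ℕ.+ b) ℕ.* s′) u , ℕP.≤ᵇ⇒≤ (k ℕ.* M) (b ℕ.* s′) v , inj₂ refl
  choose-cases a b k M s s′ inv | false = subst (a ℕ.* s ℕ.+ k ℕ.* M ℕ.≤_) (sym (ℕP.*-distribʳ-+ s a b)) (ℕP.+-monoʳ-≤ (a ℕ.* s) inv) , inv , inj₁ refl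

  -- All roundings keep the first field an upper bound: the amount subtracted from `s` is rounded
  -- down, as is `wlo`, while `whi` is rounded up because the cut grows with `M ∸ whi`. The factor
  -- 63/64 is `1ℚ - q`.
  next : (a b k M : ℕ) .{{_ : NonZero M}} → ℕ → State → State
  next a b k M d (state s wlo whi) =
    state (choose a b k M s (s ∸ wlo ℕ.* cutN M d (M ∸ whi) ℕ./ M ℕ./ 64)) (wlo ℕ.* 63 ℕ./ 64) (suc (whi ℕ.* 63 ℕ./ 64))

  iterate : (a b k M : ℕ) .{{_ : NonZero M}} → ℕ → ℕ → State
  iterate a b k M d zero    = state M M M
  iterate a b k M d (suc m) = next a b k M d (iterate a b k M d m)

  module _ (a b k : ℕ) (k≤b : k ℕ.≤ b) (M : ℕ) {{_ : NonZero M}} (ε : ℚ) (0≤ε : 0ℚ ≤ ε) (Mε : ι M * ε ≡ 1ℚ) (d : ℕ) (q : ℚ) (pq : Prob q) (q64 : q * ι 64 ≡ 1ℚ) where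

    num : ℕ → ℚ
    num a = ι a * ε

    num-mono : ∀ {a b} → a ℕ.≤ b → num a ≤ num b
    num-mono h = *-monoʳ 0≤ε (ι-mono h)

    0≤num : ∀ a → 0ℚ ≤ num a
    0≤num a = 0≤* (0≤ι a) 0≤ε

    num-+ : ∀ a b → num (a ℕ.+ b) ≡ num a + num b
    num-+ a b = trans (cong (_* ε) (ι-+ a b)) (*-distribʳ-+ ε (ι a) (ι b))

    num-∸ : ∀ a b → num a - num b ≤ num (a ∸ b)
    num-∸ a b = 0≤-⇒≤ (subst (0ℚ ≤_) (trans (cong (λ z → z - num a) (num-+ (a ∸ b) b)) (lem (num (a ∸ b)) (num a) (num b)))
      (≤⇒0≤- (num-mono (subst (a ℕ.≤_) (ℕP.+-comm b (a ∸ b)) (ℕP.m≤n+m∸n a b)))))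
      where
      lem : ∀ x a b → (x + b) - a ≡ x - (a - b)
      lem = solve-∀ ℚ-ring

    num-compl : ∀ {b w} → w ≤ 1ℚ → w ≤ num b → num (M ∸ b) ≤ 1ℚ - w
    num-compl {b} {w} w≤1 w≤b with ℕP.≤-total b M
    ... | inj₁ b≤M = 0≤-⇒≤ (subst (0ℚ ≤_) eq (≤⇒0≤- w≤b))
      where
      lem : ∀ x b w → b - w ≡ (x + b - w) - x
      lem = solve-∀ ℚ-ring
      eq : num b - w ≡ (1ℚ - w) - num (M ∸ b)
      eq = trans (lem (num (M ∸ b)) (num b) w) (cong (λ z → (z - w) - num (M ∸ b))
        (trans (sym (num-+ (M ∸ b) b)) (trans (cong num (ℕP.m∸n+n≡m b≤M)) Mε)))
    ... | inj₂ M≤b = subst (_≤ 1ℚ - w) (sym (trans (cong num (ℕP.m≤n⇒m∸n≡0 M≤b)) (*-zeroˡ ε))) (≤⇒0≤- w≤1)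

    num-* : ∀ a b → num (a ℕ.* b ℕ./ M) ≤ num a * num b
    num-* a b = subst₂ _≤_ (trans (cong (λ z → z * (ε * ε)) (ι-* x M)) (trans (lem₁ (ι x) (ι M) ε) (trans (cong (num x *_) Mε) (*-identityʳ (num x)))))
      (trans (cong (λ z → z * (ε * ε)) (ι-* a b)) (lem₂ (ι a) (ι b) ε))
      (*-monoʳ (0≤* 0≤ε 0≤ε) (ι-mono (ℕ.m/n*n≤m (a ℕ.* b) M)))
      where
      x = a ℕ.* b ℕ./ M
      lem₁ : ∀ x m e → x * m * (e * e) ≡ x * e * (m * e)
      lem₁ = solve-∀ ℚ-ring
      lem₂ : ∀ a b e → a * b * (e * e) ≡ a * e * (b * e)
      lem₂ = solve-∀ ℚ-ring

    cutN-≤ : ∀ e {a r} → a ℕ.≤ M → Prob r → num a ≤ r → num (cutN M e a) ≤ cut e r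
    cutN-≤ zero    {a} {r} a≤M pr a≤r = ≤-reflexive (*-zeroˡ ε)
    cutN-≤ (suc e) {a} {r} a≤M pr a≤r = ≤-trans (num-* m m) (≤-trans (*-mono (0≤num m) (≤-trans (0≤num m) m≤) m≤ m≤)
        (≤-reflexive (cong (x *_) (sym (*-identityʳ x)))))
      where
      m = (M ∸ a) ℕ.* cutN M e a ℕ./ M ℕ.+ a
      x = mix r (cut e r) 1ℚ
      pa : Prob (num a)
      pa = prob (0≤num a) (subst (num a ≤_) Mε (num-mono a≤M))
      m≤ : num m ≤ x
      m≤ = ≤-trans (≤-reflexive (num-+ ((M ∸ a) ℕ.* cutN M e a ℕ./ M) a)) (≤-trans
        (+-mono-≤ (≤-trans (num-* (M ∸ a) (cutN M e a)) (*-monoʳ (0≤num (cutN M e a)) (num-compl {a} {num a} (hi pa) ≤-refl)))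
                  (≤-reflexive (sym (*-identityʳ (num a)))))
        (mix1-mono pa a≤r (cutN-≤ e a≤M pr a≤r) (hi (cut-prob e pr))))

    private
      ι63 : (1ℚ - q) * ι 64 ≡ ι 63
      ι63 = trans (lem q (ι 63)) (trans (cong (λ z → (1ℚ + ι 63) - z) q64) (lem₂ (ι 63)))
        where
        lem : ∀ q a → (1ℚ - q) * (1ℚ + a) ≡ (1ℚ + a) - q * (1ℚ + a)
        lem = solve-∀ ℚ-ring
        lem₂ : ∀ a → (1ℚ + a) - 1ℚ ≡ a
        lem₂ = solve-∀ ℚ-ring

      descale : ∀ {x y} → x * ι 64 ≤ y * ι 64 → x ≤ y
      descale {x} {y} h = subst₂ _≤_ (back x) (back y) (*-monoˡ (lo pq) h)
        where
        lem : ∀ q x k → q * (x * k) ≡ x * (q * k)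
        lem = solve-∀ ℚ-ring
        back : ∀ x → q * (x * ι 64) ≡ x
        back x = trans (lem q x (ι 64)) (trans (cong (x *_) q64) (*-identityʳ x))

      swap : ∀ a b c → a * b * c ≡ a * c * b
      swap = solve-∀ ℚ-ring

      num-ι : ∀ a k → num a * ι k ≡ num (a ℕ.* k)
      num-ι a k = trans (swap (ι a) ε (ι k)) (cong (_* ε) (sym (ι-* a k)))

      move : ∀ c x k → c * x * k ≡ (c * k) * x
      move = solve-∀ ℚ-ring

    shrink-lo : ∀ a {w} → num a ≤ w → num (a ℕ.* 63 ℕ./ 64) ≤ (1ℚ - q) * w
    shrink-lo a {w} h = ≤-trans (descale (subst₂ _≤_ (sym (num-ι (a ℕ.* 63 ℕ./ 64) 64))
        (sym (trans (move (1ℚ - q) (num a) (ι 64)) (trans (cong (_* num a) ι63) (trans (*-comm (ι 63) (num a)) (num-ι a 63)))))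
        (num-mono (ℕ.m/n*n≤m (a ℕ.* 63) 64)))) (*-monoˡ (≤⇒0≤- (hi pq)) h)

    shrink-hi : ∀ a {w} → w ≤ num a → (1ℚ - q) * w ≤ num (suc (a ℕ.* 63 ℕ./ 64))
    shrink-hi a {w} h = ≤-trans (*-monoˡ (≤⇒0≤- (hi pq)) h) (descale (subst₂ _≤_
        (sym (trans (move (1ℚ - q) (num a) (ι 64)) (trans (cong (_* num a) ι63) (trans (*-comm (ι 63) (num a)) (num-ι a 63)))))
        (sym (num-ι (suc (a ℕ.* 63 ℕ./ 64)) 64))
        (num-mono (subst (ℕ._≤ 64 ℕ.+ a ℕ.* 63 ℕ./ 64 ℕ.* 64) (sym (ℕ.m≡m%n+[m/n]*n (a ℕ.* 63) 64))
          (ℕP.+-monoˡ-≤ (a ℕ.* 63 ℕ./ 64 ℕ.* 64) (ℕP.<⇒≤ (ℕ.m%n<n (a ℕ.* 63) 64)))))))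

    quotient : ∀ a → num (a ℕ./ 64) ≤ q * num a
    quotient a = descale (subst₂ _≤_ (sym (num-ι (a ℕ./ 64) 64)) (sym (trans (move q (num a) (ι 64)) (trans (cong (_* num a) q64) (*-identityˡ (num a)))))
      (num-mono (ℕ.m/n*n≤m a 64)))

    record Good (m : ℕ) (t : State) : Set where
      field
        above : bound q d m 0ℚ ≤ num (s t)
        below : num (wlo t) ≤ (1ℚ - q) ^ m
        over  : (1ℚ - q) ^ m ≤ num (whi t)
        least : k ℕ.* M ℕ.≤ b ℕ.* s t
        most  : s t ℕ.≤ M
    open Good

    prob-w : ∀ m → Prob ((1ℚ - q) ^ m)
    prob-w m = prob (^-≥0 m (≤⇒0≤- (hi pq))) (^-≤1 m (≤⇒0≤- (hi pq)) (x-y≤x (lo pq)))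

    next-good : ∀ m t → Good m t → Good (suc m) (next a b k M d t) ×
                a ℕ.* s t ℕ.+ k ℕ.* M ℕ.≤ (a ℕ.+ b) ℕ.* s (next a b k M d t)
    next-good m (state s wlo whi) g = record
        { above = ≤-trans (≤-reflexive (bound-suc q d m 0ℚ)) (above′ cases)
        ; below = shrink-lo wlo (below g)
        ; over  = shrink-hi whi (over g)
        ; least = proj₁ (proj₂ cc)
        ; most  = most′ cases
        } , proj₁ cc
      where
      w = (1ℚ - q) ^ m
      p = cutN M d (M ∸ whi)
      x = wlo ℕ.* p ℕ./ M ℕ./ 64
      c = cut d (1ℚ - w * (1ℚ - 0ℚ))
      cc = choose-cases a b k M s (s ∸ x) (least g)
      cases = proj₂ (proj₂ cc)
      r≡ : 1ℚ - w * (1ℚ - 0ℚ) ≡ 1ℚ - w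
      r≡ = lem w
        where
        lem : ∀ w → 1ℚ - w * (1ℚ - 0ℚ) ≡ 1ℚ - w
        lem = solve-∀ ℚ-ring
      pr : Prob (1ℚ - w)
      pr = prob (≤⇒0≤- (hi (prob-w m))) (x-y≤x (lo (prob-w m)))
      p≤ : num p ≤ c
      p≤ = subst (λ r → num p ≤ cut d r) (sym r≡) (cutN-≤ d (ℕP.m∸n≤m M whi) pr (num-compl {whi} {w} (hi (prob-w m)) (over g)))
      x≤ : num x ≤ q * w * c
      x≤ = ≤-trans (quotient (wlo ℕ.* p ℕ./ M)) (≤-trans (*-monoˡ (lo pq) (≤-trans (num-* wlo p)
            (*-mono (0≤num wlo) (≤-trans (0≤num p) p≤) (below g) p≤))) (≤-reflexive (sym (*-assoc q w c))))
      above′ : ∀ {z} → z ≡ s ⊎ z ≡ s ∸ x → bound q d m 0ℚ - q * w * c ≤ num z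
      above′ (inj₁ refl) = ≤-trans (x-y≤x (≤-trans (0≤num x) x≤)) (above g)
      above′ (inj₂ refl) = ≤-trans (+-mono-≤ (above g) (neg-antimono-≤ x≤)) (num-∸ s x)
      most′ : ∀ {z} → z ≡ s ⊎ z ≡ s ∸ x → z ℕ.≤ M
      most′ (inj₁ refl) = most g
      most′ (inj₂ refl) = ℕP.≤-trans (ℕP.m∸n≤m s x) (most g)

    iterate-good : ∀ m → Good m (iterate a b k M d m)
    iterate-good zero = record
      { above = ≤-reflexive (sym Mε) ; below = ≤-reflexive Mε ; over = ≤-reflexive (sym Mε)
      ; least = ℕP.*-monoˡ-≤ M k≤b ; most = ℕP.≤-refl }
    iterate-good (suc m) = proj₁ (next-good m (iterate a b k M d m) (iterate-good m))

    limit : ℕ → ℚ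
    limit m = num (s (iterate a b k M d m))

    limit-bound : ∀ m → bound q d m 0ℚ ≤ limit m
    limit-bound m = above (iterate-good m)

    limit-≤1 : ∀ m → limit m ≤ 1ℚ
    limit-≤1 m = subst (limit m ≤_) Mε (num-mono (most (iterate-good m)))

    limit-allowed : ∀ m → ι a * limit m + ι k ≤ ι (a ℕ.+ b) * limit (suc m)
    limit-allowed m = subst₂ _≤_
      (trans (num-+ (a ℕ.* x) (k ℕ.* M)) (cong₂ _+_ (pull a x) (trans (pull k M) (trans (cong (ι k *_) Mε) (*-identityʳ (ι k))))))
      (pull (a ℕ.+ b) y)
      (num-mono (proj₂ (next-good m (iterate a b k M d m) (iterate-good m))))
      where
      x = s (iterate a b k M d m)
      y = s (iterate a b k M d (suc m))
      pull : ∀ k a → num (k ℕ.* a) ≡ ι k * num a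
      pull k a = trans (cong (_* ε) (ι-* k a)) (*-assoc (ι k) (ι a) ε)

-- Success probability from the constants, for every number of variables.

module LowerBound where

  open Arithmetic
  open Refutation
  open Spending
  open Costs
  open Trials
  open import Data.Integer using (+_)
  open import Data.Nat as ℕ using (ℕ; zero; suc)
  import Data.Nat.Properties as ℕP
  open import Data.Rational hiding (_≟_; NonZero)
  open import Data.Rational.Properties hiding (_≟_)
  open import Data.Vec using (replicate)
  open import Tactic.RingSolver

  bernoulli-+ : ∀ N {x} → 0ℚ ≤ x → 1ℚ + ι N * x ≤ (1ℚ + x) ^ N
  bernoulli-+ zero    {x} 0≤x = ≤-reflexive (lem x)
    where
    lem : ∀ x → 1ℚ + 0ℚ * x ≡ 1ℚ
    lem = solve-∀ ℚ-ring
  bernoulli-+ (suc N) {x} 0≤x = ≤-trans (≤-by (x * (ι N * x)) (0≤* 0≤x (0≤* (0≤ι N) 0≤x)) (lem x (ι N)))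
    (*-monoˡ (0≤+ 0≤1 0≤x) (bernoulli-+ N 0≤x))
    where
    lem : ∀ x k → (1ℚ + x) * (1ℚ + k * x) ≡ (1ℚ + (1ℚ + k) * x) + x * (k * x)
    lem = solve-∀ ℚ-ring

  bernoulli-- : ∀ N {x} → Prob x → 1ℚ - ι N * x ≤ (1ℚ - x) ^ N
  bernoulli-- zero    {x} px = ≤-reflexive (lem x)
    where
    lem : ∀ x → 1ℚ - 0ℚ * x ≡ 1ℚ
    lem = solve-∀ ℚ-ring
  bernoulli-- (suc N) {x} px = ≤-trans (≤-by (x * (ι N * x)) (0≤* (lo px) (0≤* (0≤ι N) (lo px))) (lem x (ι N)))
    (*-monoˡ (≤⇒0≤- (hi px)) (bernoulli-- N px))
    where
    lem : ∀ x k → (1ℚ - x) * (1ℚ - k * x) ≡ (1ℚ - (1ℚ + k) * x) + x * (k * x)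
    lem = solve-∀ ℚ-ring

  cancel-* : ∀ {a b c} → 1ℚ ≤ c → a * c ≤ b * c → a ≤ b
  cancel-* {c = c} 1≤c = *-cancelʳ-≤-pos c {{positive (<-≤-trans (positive⁻¹ 1ℚ) 1≤c)}}

  abstract
    reciprocal : ∀ n → Σ[ i ∈ ℚ ] (0ℚ ≤ i × ι (suc n) * i ≡ 1ℚ)
    reciprocal n = i , 0≤i′ , trans (*-comm (ι (suc n)) i) (trans (/≡ι* 1 (suc n)) (+-identityʳ 1ℚ))
      where
      i : ℚ
      i = + 1 / suc n
      0≤i′ : 0ℚ ≤ i
      0≤i′ = cancel-* (≤-by (ι n) (0≤ι n) refl) (subst₂ _≤_ (sym (*-zeroˡ (ι (suc n)))) (sym (trans (/≡ι* 1 (suc n)) (+-identityʳ 1ℚ))) 0≤1)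

  -- The N and u of Trials.success-≥ will be K (n + 1) and κ / (n + 1).
  record Constants (b η : ℚ) : Set where
    field
      d k R : ℕ
    q : ℚ
    q = ½ ^ k
    field
      ν         : ℚ
      0≤ν       : 0ℚ ≤ ν
      ν≤1       : ν ≤ 1ℚ
      ν-inverse : ν * (1ℚ + q) ≡ 1ℚ
      S         : ℕ → ℚ
      0≤S       : ∀ m → 0ℚ ≤ S m
      S≤1       : ∀ m → S m ≤ 1ℚ
      S0        : S 0 ≡ 1ℚ
      S-bound   : ∀ m → bound q d m 0ℚ ≤ S m
      δ δ′      : ℚ
      0≤δ       : 0ℚ ≤ δ
      δ≤1       : δ ≤ 1ℚ
      S-decrease : ∀ m → (1ℚ - q) * S m + q * (1ℚ + 1ℚ) ≤ (1ℚ + q) * (S (suc m) + δ)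
      B         : ℚ
      S-final   : S R ≤ B
      K         : ℕ
      κ         : ℚ
      0≤κ       : 0ℚ ≤ κ
      κ≤1       : κ ≤ 1ℚ
      doubles   : 1ℚ + 1ℚ ≤ (1ℚ + κ) ^ K
      δ′-prob   : Prob δ′
      δ≤        : δ ≤ δ′ * (1ℚ - κ)
      gain      : 1ℚ ≤ (1ℚ + q) * (1ℚ - ι K * κ * δ′)
      μ         : ℚ
      0≤μ       : 0ℚ ≤ μ
      μ≤        : μ ≤ 1ℚ - κ * B
      rate      : 1ℚ + η ≤ μ ^ K * b

  module _ {b η : ℚ} (C : Constants b η) where
    open Constants C

    private
      pq : Prob q
      pq = prob (^-≥0 k 0≤½) (^-≤1 k 0≤½ (≤ᵇ⇒≤ _))

    module _ {n : ℕ} (Φ : Formula n) (3cnf : All (λ C → length C ℕ.≤ 3) Φ) (h : Assignment n → ℚ)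
             (0≤h : ∀ α → 0ℚ ≤ h α) (1≤h : ∀ α → Models α Φ → 1ℚ ≤ h α) where

      private
        i = proj₁ (reciprocal n)
        0≤i = proj₁ (proj₂ (reciprocal n))
        ιi : ι (suc n) * i ≡ 1ℚ
        ιi = proj₂ (proj₂ (reciprocal n))
        u = κ * i
        N = K ℕ.* suc n

        0≤u : 0ℚ ≤ u
        0≤u = 0≤* 0≤κ 0≤i

        u*n : u * ι (suc n) ≡ κ
        u*n = trans (lem κ i (ι (suc n))) (trans (cong (κ *_) ιi) (*-identityʳ κ))
          where
          lem : ∀ a b c → a * b * c ≡ a * (c * b)
          lem = solve-∀ ℚ-ring

        u-small : u * (1ℚ + ι n) ≤ 1ℚ
        u-small = subst (_≤ 1ℚ) (sym u*n) κ≤1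

        u≤1 : u ≤ 1ℚ
        u≤1 = ≤-trans (≤-trans (≤-reflexive (sym (*-identityʳ u))) (*-monoˡ 0≤u (≤-by (ι n) (0≤ι n) refl))) u-small

        -- By Bernoulli's inequality (1 - u)^(n+1) times 1 + κ is at most ((1 - u)(1 + u))^(n+1),
        -- hence at most 1. The `K`-th power of 1 + κ is at least 2.
        halves : (1ℚ - u) ^ N ≤ ½
        halves = subst (_≤ ½) (sym (^-* (1ℚ - u) K (suc n)))
          (subst₂ _≤_ (trans (lem ½ a^K) (*-identityˡ a^K)) (*-identityʳ ½)
            (*-monoˡ 0≤½ (≤-trans (*-monoˡ 0≤a^K doubles) (≤-trans (≤-reflexive (sym (^-distrib-* a (1ℚ + κ) K))) (^-≤1 K (0≤* 0≤a (0≤+ 0≤1 0≤κ)) prod)))))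
          where
          a = (1ℚ - u) ^ suc n
          a^K = a ^ K
          0≤a : 0ℚ ≤ a
          0≤a = ^-≥0 (suc n) (≤⇒0≤- u≤1)
          0≤a^K = ^-≥0 K 0≤a
          lem : ∀ h a → h * (a * (1ℚ + 1ℚ)) ≡ (h + h) * a
          lem = solve-∀ ℚ-ring
          lem₂ : ∀ u → 1ℚ ≡ (1ℚ - u) * (1ℚ + u) + u * u
          lem₂ = solve-∀ ℚ-ring
          prod : a * (1ℚ + κ) ≤ 1ℚ
          prod = ≤-trans (*-monoˡ 0≤a (subst (λ z → 1ℚ + z ≤ (1ℚ + u) ^ suc n) (trans (*-comm (ι (suc n)) u) u*n) (bernoulli-+ (suc n) 0≤u)))
            (≤-trans (≤-reflexive (sym (^-distrib-* (1ℚ - u) (1ℚ + u) (suc n))))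
              (^-≤1 (suc n) (0≤* (≤⇒0≤- u≤1) (0≤+ 0≤1 0≤u)) (≤-by (u * u) (0≤* 0≤u 0≤u) (lem₂ u))))

        ι-N : ι N * (u * δ′) ≡ ι K * κ * δ′
        ι-N = trans (cong (_* (u * δ′)) (ι-* K (suc n))) (trans (lem (ι K) (ι (suc n)) u δ′) (cong (λ z → ι K * z * δ′) u*n))
          where
          lem : ∀ a b u d → a * b * (u * d) ≡ a * (u * b) * d
          lem = solve-∀ ℚ-ring

        -- As 1 - u c is at least 1 - κ, the choice of `δ′` gives (1 - u c)(1 - u δ′) ≤ 1 - u (c +
        -- δ). By Bernoulli's inequality the `N`-th power of 1 - u δ′ is at least 1 - K κ δ′, and
        -- `gain` compares this with 1 + q.
        gains : ∀ {c} → 0ℚ ≤ c → c ≤ ι n → (1ℚ - u * c) ^ N ≤ (1ℚ + q) * (1ℚ - u * (c + δ)) ^ N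
        gains {c} 0≤c c≤n = ≤-trans (≤-trans (≤-reflexive (sym (*-identityʳ (t ^ N)))) (*-monoˡ 0≤t^N gain))
          (≤-trans (≤-reflexive (lem (t ^ N) (1ℚ + q) (1ℚ - ι K * κ * δ′))) (*-monoˡ (0≤+ 0≤1 (lo pq)) (≤-trans
            (*-monoˡ 0≤t^N (subst (λ z → 1ℚ - z ≤ (1ℚ - u * δ′) ^ N) ι-N (bernoulli-- N pz)))
            (≤-trans (≤-reflexive (sym (^-distrib-* t (1ℚ - u * δ′) N))) (^-mono N (0≤* 0≤t (≤⇒0≤- (hi pz)))
              (≤-by (u * (δ′ * t - δ)) (0≤* 0≤u (≤⇒0≤- (≤-trans δ≤ (*-monoˡ (lo δ′-prob) κ≤t)))) (lem₂ u c δ δ′)))))))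
          where
          t = 1ℚ - u * c
          κ≤t : 1ℚ - κ ≤ t
          κ≤t = +-monoʳ-≤ 1ℚ (neg-antimono-≤ (subst (u * c ≤_) u*n (*-monoˡ 0≤u (≤-trans c≤n (≤-by 1ℚ 0≤1 (+-comm 1ℚ (ι n)))))))
          0≤t = ≤-trans (≤⇒0≤- κ≤1) κ≤t
          0≤t^N = ^-≥0 N 0≤t
          pz : Prob (u * δ′)
          pz = prob (0≤* 0≤u (lo δ′-prob)) (≤-trans (*-mono 0≤u 0≤1 u≤1 (hi δ′-prob)) (≤-reflexive (*-identityˡ 1ℚ)))
          lem : ∀ a b c → a * (b * c) ≡ b * (a * c)
          lem = solve-∀ ℚ-ring
          lem₂ : ∀ u c d e → 1ℚ - u * (c + d) ≡ (1ℚ - u * c) * (1ℚ - u * e) + u * (e * (1ℚ - u * c) - d)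
          lem₂ = solve-∀ ℚ-ring

      open Cost q pq ν 0≤ν ν≤1 ν-inverse Φ d

      bounded : ∀ a t → a ++ t ≡ rounds n R → Bounded S 0≤S t
      bounded a t eq {α} {ρ} {y} m le frozen free =
        ≤-trans (spent-bound q pq Φ d α 3cnf m le y frozen free R a t eq) (S-bound (turns t y))

      -- At the start each variable costs at most `B`, whether liquid or frozen, so `u` times the
      -- total cost is at most `κ * B`.
      success-lower : ∀ α → Models α Φ → μ ^ N ≤ success Φ d k h (rounds n R) (replicate n nothing)
      success-lower α m = ≤-trans (^-mono N 0≤μ (≤-trans μ≤ (+-monoʳ-≤ 1ℚ (neg-antimono-≤ small))))
        (success-≥ Φ d k ν 0≤ν ν≤1 ν-inverse S 0≤S S≤1 S0 δ 0≤δ δ≤1 S-decrease u 0≤u N u-small halves gains h 0≤h 1≤h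
          (rounds n R) bounded (replicate n nothing) sat)
        where
        T₀ = total S 0≤S (rounds n R) (replicate n nothing)
        sat : Sat (replicate n nothing)
        sat = α , m , agrees λ x b eq → case trans (sym (lookup-replicate x nothing)) eq of λ ()
        T₀≤ : T₀ ≤ ι n * B
        T₀≤ = ∑F-bound n λ y → ≤-trans (cost-≤ S 0≤S (rounds n R) y (bounded [] (rounds n R) refl) sat)
          (subst (λ j → S j ≤ B) (sym (turns-rounds n R y)) S-final)
        0≤B : 0ℚ ≤ B
        0≤B = ≤-trans (0≤S R) S-final
        small : u * T₀ ≤ κ * B
        small = ≤-trans (*-monoˡ 0≤u (≤-trans T₀≤ (*-monoʳ {B} {ι n} {ι (suc n)} 0≤B (≤-by 1ℚ 0≤1 (+-comm 1ℚ (ι n))))))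
          (≤-reflexive (trans (sym (*-assoc u (ι (suc n)) B)) (cong (_* B) u*n)))

  1≤ι : ∀ {c} → 1 ℕ.≤ c → 1ℚ ≤ ι c
  1≤ι {suc c} _ = ≤-by (ι c) (0≤ι c) refl

  fraction-^ : ∀ {x} a b k → x * ι b ≡ ι a → x ^ k * ι (b ℕ.^ k) ≡ ι (a ℕ.^ k)
  fraction-^ {x} a b k eq = trans (cong (x ^ k *_) (ι-^ b k)) (trans (sym (^-distrib-* x (ι b) k)) (trans (cong (_^ k) eq) (sym (ι-^ a k))))

  -- Clears denominators, so that the powers are compared as natural numbers, by evaluation.
  fraction-^-≥ : ∀ {x} a b k e f → x * ι b ≡ ι a → 1 ℕ.≤ b → e ℕ.* b ℕ.^ k ℕ.≤ f ℕ.* a ℕ.^ k → ι e ≤ ι f * x ^ k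
  fraction-^-≥ {x} a b k e f eq 1≤b h = cancel-* {ι e} {ι f * x ^ k} {ι (b ℕ.^ k)} (1≤ι (ℕP.m^n>0 b {{ℕ.>-nonZero 1≤b}} k)) (subst₂ _≤_ (ι-* e (b ℕ.^ k))
    (trans (ι-* f (a ℕ.^ k)) (trans (cong (ι f *_) (sym (fraction-^ a b k eq))) (sym (*-assoc (ι f) (x ^ k) (ι (b ℕ.^ k))))))
    (ι-mono h))

  rate-≥ : ∀ {x b c} e f g h k → b * ι g ≡ ι f → c * ι h ≡ ι e → 1 ℕ.≤ g ℕ.* h →
           ι (e ℕ.* g) ≤ ι (f ℕ.* h) * x ^ k → c ≤ x ^ k * b
  rate-≥ {x} {b} {c} e f g h k bg ch 1≤ le = cancel-* {c} {x ^ k * b} {ι (g ℕ.* h)} (1≤ι 1≤)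
    (subst₂ _≤_ (trans (ι-* e g) (trans (cong (_* ι g) (sym ch)) (trans (lem c (ι h) (ι g)) (cong (c *_) (sym (ι-* g h))))))
      (trans (cong (_* x ^ k) (trans (ι-* f h) (cong (_* ι h) (sym bg)))) (trans (lem₂ b (ι g) (ι h) (x ^ k)) (cong (x ^ k * b *_) (sym (ι-* g h)))))
      le)
    where
    lem : ∀ c h g → c * h * g ≡ c * (g * h)
    lem = solve-∀ ℚ-ring
    lem₂ : ∀ b g h y → b * g * h * y ≡ y * b * (g * h)
    lem₂ = solve-∀ ℚ-ring

-- The numerical constants.

module Parameters where

  open Arithmetic
  open Spending
  open FixedPoint
  open LowerBound
  open import Data.Bool using (T)
  open import Data.Integer using (+_)
  open import Data.Nat as ℕ using (ℕ; suc; NonZero; _≤ᵇ_)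
  import Data.Nat.Properties as ℕP
  open import Data.Rational hiding (_≟_; NonZero; _≤ᵇ_)
  open import Data.Rational.Properties hiding (_≟_)
  open import Tactic.RingSolver

  limits : ∀ a b k M .{{_ : NonZero M}} d R q → Prob q → q * ι 64 ≡ 1ℚ → k ℕ.≤ b → T (1000 ℕ.* State.s (iterate a b k M d R) ≤ᵇ 394 ℕ.* M) →
    Σ[ S ∈ (ℕ → ℚ) ] ((∀ m → 0ℚ ≤ S m) × (∀ m → S m ≤ 1ℚ) × S 0 ≡ 1ℚ × (∀ m → bound q d m 0ℚ ≤ S m) ×
      (∀ m → ι a * S m + ι k ≤ ι (a ℕ.+ b) * S (suc m)) × ι 1000 * S R ≤ ι 394)
  limits a b k M@(suc M-1) d R q pq q64 k≤b h with reciprocal M-1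
  ... | ε , 0≤ε , Mε = limit′ , (λ m → 0≤* (0≤ι (State.s (iterate a b k M d m))) 0≤ε) , limit-≤1 a b k k≤b M ε 0≤ε Mε d q pq q64 , Mε ,
          limit-bound a b k k≤b M ε 0≤ε Mε d q pq q64 , limit-allowed a b k k≤b M ε 0≤ε Mε d q pq q64 , final
    where
    limit′ = limit a b k k≤b M ε 0≤ε Mε d q pq q64
    s = State.s (iterate a b k M d R)
    scaled : ∀ c (t : ℕ) → ι (c ℕ.* t) * ε ≡ ι c * (ι t * ε)
    scaled c t = trans (cong (_* ε) (ι-* c t)) (*-assoc (ι c) (ι t) ε)
    final : ι 1000 * limit′ R ≤ ι 394
    final = subst₂ _≤_ (scaled 1000 s) (trans (scaled 394 M) (trans (cong (ι 394 *_) Mε) (*-identityʳ (ι 394))))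
      (*-monoʳ 0≤ε (ι-mono (ℕP.≤ᵇ⇒≤ (1000 ℕ.* s) (394 ℕ.* M) h)))
  private
    q₆ = ½ ^ 6

    -- For `q` = 1/64 and `δ` = 1/50, multiplication by 640 turns the two sides into 630 s + 20 and
    -- 650 t + 13; this is where 630, 7 and 650 come from.
    decrease : ∀ s t → + 630 / 1 * s + + 7 / 1 ≤ + 650 / 1 * t → (1ℚ - q₆) * s + q₆ * (1ℚ + 1ℚ) ≤ (1ℚ + q₆) * (t + + 1 / 50)
    decrease s t h = ≤-by (+ 1 / 640 * (+ 650 / 1 * t - (+ 630 / 1 * s + + 7 / 1))) (0≤* {+ 1 / 640} (≤ᵇ⇒≤ _) (≤⇒0≤- h)) (lem s t)
      where
      lem : ∀ s t → (1ℚ + + 1 / 64) * (t + + 1 / 50) ≡ ((1ℚ - + 1 / 64) * s + + 1 / 64 * (1ℚ + 1ℚ)) + + 1 / 640 * (+ 650 / 1 * t - (+ 630 / 1 * s + + 7 / 1))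
      lem = solve-∀ ℚ-ring

  Limits : (ℕ → ℚ) → Set
  Limits S = (∀ m → 0ℚ ≤ S m) × (∀ m → S m ≤ 1ℚ) × S 0 ≡ 1ℚ × (∀ m → bound q₆ 60 m 0ℚ ≤ S m) ×
    (∀ m → ι 630 * S m + ι 7 ≤ ι 650 * S (suc m)) × ι 1000 * S 512 ≤ ι 394

  abstract
    limits₆ : Σ[ S ∈ (ℕ → ℚ) ] Limits S
    -- The final `tt` has the type checker evaluate all 512 iterations with denominator 2^30;
    -- `abstract` keeps the result from being unfolded elsewhere.
    limits₆ = limits 630 20 7 (2 ℕ.^ 30) 60 512 q₆ (prob (≤ᵇ⇒≤ _) (≤ᵇ⇒≤ _)) refl (ℕP.≤ᵇ⇒≤ 7 20 tt) tt

  abstract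
    doubles₆ : 1ℚ + 1ℚ ≤ (1ℚ + + 109 / 10000) ^ 64
    doubles₆ = subst (1ℚ + 1ℚ ≤_) (*-identityˡ ((+ 10109 / 10000) ^ 64))
      (fraction-^-≥ {+ 10109 / 10000} 10109 10000 64 2 1 (/≡ι* 10109 10000) (ℕP.≤ᵇ⇒≤ 1 10000 tt)
        (ℕP.≤ᵇ⇒≤ (2 ℕ.* 10000 ℕ.^ 64) (1 ℕ.* 10109 ℕ.^ 64) tt))

    gain₆ : 1ℚ ≤ (1ℚ + q₆) * (1ℚ - ι 64 * (+ 109 / 10000) * (+ 1 / 49))
    gain₆ = ≤ᵇ⇒≤ _

    final₆ : proj₁ limits₆ 512 ≤ + 394 / 1000
    final₆ = cancel-* {proj₁ limits₆ 512} {+ 394 / 1000} {ι 1000} (1≤ι {1000} (ℕP.≤ᵇ⇒≤ 1 1000 tt))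
          (subst₂ _≤_ (*-comm (ι 1000) (proj₁ limits₆ 512)) (sym (/≡ι* 394 1000)) (proj₂ (proj₂ (proj₂ (proj₂ (proj₂ (proj₂ limits₆)))))))

    decrease₆ : ∀ m → (1ℚ - q₆) * proj₁ limits₆ m + q₆ * (1ℚ + 1ℚ) ≤ (1ℚ + q₆) * (proj₁ limits₆ (suc m) + + 1 / 50)
    decrease₆ m = decrease (S m) (S (suc m))
          (subst₂ _≤_ (sym (cong₂ _+_ (cong (_* S m) (/1≡ι 630)) (/1≡ι 7))) (sym (cong (_* S (suc m)) (/1≡ι 650)))
            (proj₁ (proj₂ (proj₂ (proj₂ (proj₂ (proj₂ limits₆))))) m))
      where
      S : ℕ → ℚ
      S = proj₁ limits₆

    rate₆ : 1ℚ + + 1 / 500 ≤ (+ 9957 / 10000) ^ 64 * (+ 132065 / 100000)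
    rate₆ = rate-≥ {+ 9957 / 10000} {+ 132065 / 100000} {+ 501 / 500} 501 132065 100000 500 64
          (/≡ι* 132065 100000) (/≡ι* 501 500) (ℕP.≤ᵇ⇒≤ 1 (100000 ℕ.* 500) tt)
          (fraction-^-≥ {+ 9957 / 10000} 9957 10000 64 (501 ℕ.* 100000) (132065 ℕ.* 500) (/≡ι* 9957 10000) (ℕP.≤ᵇ⇒≤ 1 10000 tt)
            (ℕP.≤ᵇ⇒≤ (501 ℕ.* 100000 ℕ.* 10000 ℕ.^ 64) (132065 ℕ.* 500 ℕ.* 9957 ℕ.^ 64) tt))

  abstract
    constants : Constants (+ 132065 / 100000) (+ 1 / 500)
    constants = record
      { d = 60 ; k = 6 ; R = 512
      ; ν = + 64 / 65 ; 0≤ν = ≤ᵇ⇒≤ _ ; ν≤1 = ≤ᵇ⇒≤ _ ; ν-inverse = refl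
      ; S = proj₁ limits₆ ; 0≤S = proj₁ (proj₂ limits₆) ; S≤1 = proj₁ (proj₂ (proj₂ limits₆))
      ; S0 = proj₁ (proj₂ (proj₂ (proj₂ limits₆))) ; S-bound = proj₁ (proj₂ (proj₂ (proj₂ (proj₂ limits₆))))
      -- This `δ` lets `S` sink as low as 7/20 and stays below log₂ (1 + q) ≈ 0.0224, about the most
      -- that the factor 1 + q can pay for; `δ′` is slightly above δ / (1 - κ).
      ; δ = + 1 / 50 ; δ′ = + 1 / 49 ; 0≤δ = ≤ᵇ⇒≤ _ ; δ≤1 = ≤ᵇ⇒≤ _
      ; S-decrease = decrease₆ ; B = + 394 / 1000 ; S-final = final₆
      -- `κ` is 2^(1/64) - 1 rounded up, and `μ` below is 1 - κ B rounded down.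
      ; K = 64 ; κ = + 109 / 10000 ; 0≤κ = ≤ᵇ⇒≤ _ ; κ≤1 = ≤ᵇ⇒≤ _ ; doubles = doubles₆
      ; δ′-prob = prob (≤ᵇ⇒≤ _) (≤ᵇ⇒≤ _) ; δ≤ = ≤ᵇ⇒≤ _ ; gain = gain₆
      ; μ = + 9957 / 10000 ; 0≤μ = ≤ᵇ⇒≤ _ ; μ≤ = ≤ᵇ⇒≤ _ ; rate = rate₆
      }

-- A language of bounded folds and its compilation to while-programs.

module Machine where

  open import Data.Fin.Patterns using (0F; 1F; 2F; 3F; 4F; 5F; 6F)
  open import Data.List using (replicate)
  open import Data.Nat using (ℕ; zero; suc; _+_; _*_; _≤_; s≤s)
  open import Data.Nat.Properties
  open import Data.Nat.Tactic.RingSolver using (solve-∀)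

  infix 3 _⇒[_]_

  -- κ ⇒[ t ] κ′: whatever the coins are, κ leads to κ′ in at most t steps.
  data _⇒[_]_ {r} : Config r → ℕ → Config r → Set where
    stop : ∀ {κ t} → κ ⇒[ t ] κ
    move : ∀ {c K σ κ κ′ t} → (∀ b → step b (c ∷ K , σ) ≡ κ) → κ ⇒[ t ] κ′ → (c ∷ K , σ) ⇒[ suc t ] κ′

  ⇒-weaken : ∀ {r} {κ κ′ : Config r} {t u} → t ≤ u → κ ⇒[ t ] κ′ → κ ⇒[ u ] κ′
  ⇒-weaken _ stop = stop
  ⇒-weaken (s≤s t≤u) (move e m) = move e (⇒-weaken t≤u m)

  ⇒-trans : ∀ {r} {κ κ′ κ″ : Config r} {t u} → κ ⇒[ t ] κ′ → κ′ ⇒[ u ] κ″ → κ ⇒[ t + u ] κ″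
  ⇒-trans {t = t} {u} stop m = ⇒-weaken (m≤n+m u t) m
  ⇒-trans (move e m) m′ = move e (⇒-trans m m′)

  Runs : ∀ {r} → Command r → ℕ → Store r → Store r → Set
  Runs c t σ σ′ = ∀ K → (c ∷ K , σ) ⇒[ t ] (K , σ′)

  runs-weaken : ∀ {r} {c : Command r} {t u σ σ′} → t ≤ u → Runs c t σ σ′ → Runs c u σ σ′
  runs-weaken t≤u h K = ⇒-weaken t≤u (h K)

  runs-⨾ : ∀ {r} {c d : Command r} {t u σ σ′ σ″} → Runs c t σ σ′ → Runs d u σ′ σ″ → Runs (c ⨾ d) (suc (t + u)) σ σ″
  runs-⨾ h k K = move (λ _ → refl) (⇒-trans (h _) (k K))

  data Op (r : ℕ) : Set where
    nil′        : Op r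
    copy hd′ tl′ : Fin r → Op r
    cons′       : Fin r → Fin r → Op r

  expr : ∀ {r} → Op r → Expr r
  expr nil′        = `nil
  expr (copy x)    = `copy x
  expr (hd′ x)     = `hd x
  expr (tl′ x)     = `tl x
  expr (cons′ x y) = `cons x y

  value : ∀ {r} → Store r → Op r → Tree
  value σ nil′        = nil
  value σ (copy x)    = lookup σ x
  value σ (hd′ x)     = hd (lookup σ x)
  value σ (tl′ x)     = tl (lookup σ x)
  value σ (cons′ x y) = cons (lookup σ x) (lookup σ y)

  eval-expr : ∀ {r} b (σ : Store r) o → eval b σ (expr o) ≡ value σ o
  eval-expr b σ nil′        = refl
  eval-expr b σ (copy x)    = refl
  eval-expr b σ (hd′ x)     = refl
  eval-expr b σ (tl′ x)     = refl
  eval-expr b σ (cons′ x y) = refl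

  Block : ℕ → Set
  Block r = List (Fin r × Op r)

  -- Commands have no skip; copying register 0 to itself serves as one.
  block : ∀ {r} → Block (suc r) → Command (suc r)
  block []             = zero ≔ `copy zero
  block ((x , o) ∷ is) = (x ≔ expr o) ⨾ block is

  exec : ∀ {r} → Block (suc r) → Store (suc r) → Store (suc r)
  exec []             σ = σ [ zero ]≔ lookup σ zero
  exec ((x , o) ∷ is) σ = exec is (σ [ x ]≔ value σ o)

  runs-block : ∀ {r} (is : Block (suc r)) σ → Runs (block is) (suc (2 * length is)) σ (exec is σ)
  runs-block []             σ K = move (λ _ → refl) stop
  runs-block ((x , o) ∷ is) σ K = ⇒-weaken (≤-reflexive (lem (length is)))
    (move (λ _ → refl) (move (λ b → cong (λ v → block is ∷ K , (σ [ x ]≔ v)) (eval-expr b σ o)) (runs-block is _ K)))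
    where
    lem : ∀ n → 1 + (1 + (1 + (n + (n + 0)))) ≡ 1 + ((1 + n) + ((1 + n) + 0))
    lem = solve-∀

  runs-if : ∀ {r} {x} {c d : Command r} {t u σ σ′} {b} → isCons (lookup σ x) ≡ b →
            (b ≡ true → Runs c t σ σ′) → (b ≡ false → Runs d u σ σ′) → Runs (`if x c d) (suc (t + u)) σ σ′
  runs-if {c = c} {d} {t} {u} {σ} {b = true}  eq h _ K =
    move (λ _ → cong (λ b → (if b then c else d) ∷ K , σ) eq) (⇒-weaken (m≤m+n t u) (h refl K))
  runs-if {c = c} {d} {t} {u} {σ} {b = false} eq _ h K =
    move (λ _ → cong (λ b → (if b then c else d) ∷ K , σ) eq) (⇒-weaken (m≤n+m u t) (h refl K))

  -- A first-order language over trees, whose only loop folds over the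
  -- spine of a list, for at most as many elements as the clock is long.
  data Tm : ℕ → Set where
    get  : ∀ {Γ} → Fin Γ → Tm Γ
    nil  : ∀ {Γ} → Tm Γ
    cons : ∀ {Γ} → Tm Γ → Tm Γ → Tm Γ
    head tail : ∀ {Γ} → Tm Γ → Tm Γ
    cond : ∀ {Γ} → Tm Γ → Tm Γ → Tm Γ → Tm Γ
    bind : ∀ {Γ} → Tm Γ → Tm (suc Γ) → Tm Γ
    fold : ∀ {Γ} → Tm Γ → Tm Γ → Tm (suc (suc Γ)) → Tm Γ
    ren  : ∀ {Γ Δ} → (Fin Δ → Fin Γ) → Tm Δ → Tm Γ

  Env : ℕ → Set
  Env Γ = Fin Γ → Tree

  infixl 5 _▸_

  _▸_ : ∀ {A : Set} {Γ} → (Fin Γ → A) → A → Fin (suc Γ) → A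
  (γ ▸ v) zero    = v
  (γ ▸ v) (suc i) = γ i

  -- An exhausted list idles until the clock runs out. The number of iterations is thus known from
  -- the clock alone, and `cost` does not depend on the data.
  loop : ℕ → (Tree → Tree → Tree) → Tree → Tree → Tree
  loop zero    f xs          a = a
  loop (suc ℓ) f nil         a = loop ℓ f nil a
  loop (suc ℓ) f (cons x xs) a = loop ℓ f xs (f x a)

  ⟦_⟧ : ∀ {Γ} → Tm Γ → ℕ → Env Γ → Tree
  ⟦ get i ⟧ ℓ γ      = γ i
  ⟦ nil ⟧ ℓ γ        = nil
  ⟦ cons s t ⟧ ℓ γ   = cons (⟦ s ⟧ ℓ γ) (⟦ t ⟧ ℓ γ)
  ⟦ head t ⟧ ℓ γ     = hd (⟦ t ⟧ ℓ γ)
  ⟦ tail t ⟧ ℓ γ     = tl (⟦ t ⟧ ℓ γ)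
  ⟦ cond c s t ⟧ ℓ γ = if isCons (⟦ c ⟧ ℓ γ) then ⟦ s ⟧ ℓ γ else ⟦ t ⟧ ℓ γ
  ⟦ bind s t ⟧ ℓ γ   = ⟦ t ⟧ ℓ (γ ▸ ⟦ s ⟧ ℓ γ)
  ⟦ fold s t u ⟧ ℓ γ = loop ℓ (λ x a → ⟦ u ⟧ ℓ (γ ▸ a ▸ x)) (⟦ s ⟧ ℓ γ) (⟦ t ⟧ ℓ γ)
  ⟦ ren f t ⟧ ℓ γ    = ⟦ t ⟧ ℓ (γ ∘ f)

  -- Registers: 0 the input, 1 the clock, 2 a stack, 3 to 5 scratch, 6 the tape.
  pattern io = 0F
  pattern clk = 1F
  pattern st = 2F
  pattern ra = 3F
  pattern rb = 4F
  pattern rc = 5F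
  pattern tp = 6F

  Cmd : Set
  Cmd = Command 7

  push-clock cons-block hd-block tl-block cond-block bind-block enter-block leave-block skip-block test-block counter-block exit-block : Block 7
  push-clock    = (st , cons′ clk st) ∷ []
  cons-block    = (rb , hd′ st) ∷ (st , tl′ st) ∷ (ra , hd′ st) ∷ (st , tl′ st) ∷ (ra , cons′ ra rb) ∷ (st , cons′ ra st) ∷ []
  hd-block      = (ra , hd′ st) ∷ (ra , hd′ ra) ∷ (st , tl′ st) ∷ (st , cons′ ra st) ∷ []
  tl-block      = (ra , hd′ st) ∷ (ra , tl′ ra) ∷ (st , tl′ st) ∷ (st , cons′ ra st) ∷ []
  cond-block    = (ra , hd′ st) ∷ (st , tl′ st) ∷ []
  bind-block    = (rb , hd′ st) ∷ (st , tl′ st) ∷ (st , tl′ st) ∷ (st , cons′ rb st) ∷ []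
  test-block    = (rb , tl′ st) ∷ (ra , hd′ rb) ∷ []
  enter-block   = (ra , hd′ ra) ∷ (st , cons′ ra st) ∷ []
  skip-block    = (rb , hd′ st) ∷ (st , tl′ st) ∷ (ra , hd′ st) ∷ (st , tl′ st) ∷ (rc , hd′ st) ∷ (rc , tl′ rc) ∷ (st , tl′ st)
                ∷ (st , cons′ rc st) ∷ (st , cons′ ra st) ∷ (st , cons′ rb st) ∷ []
  leave-block   = (rb , hd′ st) ∷ (st , tl′ st) ∷ (st , tl′ st) ∷ (st , tl′ st) ∷ (ra , hd′ st) ∷ (ra , tl′ ra) ∷ (st , tl′ st)
                ∷ (rc , hd′ st) ∷ (rc , tl′ rc) ∷ (st , tl′ st) ∷ (st , cons′ rc st) ∷ (st , cons′ ra st) ∷ (st , cons′ rb st) ∷ []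
  counter-block = (rb , tl′ st) ∷ (rb , tl′ rb) ∷ (ra , hd′ rb) ∷ []
  exit-block    = (rb , hd′ st) ∷ (st , tl′ st) ∷ (st , tl′ st) ∷ (st , tl′ st) ∷ (st , cons′ rb st) ∷ []

  tails : ℕ → Block 7
  tails p = replicate p (ra , tl′ ra) ++ (ra , hd′ ra) ∷ (st , cons′ ra st) ∷ []

  Positions : ℕ → Set
  Positions Γ = Fin Γ → ℕ

  -- While the body of a fold runs, four entries lie on top of the stack: the current element, the
  -- accumulator, the list and the remaining clock. The first two are the variables 0 and 1.
  body-positions : ∀ {Γ} → Positions Γ → Positions (suc (suc Γ))
  body-positions ρ = (λ i → 4 + ρ i) ▸ 1 ▸ 0

  bind-positions : ∀ {Γ} → Positions Γ → Positions (suc Γ)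
  bind-positions ρ = (suc ∘ ρ) ▸ 0

  fold-body : Cmd → Cmd
  fold-body c = block test-block ⨾ `if ra (block enter-block ⨾ c ⨾ block leave-block) (block skip-block) ⨾ block counter-block

  compile : ∀ {Γ} → Tm Γ → Positions Γ → Cmd
  compile (get i) ρ      = block ((ra , copy st) ∷ tails (ρ i))
  compile nil ρ          = block ((ra , nil′) ∷ (st , cons′ ra st) ∷ [])
  compile (cons s t) ρ   = compile s ρ ⨾ compile t (suc ∘ ρ) ⨾ block cons-block
  compile (head t) ρ       = compile t ρ ⨾ block hd-block
  compile (tail t) ρ       = compile t ρ ⨾ block tl-block
  compile (cond c s t) ρ = compile c ρ ⨾ block cond-block ⨾ `if ra (compile s ρ) (compile t ρ)
  compile (bind s t) ρ   = compile s ρ ⨾ compile t (bind-positions ρ) ⨾ block bind-block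
  compile (fold s t u) ρ = block push-clock ⨾ compile s (suc ∘ ρ) ⨾ compile t (λ i → 2 + ρ i) ⨾ block counter-block ⨾
                           `while ra (fold-body (compile u (body-positions ρ))) ⨾ block exit-block
  -- Renaming is free at run time: it only redirects stack positions.
  compile (ren f t) ρ    = compile t (ρ ∘ f)

  loop-cost : ℕ → ℕ → ℕ
  loop-cost zero    t = 1
  loop-cost (suc ℓ) t = suc (t + loop-cost ℓ t)

  cost : ∀ {Γ} → Tm Γ → Positions Γ → ℕ → ℕ
  cost (get i) ρ ℓ      = 10 + 2 * ρ i
  cost nil ρ ℓ          = 5
  cost (cons s t) ρ ℓ   = 20 + cost s ρ ℓ + cost t (suc ∘ ρ) ℓ
  cost (head t) ρ ℓ       = 20 + cost t ρ ℓ
  cost (tail t) ρ ℓ       = 20 + cost t ρ ℓ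
  cost (cond c s t) ρ ℓ = 20 + cost c ρ ℓ + (cost s ρ ℓ + cost t ρ ℓ)
  cost (bind s t) ρ ℓ   = 20 + cost s ρ ℓ + cost t (bind-positions ρ) ℓ
  cost (fold s t u) ρ ℓ = 40 + cost s (suc ∘ ρ) ℓ + cost t (λ i → 2 + ρ i) ℓ + loop-cost ℓ (80 + cost u (body-positions ρ) ℓ)
  cost (ren f t) ρ ℓ    = cost t (ρ ∘ f) ℓ

  nth : Tree → ℕ → Tree
  nth s zero    = hd s
  nth s (suc p) = nth (tl s) p

  spine : Tree → ℕ
  spine nil        = 0
  spine (cons _ t) = suc (spine t)

  store : (i k s a b c t : Tree) → Store 7
  store i k s a b c t = i ∷ k ∷ s ∷ a ∷ b ∷ c ∷ t ∷ []

  record Result (c : Cmd) (T : ℕ) (i k s a b c′ t : Tree) (s′ : Tree) : Set where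
    constructor result
    field
      {a′ b′ c″} : Tree
      runs : Runs c T (store i k s a b c′ t) (store i k s′ a′ b′ c″ t)

  exec-tails : ∀ p i k s a b c t →
    exec (tails p) (store i k s a b c t) ≡ store i k (cons (nth a p) s) (nth a p) b c t
  exec-tails zero    i k s a b c t = refl
  exec-tails (suc p) i k s a b c t = exec-tails p i k s (tl a) b c t

  length-tails : ∀ p → length (tails p) ≡ p + 2
  length-tails zero    = refl
  length-tails (suc p) = cong suc (length-tails p)

  Fits : ∀ {Γ} → Positions Γ → Tree → Env Γ → Set
  Fits ρ s γ = ∀ i → nth s (ρ i) ≡ γ i

  fits-body : ∀ {Γ} {ρ : Positions Γ} {s γ e a x k} → Fits ρ s γ → Fits (body-positions ρ) (cons e (cons a (cons x (cons k s)))) (γ ▸ a ▸ e)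
  fits-body h zero          = refl
  fits-body h (suc zero)    = refl
  fits-body h (suc (suc i)) = h i

  fits-bind : ∀ {Γ} {ρ : Positions Γ} {s γ v} → Fits ρ s γ → Fits (bind-positions ρ) (cons v s) (γ ▸ v)
  fits-bind h zero    = refl
  fits-bind h (suc i) = h i

  module _ (i k t : Tree) where

    private
      Body : Cmd → ℕ → (Tree → Tree → Tree) → Tree → Set
      Body c T f s = ∀ e acc x κ a b c′ → let s′ = cons e (cons acc (cons (cons e x) (cons κ s))) in
        Result c T i k s′ a b c′ t (cons (f e acc) s′)

      tested : ∀ {u x s} a b c → Runs (block test-block) 5 (store i k (cons u (cons x s)) a b c t) (store i k (cons u (cons x s)) x (cons x s) c t)
      tested a b c = runs-block test-block _

      entered : ∀ {e x s} b c → Runs (block enter-block) 5 (store i k s (cons e x) b c t) (store i k (cons e s) e b c t)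
      entered b c = runs-block enter-block _

      left : ∀ {v e acc x κ s} a b c → Runs (block leave-block) 27
        (store i k (cons v (cons e (cons acc (cons x (cons κ s))))) a b c t) (store i k (cons v (cons (tl x) (cons (tl κ) s))) (tl x) v (tl κ) t)
      left a b c = runs-block leave-block _

      counted : ∀ {u x κ s} a b c → Runs (block counter-block) 7
        (store i k (cons u (cons x (cons κ s))) a b c t) (store i k (cons u (cons x (cons κ s))) κ (cons κ s) c t)
      counted a b c = runs-block counter-block _

      fold-step : ∀ {c T f s} → Body c T f s → ∀ x acc e κ a b c′ →
        Σ[ b′ ∈ Tree ] Σ[ c″ ∈ Tree ] Runs (fold-body c) (80 + T)
          (store i k (cons acc (cons (cons e x) (cons κ s))) a b c′ t)
          (store i k (cons (f e acc) (cons x (cons (tl κ) s))) (tl κ) b′ c″ t)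
      fold-step {c} {T} {f} {s = s} h x acc e κ a b c′ with h e acc x κ e (cons (cons e x) (cons κ s)) c′
      ... | result {a₁} {b₁} {c₁} r = cons (tl κ) s , tl κ , runs-weaken (bound T)
          (runs-⨾ (tested a b c′) (runs-⨾
            (runs-if {x = ra} {c = block enter-block ⨾ c ⨾ block leave-block} {d = block skip-block} {u = 0}
              {σ′ = store i k (cons (f e acc) (cons x (cons (tl κ) s))) x (f e acc) (tl κ) t} refl
              (λ _ → runs-⨾ (entered (cons (cons e x) (cons κ s)) c′) (runs-⨾ r (left a₁ b₁ c₁))) (λ ()))
            (counted x (f e acc) (tl κ))))
        where
        lem : ∀ x → 1 + (5 + (1 + (1 + (1 + (5 + (1 + (x + 27))) + 0) + 7))) ≡ x + 49
        lem = solve-∀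
        bound : ∀ x → suc (5 + suc (suc (suc (5 + suc (x + 27)) + 0) + 7)) ≤ 80 + x
        bound x = ≤-trans (≤-reflexive (trans (lem x) (+-comm x 49))) (+-monoˡ-≤ x (m≤m+n 49 31))

      fold-idle : ∀ c acc κ s a b c′ →
        Runs (fold-body c) 80 (store i k (cons acc (cons nil (cons κ s))) a b c′ t)
          (store i k (cons acc (cons nil (cons (tl κ) s))) (tl κ) (cons (tl κ) s) (tl κ) t)
      fold-idle c acc κ s a b c′ = (runs-weaken (m≤m+n 36 44)
          (runs-⨾ (runs-block test-block _) (runs-⨾
            (runs-if {c = block enter-block ⨾ c ⨾ block leave-block} {t = 0} refl (λ ()) (λ _ → runs-block skip-block _))
            (runs-block counter-block _))))

      while-step : ∀ {c : Cmd} {T U σ σ′ σ″} → isCons (lookup σ ra) ≡ true → Runs c T σ σ′ → Runs (`while ra c) U σ′ σ″ →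
                   Runs (`while ra c) (suc (T + U)) σ σ″
      while-step {c} {σ = σ} eq h w K = move (λ _ → cong (λ b → (if b then c ∷ `while ra c ∷ K else K) , σ) eq) (⇒-trans (h (`while ra c ∷ K)) (w K))

      while-stop : ∀ {c : Cmd} {U σ} → isCons (lookup σ ra) ≡ false → Runs (`while ra c) (suc U) σ σ
      while-stop {c} {σ = σ} eq K = move (λ _ → cong (λ b → (if b then c ∷ `while ra c ∷ K else K) , σ) eq) stop

      -- Induction on the remaining clock `κ` rather than the list, which may run out earlier or
      -- later.
      fold-loop : ∀ {c T f s} → Body c T f s → ∀ κ x acc b c′ →
        Σ[ x′ ∈ Tree ] Σ[ κ′ ∈ Tree ] Result (`while ra (fold-body c)) (loop-cost (spine κ) (80 + T))
          i k (cons acc (cons x (cons κ s))) κ b c′ t (cons (loop (spine κ) f x acc) (cons x′ (cons κ′ s)))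
      fold-loop h nil x acc b c = x , nil , result (while-stop refl)
      fold-loop {c} {T} {s = s} h (cons κ₀ κ) nil acc b c′ =
        let x′ , κ′ , result w = fold-loop h κ nil acc (cons κ s) κ in
        x′ , κ′ , result (while-step {T = 80 + T} refl (runs-weaken (m≤m+n 80 T) (fold-idle c acc (cons κ₀ κ) s (cons κ₀ κ) b c′)) w)
      fold-loop {T = T} {f} h (cons κ₀ κ) (cons e x) acc b c =
        let b′ , c′ , r = fold-step h x acc e (cons κ₀ κ) (cons κ₀ κ) b c
            x′ , κ′ , result w = fold-loop h κ x (f e acc) b′ c′
        in x′ , κ′ , result (while-step {T = 80 + T} refl r w)

      fold-run : ∀ {c T f s} → Body c T f s → ∀ x acc a b c′ →
        Result (block counter-block ⨾ `while ra (fold-body c) ⨾ block exit-block) (21 + loop-cost (spine k) (80 + T))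
          i k (cons acc (cons x (cons k s))) a b c′ t (cons (loop (spine k) f x acc) s)
      fold-run {T = T} {s = s} h x acc a b c′ with fold-loop h k x acc (cons k s) c′
      ... | _ , _ , result w = result (runs-weaken (≤-trans (≤-reflexive (lem (loop-cost (spine k) (80 + T)))) (+-monoˡ-≤ (loop-cost (spine k) (80 + T)) (m≤m+n 20 1)))
            (runs-⨾ (runs-block counter-block _) (runs-⨾ w (runs-block exit-block _))))
        where
        lem : ∀ z → 1 + (7 + (1 + (z + 11))) ≡ 20 + z
        lem = solve-∀

      cond-run : ∀ {v c d T U s s′} b → isCons v ≡ b →
        (b ≡ true → ∀ a b c′ → Result c T i k s a b c′ t s′) → (b ≡ false → ∀ a b c′ → Result d U i k s a b c′ t s′) →
        ∀ a b c′ → Result (block cond-block ⨾ `if ra c d) (suc (5 + suc (T + U))) i k (cons v s) a b c′ t s′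
      cond-run {v} {c} {d} {T} {U} true eq h _ a b c′ with h refl v b c′
      ... | result r = result (runs-⨾ (runs-block cond-block _) (runs-if {d = d} {u = U} eq (λ _ → r) (λ ())))
      cond-run {v} {c} {d} {T} {U} false eq _ h a b c′ with h refl v b c′
      ... | result r = result (runs-⨾ (runs-block cond-block _) (runs-if {c = c} {t = T} eq (λ ()) (λ _ → r)))

      infixr 4 _then_
      _then_ : ∀ {c d T U s a b c′ s′ s″} → Result c T i k s a b c′ t s′ → (∀ a b c′ → Result d U i k s′ a b c′ t s″) →
        Result (c ⨾ d) (suc (T + U)) i k s a b c′ t s″
      result r then h = result (runs-⨾ r (Result.runs (h _ _ _)))

      weaken : ∀ {c T U s a b c′ s′} → T ≤ U → Result c T i k s a b c′ t s′ → Result c U i k s a b c′ t s′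
      weaken h (result r) = result (runs-weaken h r)

      pushed-clock : ∀ {s} a b c → Result (block push-clock) 3 i k s a b c t (cons k s)
      pushed-clock a b c = result (runs-block push-clock _)

      consed : ∀ {u v s} a b c → Result (block cons-block) 13 i k (cons v (cons u s)) a b c t (cons (cons u v) s)
      consed a b c = result (runs-block cons-block _)

      headed : ∀ {u s} a b c → Result (block hd-block) 9 i k (cons u s) a b c t (cons (hd u) s)
      headed a b c = result (runs-block hd-block _)

      tailed : ∀ {u s} a b c → Result (block tl-block) 9 i k (cons u s) a b c t (cons (tl u) s)
      tailed a b c = result (runs-block tl-block _)

      bound-off : ∀ {u v s} a b c → Result (block bind-block) 9 i k (cons v (cons u s)) a b c t (cons v s)
      bound-off a b c = result (runs-block bind-block _)

      got : ∀ p {s v} → nth s p ≡ v → ∀ a b c → Result (block ((ra , copy st) ∷ tails p)) (10 + 2 * p) i k s a b c t (cons v s)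
      got p {s} eq a b c = result (runs-weaken (≤-trans (≤-reflexive lem) (+-monoˡ-≤ (2 * p) (m≤m+n 7 3)))
        (subst (Runs (block ((ra , copy st) ∷ tails p)) (suc (2 * length ((ra , copy st) ∷ tails p))) (store i k s a b c t))
          (trans (exec-tails p i k s s b c t) (cong (λ v → store i k (cons v s) (nth s p) b c t) eq))
          (runs-block ((ra , copy st) ∷ tails p) _)))
        where
        lem′ : ∀ p → 1 + (2 * (1 + (p + 2))) ≡ 7 + 2 * p
        lem′ = solve-∀
        lem : suc (2 * length ((ra , copy st) ∷ tails p)) ≡ 7 + 2 * p
        lem = trans (cong (λ m → suc (2 * suc m)) (length-tails p)) (lem′ p)

      cons-cost : ∀ x y → suc (x + suc (y + 13)) ≤ 20 + x + y
      cons-cost x y = ≤-trans (≤-reflexive (lem x y)) (+-monoˡ-≤ y (+-monoˡ-≤ x (m≤m+n 15 5)))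
        where
        lem : ∀ x y → 1 + (x + (1 + (y + 13))) ≡ 15 + x + y
        lem = solve-∀

      head-cost : ∀ x → suc (x + 9) ≤ 20 + x
      head-cost x = ≤-trans (≤-reflexive (cong suc (+-comm x 9))) (+-monoˡ-≤ x (m≤m+n 10 10))

      cond-cost : ∀ x y z → suc (x + suc (5 + suc (y + z))) ≤ 20 + x + (y + z)
      cond-cost x y z = ≤-trans (≤-reflexive (lem x y z)) (+-monoˡ-≤ (y + z) (+-monoˡ-≤ x (m≤m+n 8 12)))
        where
        lem : ∀ x y z → 1 + (x + (1 + (5 + (1 + (y + z))))) ≡ 8 + x + (y + z)
        lem = solve-∀

      bind-cost : ∀ x y → suc (x + suc (y + 9)) ≤ 20 + x + y
      bind-cost x y = ≤-trans (≤-reflexive (lem x y)) (+-monoˡ-≤ y (+-monoˡ-≤ x (m≤m+n 11 9)))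
        where
        lem : ∀ x y → 1 + (x + (1 + (y + 9))) ≡ 11 + x + y
        lem = solve-∀

      fold-cost : ∀ x y z → suc (3 + suc (x + suc (y + (21 + z)))) ≤ 40 + x + y + z
      fold-cost x y z = ≤-trans (≤-reflexive (lem x y z)) (+-monoˡ-≤ z (+-monoˡ-≤ y (+-monoˡ-≤ x (m≤m+n 27 13))))
        where
        lem : ∀ x y z → 1 + (3 + (1 + (x + (1 + (y + (21 + z)))))) ≡ 27 + x + y + z
        lem = solve-∀

    -- The scratch registers are arbitrary on entry and unspecified on exit, so compiled pieces can
    -- be chained with `_then_`; only the stack carries values.
    correct : ∀ {Γ} (u : Tm Γ) ρ {s γ} → Fits ρ s γ → ∀ a b c → Result (compile u ρ) (cost u ρ (spine k)) i k s a b c t (cons (⟦ u ⟧ (spine k) γ) s)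
    correct (get j) ρ h = got (ρ j) (h j)
    correct nil ρ h a b c = result (runs-block ((ra , nil′) ∷ (st , cons′ ra st) ∷ []) _)
    correct (cons u v) ρ h a b c = weaken (cons-cost (cost u ρ (spine k)) (cost v (suc ∘ ρ) (spine k)))
      (correct u ρ h a b c then λ a b c → correct v (suc ∘ ρ) h a b c then consed)
    correct (head u) ρ h a b c = weaken (head-cost (cost u ρ (spine k))) (correct u ρ h a b c then headed)
    correct (tail u) ρ h a b c = weaken (head-cost (cost u ρ (spine k))) (correct u ρ h a b c then tailed)
    correct (cond w u v) ρ {s} {γ} h a b c = weaken (cond-cost (cost w ρ (spine k)) (cost u ρ (spine k)) (cost v ρ (spine k)))
      (correct w ρ h a b c then branch)
      where
      branch : ∀ a b c → Result (block cond-block ⨾ `if ra (compile u ρ) (compile v ρ)) (suc (5 + suc (cost u ρ (spine k) + cost v ρ (spine k))))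
        i k (cons (⟦ w ⟧ (spine k) γ) s) a b c t (cons (⟦ cond w u v ⟧ (spine k) γ) s)
      branch with isCons (⟦ w ⟧ (spine k) γ) in eq
      ... | true  = cond-run true eq (λ _ → correct u ρ h) (λ ())
      ... | false = cond-run false eq (λ ()) (λ _ → correct v ρ h)
    correct (bind u v) ρ h a b c = weaken (bind-cost (cost u ρ (spine k)) (cost v (bind-positions ρ) (spine k)))
      (correct u ρ h a b c then λ a b c → correct v (bind-positions ρ) (fits-bind h) a b c then bound-off)
    correct (fold u v w) ρ {s} {γ} h a b c = weaken
      (fold-cost (cost u (suc ∘ ρ) (spine k)) (cost v (λ i → 2 + ρ i) (spine k)) (loop-cost (spine k) (80 + cost w (body-positions ρ) (spine k))))
      (pushed-clock a b c then λ a b c → correct u (suc ∘ ρ) h a b c then λ a b c → correct v (λ i → 2 + ρ i) h a b c then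
        fold-run (λ e acc x κ → correct w (body-positions ρ) (fits-body {e = e} {acc} {cons e x} {κ} h)) (⟦ u ⟧ (spine k) γ) (⟦ v ⟧ (spine k) γ))
    correct (ren f u) ρ h a b c = correct u (ρ ∘ f) (h ∘ f) a b c

-- Refutation, updates and rounds as terms of the fold language.

module Algorithm where

  open Refutation
  open Spending using (rounds)
  open Trials
  open Machine
  open import Data.Fin.Patterns
  open import Data.Nat using (ℕ; zero; suc; _+_; _≤_; s≤s)
  open import Data.Nat.Properties

  iter : ∀ {A : Set} → ℕ → (A → A) → A → A
  iter zero    f a = a
  iter (suc m) f a = iter m f (f a)

  loop-nil : ∀ ℓ {f a} → loop ℓ f nil a ≡ a
  loop-nil zero    = refl
  loop-nil (suc ℓ) = loop-nil ℓ

  loop-foldl : ∀ {ℓ f a} xs → length xs ≤ ℓ → loop ℓ f (encodeList xs) a ≡ foldl (λ a x → f x a) a xs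
  loop-foldl {ℓ} [] _ = loop-nil ℓ
  loop-foldl (x ∷ xs) (s≤s h) = loop-foldl xs h

  loop-iter : ∀ {ℓ g a} m → m ≤ ℓ → loop ℓ (λ _ → g) (encodeℕ m) a ≡ iter m g a
  loop-iter {ℓ} zero _ = loop-nil ℓ
  loop-iter (suc m) (s≤s h) = loop-iter m h

  -- A fold cannot be left early, so the step function must preserve an answer once it is found;
  -- this is the premise that becomes `keep`.
  loop-any : ∀ {A : Set} {ℓ f} (enc : A → Tree) (p : A → Bool) → (∀ x a → f x (cons nil a) ≡ cons nil nil) →
    ∀ xs → All (λ x → f (enc x) nil ≡ fromBool (p x)) xs → length xs ≤ ℓ → ∀ b → loop ℓ f (encodeList (map enc xs)) (fromBool b) ≡ fromBool (b ∨ any p xs)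
  loop-any {ℓ = ℓ} enc p keep [] [] _ false = loop-nil ℓ
  loop-any {ℓ = ℓ} enc p keep [] [] _ true  = loop-nil ℓ
  loop-any {ℓ = suc ℓ} {f} enc p keep (x ∷ xs) (e ∷ es) (s≤s h) false = trans (cong (loop ℓ f (encodeList (map enc xs))) e) (loop-any {ℓ = ℓ} {f} enc p keep xs es h (p x))
  loop-any {ℓ = suc ℓ} {f} enc p keep (x ∷ xs) (e ∷ es) (s≤s h) true  = trans (cong (loop ℓ f (encodeList (map enc xs))) (keep (enc x) nil)) (loop-any {ℓ = ℓ} {f} enc p keep xs es h true)

  loop-all : ∀ {A : Set} {ℓ f} (enc : A → Tree) (p : A → Bool) → (∀ x → f x nil ≡ nil) →
    ∀ xs → All (λ x → f (enc x) (cons nil nil) ≡ fromBool (p x)) xs → length xs ≤ ℓ → ∀ b → loop ℓ f (encodeList (map enc xs)) (fromBool b) ≡ fromBool (b ∧ all p xs)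
  loop-all {ℓ = ℓ} enc p keep [] [] _ false = loop-nil ℓ
  loop-all {ℓ = ℓ} enc p keep [] [] _ true  = loop-nil ℓ
  loop-all {ℓ = suc ℓ} {f} enc p keep (x ∷ xs) (e ∷ es) (s≤s h) true  = trans (cong (loop ℓ f (encodeList (map enc xs))) e) (loop-all {ℓ = ℓ} {f} enc p keep xs es h (p x))
  loop-all {ℓ = suc ℓ} {f} enc p keep (x ∷ xs) (e ∷ es) (s≤s h) false = trans (cong (loop ℓ f (encodeList (map enc xs))) (keep (enc x))) (loop-all {ℓ = ℓ} {f} enc p keep xs es h false)

  encodeVec : ∀ {A : Set} {n} → (A → Tree) → Vec A n → Tree
  encodeVec e []       = nil
  encodeVec e (a ∷ as) = cons (e a) (encodeVec e as)

  encodeMaybe : Maybe Bool → Tree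
  encodeMaybe nothing  = nil
  encodeMaybe (just b) = cons (fromBool b) nil

  encodePartial : ∀ {n} → Partial n → Tree
  encodePartial = encodeVec encodeMaybe

  encodeLiterals : ∀ {n} → List (Literal n) → Tree
  encodeLiterals C = encodeList (map encodeLiteral C)

  encodeFormula : ∀ {n} → Formula n → Tree
  encodeFormula Φ = encodeList (map encodeLiterals Φ)

  lookupT : ℕ → Tree → Tree → Tree
  lookupT ℓ r x = hd (loop ℓ (λ _ → tl) x r)

  shift : Tree → Tree
  shift s = cons (cons (hd (tl s)) (hd s)) (tl (tl s))

  -- A list zipper: `shift` moves the entries before position `x` in reverse order to a second list,
  -- the next entry is replaced, and the second list is pushed back.
  setT : ℕ → Tree → Tree → Tree → Tree
  setT ℓ r x v = let s = loop ℓ (λ _ → shift) x (cons nil r) in loop ℓ cons (hd s) (cons v (tl (tl s)))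

  lookupT-spec : ∀ {A : Set} {ℓ n} (e : A → Tree) (v : Vec A n) x → n ≤ ℓ → lookupT ℓ (encodeVec e v) (encodeℕ (toℕ x)) ≡ e (lookup v x)
  lookupT-spec e v x h = trans (cong hd (loop-iter (toℕ x) (≤-trans (<⇒≤ (toℕ<n x)) h))) (go v x)
    where
    go : ∀ {n} (v : Vec _ n) x → hd (iter (toℕ x) tl (encodeVec e v)) ≡ e (lookup v x)
    go (_ ∷ _) zero    = refl
    go (_ ∷ v) (suc x) = go v x

  push : List Tree → Tree → Tree
  push r t = foldl (λ a x → cons x a) t r

  -- Generalised over the prefix `r` already moved, so that the induction goes through.
  shift-spec : ∀ {A : Set} {n} (e : A → Tree) (v : Vec A n) x a r → Σ[ r′ ∈ List Tree ] Σ[ s ∈ Tree ]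
    (iter (toℕ x) shift (cons (encodeList r) (encodeVec e v)) ≡ cons (encodeList r′) s × length r′ ≡ toℕ x + length r ×
     push r′ (cons (e a) (tl s)) ≡ push r (encodeVec e (v [ x ]≔ a)))
  shift-spec e (b ∷ v) zero    a r = r , cons (e b) (encodeVec e v) , refl , refl , refl
  shift-spec e (b ∷ v) (suc x) a r with shift-spec e v x a (e b ∷ r)
  ... | r′ , s , p , l , q = r′ , s , p , trans l (+-suc (toℕ x) (length r)) , q

  setT-spec : ∀ {A : Set} {ℓ n} (e : A → Tree) (v : Vec A n) x a → n ≤ ℓ → setT ℓ (encodeVec e v) (encodeℕ (toℕ x)) (e a) ≡ encodeVec e (v [ x ]≔ a)
  setT-spec {ℓ = ℓ} e v x a h with shift-spec e v x a []
  ... | r′ , s , p , l , q = trans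
    (cong (λ z → loop ℓ cons (hd z) (cons (e a) (tl (tl z)))) (trans (loop-iter (toℕ x) x≤ℓ) p))
    (trans (loop-foldl r′ (subst (_≤ ℓ) (sym (trans l (+-identityʳ (toℕ x)))) x≤ℓ)) q)
    where x≤ℓ = ≤-trans (<⇒≤ (toℕ<n x)) h

  wk : ∀ {Γ} → Tm Γ → Tm (suc Γ)
  wk = ren suc

  refuted-args : Fin 2 → Fin 7
  refuted-args = lookup (0F ∷ 6F ∷ [])

  try-args : Fin 2 → Fin 5
  try-args = lookup (0F ∷ 4F ∷ [])

  update-args : Fin 4 → Fin 5
  update-args = lookup (1F ∷ 2F ∷ 0F ∷ 4F ∷ [])

  body-args : Fin 3 → Fin 5
  body-args = lookup (0F ∷ 1F ∷ 4F ∷ [])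

  next-args : Fin 3 → Fin 4
  next-args = lookup (0F ∷ 2F ∷ 3F ∷ [])

  yesₜ : ∀ {Γ} → Tm Γ
  yesₜ = cons nil nil

  lookupₜ : ∀ {Γ} → Tm Γ → Tm Γ → Tm Γ
  lookupₜ r x = head (fold x r (tail (get 1F)))

  setₜ : ∀ {Γ} → Tm Γ → Tm Γ → Tm Γ → Tm Γ
  setₜ r x v = bind (fold x (cons nil r) (cons (cons (head (tail (get 1F))) (head (get 1F))) (tail (tail (get 1F)))))
    (fold (head (get 0F)) (cons (wk v) (tail (tail (get 0F)))) (cons (get 0F) (get 1F)))

  differₜ : ∀ {Γ} → Tm Γ → Tm Γ → Tm Γ
  differₜ a b = cond a (cond b nil yesₜ) (cond b yesₜ nil)

  sameₜ : ∀ {Γ} → Tm Γ → Tm Γ → Tm Γ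
  sameₜ a b = cond a (cond b yesₜ nil) (cond b nil yesₜ)

  falsifiedₜ : ∀ {Γ} → Tm Γ → Tm Γ → Tm Γ
  falsifiedₜ r l = bind (lookupₜ r (head l)) (cond (get 0F) (differₜ (wk (tail l)) (head (get 0F))) nil)

  -- Variables: 0 the partial assignment, 1 the formula.
  refutedₜ : ℕ → Tm 2
  refutedₜ zero    = nil
  refutedₜ (suc d) = fold (get 1F) nil (cond (get 1F) yesₜ (fold (get 0F) yesₜ (cond (get 1F)
    (cond (falsifiedₜ (get 4F) (get 0F)) yesₜ
      (bind (setₜ (get 4F) (head (get 0F)) (cons (tail (get 0F)) nil)) (ren refuted-args (refutedₜ d)))) nil)))

  isCons-fromBool : ∀ b → isCons (fromBool b) ≡ b
  isCons-fromBool false = refl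
  isCons-fromBool true  = refl

  module _ {n ℓ : ℕ} (Φ : Formula n) (n≤ℓ : n ≤ ℓ) (3≤ℓ : 3 ≤ ℓ) (Φ≤ℓ : length Φ ≤ ℓ) (3cnf : All (λ C → length C ≤ 3) Φ) where

    falsifiedₜ-spec : ∀ {Γ} (r l : Tm Γ) γ ρ (k : Literal n) → ⟦ r ⟧ ℓ γ ≡ encodePartial ρ → ⟦ l ⟧ ℓ γ ≡ encodeLiteral k →
      ⟦ falsifiedₜ r l ⟧ ℓ γ ≡ fromBool (falsified ρ k)
    falsifiedₜ-spec r l γ ρ (x , b) er el
      rewrite er | el | lookupT-spec {ℓ = ℓ} encodeMaybe ρ x n≤ℓ with lookup ρ x | b
    ... | nothing    | _     = refl
    ... | just true  | true  = refl
    ... | just false | true  = refl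
    ... | just true  | false = refl
    ... | just false | false = refl

    assignT-spec : ∀ ρ (k : Literal n) → setT ℓ (encodePartial ρ) (hd (encodeLiteral k)) (cons (tl (encodeLiteral k)) nil) ≡ encodePartial (assign ρ k)
    assignT-spec ρ (x , b) = setT-spec encodeMaybe ρ x (just b) n≤ℓ

    refutedₜ-spec : ∀ d γ ρ → γ 0F ≡ encodePartial ρ → γ 1F ≡ encodeFormula Φ → ⟦ refutedₜ d ⟧ ℓ γ ≡ fromBool (refuted Φ d ρ)
    refutedₜ-spec zero    γ ρ eρ eΦ = refl
    refutedₜ-spec (suc d) γ ρ eρ eΦ = trans (cong (λ z → loop ℓ clause z nil) eΦ)
        (loop-any {f = clause} encodeLiterals (all (λ l → falsified ρ l ∨ refuted Φ d (assign ρ l))) (λ _ _ → refl) Φ (All.map (λ {C} → clause-spec {C}) 3cnf) Φ≤ℓ false)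
      where
      test : Tm 6
      test = cond (falsifiedₜ (get 4F) (get 0F)) yesₜ (bind (setₜ (get 4F) (head (get 0F)) (cons (tail (get 0F)) nil)) (ren refuted-args (refutedₜ d)))
      clause : Tree → Tree → Tree
      clause C a = ⟦ cond (get 1F) yesₜ (fold (get 0F) yesₜ (cond (get 1F) test nil)) ⟧ ℓ (γ ▸ a ▸ C)
      test-spec : ∀ C a a′ l → ⟦ test ⟧ ℓ (γ ▸ a ▸ C ▸ a′ ▸ encodeLiteral l) ≡ fromBool (falsified ρ l ∨ refuted Φ d (assign ρ l))
      test-spec C a a′ l
        rewrite falsifiedₜ-spec (get 4F) (get 0F) (γ ▸ a ▸ C ▸ a′ ▸ encodeLiteral l) ρ l eρ refl with falsified ρ l
      ... | true  = refl
      ... | false = refutedₜ-spec d _ (assign ρ l) (trans (cong (λ z → setT ℓ z (hd (encodeLiteral l)) (cons (tl (encodeLiteral l)) nil)) eρ) (assignT-spec ρ l)) eΦ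
      clause-spec : ∀ {C} → length C ≤ 3 → clause (encodeLiterals C) nil ≡ fromBool (all (λ l → falsified ρ l ∨ refuted Φ d (assign ρ l)) C)
      clause-spec {C} h = loop-all {f = λ l a → ⟦ cond (get 1F) test nil ⟧ ℓ (γ ▸ nil ▸ encodeLiterals C ▸ a ▸ l)} encodeLiteral
        (λ l → falsified ρ l ∨ refuted Φ d (assign ρ l)) (λ _ → refl) C (All.tabulate (λ {l} _ → test-spec (encodeLiterals C) nil (cons nil nil) l)) (≤-trans h 3≤ℓ) true

  selectₜ : ∀ {Γ} → ℕ → Tm Γ → Tm Γ
  selectₜ zero    τ = yesₜ
  selectₜ (suc k) τ = cond (head τ) (selectₜ k (tail τ)) nil

  tailsₜ : ∀ {Γ} → ℕ → Tm Γ → Tm Γ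
  tailsₜ zero    τ = τ
  tailsₜ (suc k) τ = tailsₜ k (tail τ)

  selectT : ℕ → Tree → Bool
  selectT zero    τ = true
  selectT (suc k) τ = isCons (hd τ) ∧ selectT k (tl τ)

  selectₜ-spec : ∀ {Γ} k (τ : Tm Γ) {ℓ γ} → ⟦ selectₜ k τ ⟧ ℓ γ ≡ fromBool (selectT k (⟦ τ ⟧ ℓ γ))
  selectₜ-spec zero    τ = refl
  selectₜ-spec (suc k) τ {ℓ} {γ} with isCons (hd (⟦ τ ⟧ ℓ γ))
  ... | true  = selectₜ-spec k (tail τ)
  ... | false = refl

  tailsₜ-spec : ∀ {Γ} k (τ : Tm Γ) {ℓ γ} → ⟦ tailsₜ k τ ⟧ ℓ γ ≡ iter k tl (⟦ τ ⟧ ℓ γ)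
  tailsₜ-spec zero    τ = refl
  tailsₜ-spec (suc k) τ = tailsₜ-spec k (tail τ)

  -- Variables: 0 the fresh bit, 1 the variable, 2 the partial assignment, 3 the formula.
  updateₜ : ℕ → Tm 4
  updateₜ d = cond (lookupₜ (get 2F) (get 1F)) (get 2F) (setₜ (get 2F) (get 1F) (cons
    (cond (try yesₜ) nil (cond (try nil) yesₜ (cond (get 0F) yesₜ nil))) nil))
    where
    try : Tm 4 → Tm 4
    try b = bind (setₜ (get 2F) (get 1F) (cons b nil)) (ren try-args (refutedₜ d))

  -- Variables: 0 the variable, 1 the pair of partial assignment and tape, 2 the formula.
  advanceₜ : ℕ → ℕ → Tm 3
  advanceₜ d k = cons (cond (selectₜ k (tail (get 1F)))
      (bind (head (tailsₜ k (tail (get 1F)))) (bind (head (get 2F)) (ren update-args (updateₜ d)))) (head (get 1F)))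
    (tail (tailsₜ k (tail (get 1F))))

  -- Variables: 0 the pair of partial assignment and tape, 1 the list of variables, 2 the formula.
  roundsₜ : ℕ → ℕ → ℕ → Tm 3
  roundsₜ d k zero    = get 0F
  roundsₜ d k (suc m) = bind (fold (get 1F) (get 0F) (ren body-args (advanceₜ d k))) (ren next-args (roundsₜ d k m))

  -- The rounds of `trial`, with coins read from a tree. On a tape that is too short `hd` and `tl`
  -- give `nil`, so the result is defined for every tree, and correctness of the output needs no
  -- assumption on the tape.
  walk : ∀ {n} → Formula n → ℕ → ℕ → List (Fin n) → Partial n × Tree → Partial n × Tree
  walk Φ d k []      σ       = σ
  walk Φ d k (x ∷ s) (ρ , τ) = walk Φ d k s (advance Φ d ρ x (selectT k τ) (isCons (hd (iter k tl τ))) , tl (iter k tl τ))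

  walk-++ : ∀ {n} (Φ : Formula n) d k s t σ → walk Φ d k (s ++ t) σ ≡ walk Φ d k t (walk Φ d k s σ)
  walk-++ Φ d k []      t σ = refl
  walk-++ Φ d k (x ∷ s) t σ = walk-++ Φ d k s t _

  encodeVar : ∀ {n} → Fin n → Tree
  encodeVar x = encodeℕ (toℕ x)

  encodeState : ∀ {n} → Partial n × Tree → Tree
  encodeState (ρ , τ) = cons (encodePartial ρ) τ

  module _ {n ℓ : ℕ} (Φ : Formula n) (n≤ℓ : n ≤ ℓ) (3≤ℓ : 3 ≤ ℓ) (Φ≤ℓ : length Φ ≤ ℓ) (3cnf : All (λ C → length C ≤ 3) Φ) where

    updateₜ-spec : ∀ d γ ρ x → γ 1F ≡ encodeVar x → γ 2F ≡ encodePartial ρ → γ 3F ≡ encodeFormula Φ →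
      ⟦ updateₜ d ⟧ ℓ γ ≡ encodePartial (update Φ d ρ x (isCons (γ 0F)))
    updateₜ-spec d γ ρ x e₁ e₂ e₃ = trans (cong₂ (λ r y → ifc (lookupT ℓ r y) r (setT ℓ r y (cons val nil))) e₂ e₁) go
      where
      ifc : Tree → Tree → Tree → Tree
      ifc c s t = if isCons c then s else t
      try : Tree → Tree
      try b = ⟦ refutedₜ d ⟧ ℓ ((γ ▸ setT ℓ (γ 2F) (γ 1F) (cons b nil)) ∘ try-args)
      val : Tree
      val = ifc (try (cons nil nil)) nil (ifc (try nil) (cons nil nil) (ifc (γ 0F) (cons nil nil) nil))
      try-spec : ∀ b → try (fromBool b) ≡ fromBool (refuted Φ d (assign ρ (x , b)))
      try-spec b = refutedₜ-spec Φ n≤ℓ 3≤ℓ Φ≤ℓ 3cnf d _ (assign ρ (x , b))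
        (trans (cong₂ (λ r y → setT ℓ r y (cons (fromBool b) nil)) e₂ e₁) (setT-spec encodeMaybe ρ x (just b) n≤ℓ)) e₃
      val-spec : val ≡ fromBool (fromMaybe (isCons (γ 0F)) (forced Φ d ρ x))
      val-spec rewrite try-spec true | try-spec false
        with refuted Φ d (assign ρ (x , true)) | refuted Φ d (assign ρ (x , false)) | isCons (γ 0F)
      ... | true  | _     | _     = refl
      ... | false | true  | _     = refl
      ... | false | false | true  = refl
      ... | false | false | false = refl
      go : ifc (lookupT ℓ (encodePartial ρ) (encodeVar x)) (encodePartial ρ) (setT ℓ (encodePartial ρ) (encodeVar x) (cons val nil))
         ≡ encodePartial (update Φ d ρ x (isCons (γ 0F)))
      go rewrite lookupT-spec {ℓ = ℓ} encodeMaybe ρ x n≤ℓ | val-spec with lookup ρ x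
      ... | just _  = refl
      ... | nothing = setT-spec encodeMaybe ρ x (just (fromMaybe (isCons (γ 0F)) (forced Φ d ρ x))) n≤ℓ

    advanceₜ-spec : ∀ d k γ σ x → γ 0F ≡ encodeVar x → γ 1F ≡ encodeState σ → γ 2F ≡ encodeFormula Φ →
      ⟦ advanceₜ d k ⟧ ℓ γ ≡ encodeState (walk Φ d k (x ∷ []) σ)
    advanceₜ-spec d k γ (ρ , τ) x e₀ e₁ e₂ = cong₂ cons fst
        (cong tl (trans (tailsₜ-spec k (tail (get 1F)) {ℓ} {γ}) (cong (iter k tl ∘ tl) e₁)))
      where
      bit : Tree
      bit = hd (⟦ tailsₜ k (tail (get 1F)) ⟧ ℓ γ)
      bit≡ : bit ≡ hd (iter k tl τ)
      bit≡ = cong hd (trans (tailsₜ-spec k (tail (get 1F)) {ℓ} {γ}) (cong (iter k tl ∘ tl) e₁))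
      upd = ⟦ updateₜ d ⟧ ℓ ((γ ▸ bit ▸ hd (γ 1F)) ∘ update-args)
      fst : (if isCons (⟦ selectₜ k (tail (get 1F)) ⟧ ℓ γ) then upd else hd (γ 1F)) ≡ encodePartial (advance Φ d ρ x (selectT k τ) (isCons (hd (iter k tl τ))))
      fst rewrite selectₜ-spec k (tail (get 1F)) {ℓ} {γ} | isCons-fromBool (selectT k (tl (γ 1F)))
        | updateₜ-spec d ((γ ▸ bit ▸ hd (γ 1F)) ∘ update-args) ρ x e₀ (cong hd e₁) e₂ | bit≡ | e₁ with selectT k τ
      ... | true  = refl
      ... | false = refl

    round-spec : ∀ d k f → (∀ y σ x → y ≡ encodeVar x → f y (encodeState σ) ≡ encodeState (walk Φ d k (x ∷ []) σ)) →
      ∀ s → length s ≤ ℓ → ∀ {ℓ′} → length s ≤ ℓ′ → ∀ σ → loop ℓ′ f (encodeList (map encodeVar s)) (encodeState σ) ≡ encodeState (walk Φ d k s σ)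
    round-spec d k f h []      _ {ℓ′} _ σ = loop-nil ℓ′
    round-spec d k f h (x ∷ s) l {suc ℓ′} (s≤s l′) σ = trans (cong (loop ℓ′ f (encodeList (map encodeVar s))) (h (encodeVar x) σ x refl))
      (round-spec d k f h s (≤-trans (n≤1+n _) l) l′ _)

    roundsₜ-spec : ∀ d k m γ σ → γ 0F ≡ encodeState σ → γ 1F ≡ encodeList (map encodeVar (allFin n)) → γ 2F ≡ encodeFormula Φ →
      ⟦ roundsₜ d k m ⟧ ℓ γ ≡ encodeState (walk Φ d k (rounds n m) σ)
    roundsₜ-spec d k zero    γ σ e₀ e₁ e₂ = e₀
    roundsₜ-spec d k (suc m) γ σ e₀ e₁ e₂ = trans
      (roundsₜ-spec d k m _ (walk Φ d k (allFin n) σ)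
        (trans (cong₂ (loop ℓ (λ x a → ⟦ ren body-args (advanceₜ d k) ⟧ ℓ (γ ▸ a ▸ x))) e₁ e₀)
          (round-spec d k _ (λ y σ x e → advanceₜ-spec d k ((γ ▸ encodeState σ ▸ y) ∘ body-args) σ x e refl e₂) (allFin n) len len σ)) e₁ e₂)
      (cong encodeState (sym (walk-++ Φ d k (allFin n) (rounds n m) σ)))
      where
      len : length (allFin n) ≤ ℓ
      len = subst (_≤ ℓ) (sym (length-tabulate id)) n≤ℓ

-- A whole trial as one term, and its agreement with the probabilistic model.

module Trial where

  open Refutation
  open Spending using (rounds)
  open Trials
  open Machine
  open Algorithm
  open import Data.Fin.Patterns
  open import Data.Nat using (ℕ; zero; suc; _+_; _*_; _≤_; s≤s)
  open import Data.Nat.Properties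
  open import Data.Vec using (replicate)

  reverseₜ : ∀ {Γ} → Tm Γ → Tm Γ
  reverseₜ t = fold t nil (cons (get 0F) (get 1F))

  -- The head of the state is the next number, the tail lists the smaller ones in descending order.
  count-up : Tree → Tree
  count-up s = cons (cons nil (hd s)) (cons (hd s) (tl s))

  varsₜ : ∀ {Γ} → Tm Γ → Tm Γ
  varsₜ n = bind (fold n (cons nil nil) (cons (cons nil (head (get 1F))) (cons (head (get 1F)) (tail (get 1F))))) (reverseₜ (tail (get 0F)))

  count-from : ℕ → ℕ → List Tree
  count-from zero    c = []
  count-from (suc m) c = encodeℕ c ∷ count-from m (suc c)

  count-up-spec : ∀ m c r → Σ[ z ∈ Tree ] Σ[ r′ ∈ List Tree ]
    (iter m count-up (cons (encodeℕ c) (encodeList r)) ≡ cons z (encodeList r′) × length r′ ≡ m + length r ×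
     (∀ t → push r′ t ≡ push r (foldr cons t (count-from m c))))
  count-up-spec zero    c r = encodeℕ c , r , refl , refl , λ t → refl
  count-up-spec (suc m) c r with count-up-spec m (suc c) (encodeℕ c ∷ r)
  ... | z , r′ , p , l , q = z , r′ , p , trans l (+-suc m (length r)) , q

  count-from-tabulate : ∀ m c → count-from m c ≡ tabulate {n = m} (λ i → encodeℕ (toℕ i + c))
  count-from-tabulate zero    c = refl
  count-from-tabulate (suc m) c = cong (encodeℕ c ∷_) (trans (count-from-tabulate m (suc c)) (tabulate-cong (λ i → cong encodeℕ (+-suc (toℕ i) c))))

  varsₜ-spec : ∀ {Γ} (t : Tm Γ) {ℓ γ} n → n ≤ ℓ → ⟦ t ⟧ ℓ γ ≡ encodeℕ n → ⟦ varsₜ t ⟧ ℓ γ ≡ encodeList (map encodeVar (allFin n))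
  varsₜ-spec t {ℓ} n h e with count-up-spec n 0 []
  ... | z , r′ , p , l , q = trans
    (cong (λ s → loop ℓ cons (tl s) nil) (trans (cong (λ w → loop ℓ (λ _ → count-up) w (cons nil nil)) e) (trans (loop-iter n h) p)))
    (trans (loop-foldl r′ (subst (_≤ ℓ) (sym (trans l (+-identityʳ n))) h)) (trans (q nil) (cong encodeList
      (trans (count-from-tabulate n 0) (trans (tabulate-cong (λ i → cong encodeℕ (+-identityʳ (toℕ i)))) (sym (map-tabulate id encodeVar)))))))

  fillTree : ∀ {n} → Partial n → Tree → Assignment n
  fillTree []            τ = []
  fillTree (just b ∷ ρ)  τ = b ∷ fillTree ρ (tl τ)
  fillTree (nothing ∷ ρ) τ = isCons (hd τ) ∷ fillTree ρ (tl τ)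

  -- The bit taken from the tape is normalised, since an arbitrary tape need not contain values of
  -- `fromBool`.
  fill-move : Tree → Tree → Tree
  fill-move e s = cons (cons (if isCons e then hd e else (if isCons (hd (tl s)) then cons nil nil else nil)) (hd s)) (tl (tl s))

  fillₜ : ∀ {Γ} → Tm Γ → Tm Γ → Tm Γ
  fillₜ ρ τ = bind (fold ρ (cons nil τ) (cons (cons (cond (get 0F) (head (get 0F)) (cond (head (tail (get 1F))) yesₜ nil)) (head (get 1F))) (tail (tail (get 1F)))))
    (reverseₜ (head (get 0F)))

  fill-move-spec : ∀ {n ℓ} (ρ : Partial n) τ r → n ≤ ℓ → Σ[ z ∈ Tree ] Σ[ r′ ∈ List Tree ]
    (loop ℓ fill-move (encodePartial ρ) (cons (encodeList r) τ) ≡ cons (encodeList r′) z × length r′ ≡ n + length r ×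
     (∀ t → push r′ t ≡ push r (foldr cons t (map fromBool (toList (fillTree ρ τ))))))
  fill-move-spec {ℓ = ℓ} [] τ r _ = τ , r , loop-nil ℓ , refl , λ t → refl
  fill-move-spec {suc n} {suc ℓ} (just b ∷ ρ) τ r (s≤s h) with fill-move-spec {ℓ = ℓ} ρ (tl τ) (fromBool b ∷ r) h
  ... | z , r′ , p , l , q = z , r′ , p , trans l (+-suc n (length r)) , q
  fill-move-spec {suc n} {suc ℓ} (nothing ∷ ρ) τ r (s≤s h) with isCons (hd τ)
  ... | b with fill-move-spec {ℓ = ℓ} ρ (tl τ) (fromBool b ∷ r) h
  ...   | z , r′ , p , l , q = z , r′ , trans (cong (λ w → loop ℓ fill-move (encodePartial ρ) (cons (cons w (encodeList r)) (tl τ))) (canonical b)) p , trans l (+-suc n (length r)) , q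
    where
    canonical : ∀ b → (if b then cons nil nil else nil) ≡ fromBool b
    canonical false = refl
    canonical true  = refl

  fillₜ-spec : ∀ {Γ} (r u : Tm Γ) {ℓ γ n} (ρ : Partial n) → n ≤ ℓ → ⟦ r ⟧ ℓ γ ≡ encodePartial ρ →
    ⟦ fillₜ r u ⟧ ℓ γ ≡ encodeAssignment (fillTree ρ (⟦ u ⟧ ℓ γ))
  fillₜ-spec r u {ℓ} {γ} {n} ρ h e with fill-move-spec {ℓ = ℓ} ρ (⟦ u ⟧ ℓ γ) [] h
  ... | z , r′ , p , l , q = trans (cong (λ s → loop ℓ cons (hd s) nil) (trans (cong (λ w → loop ℓ fill-move w (cons nil (⟦ u ⟧ ℓ γ))) e) p))
    (trans (loop-foldl r′ (subst (_≤ ℓ) (sym (trans l (+-identityʳ n))) h)) (q nil))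

  encodeAssignment-Vec : ∀ {n} (α : Assignment n) → encodeAssignment α ≡ encodeVec fromBool α
  encodeAssignment-Vec []      = refl
  encodeAssignment-Vec (b ∷ α) = cong (cons (fromBool b)) (encodeAssignment-Vec α)

  true? : ∀ {n} → Assignment n → Literal n → Bool
  true? α l = isYes (lookup α (var l) ≟ᵇ proj₂ l)

  models : ∀ {n} → Formula n → Assignment n → Bool
  models Φ α = all (any (true? α)) Φ

  -- Variables: 0 the assignment, 1 the formula.
  modelsₜ : Tm 2
  modelsₜ = fold (get 1F) yesₜ (cond (get 1F) (fold (get 0F) nil (cond (get 1F) yesₜ (sameₜ (lookupₜ (get 4F) (head (get 0F))) (tail (get 0F))))) nil)

  modelsₜ-spec : ∀ {n ℓ} (Φ : Formula n) → n ≤ ℓ → 3 ≤ ℓ → length Φ ≤ ℓ → All (λ C → length C ≤ 3) Φ →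
    ∀ γ α → γ 0F ≡ encodeAssignment α → γ 1F ≡ encodeFormula Φ → ⟦ modelsₜ ⟧ ℓ γ ≡ fromBool (models Φ α)
  modelsₜ-spec {n} {ℓ} Φ n≤ℓ 3≤ℓ Φ≤ℓ 3cnf γ α eα eΦ = trans (cong (λ z → loop ℓ clause z (cons nil nil)) eΦ)
      (loop-all {f = clause} encodeLiterals (any (true? α)) (λ _ → refl) Φ (All.map (λ {C} → clause-spec {C}) 3cnf) Φ≤ℓ true)
    where
    test : Tm 6
    test = sameₜ (lookupₜ (get 4F) (head (get 0F))) (tail (get 0F))
    clause : Tree → Tree → Tree
    clause C a = ⟦ cond (get 1F) (fold (get 0F) nil (cond (get 1F) yesₜ test)) nil ⟧ ℓ (γ ▸ a ▸ C)
    test-spec : ∀ C a a′ l → ⟦ test ⟧ ℓ (γ ▸ a ▸ C ▸ a′ ▸ encodeLiteral l) ≡ fromBool (true? α l)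
    test-spec C a a′ (x , b) rewrite eα | encodeAssignment-Vec α | lookupT-spec {ℓ = ℓ} fromBool α x n≤ℓ with lookup α x | b
    ... | true  | true  = refl
    ... | true  | false = refl
    ... | false | true  = refl
    ... | false | false = refl
    clause-spec : ∀ {C} → length C ≤ 3 → clause (encodeLiterals C) (cons nil nil) ≡ fromBool (any (true? α) C)
    clause-spec {C} h = loop-any {f = λ l a → ⟦ cond (get 1F) yesₜ test ⟧ ℓ (γ ▸ cons nil nil ▸ encodeLiterals C ▸ a ▸ l)} encodeLiteral
      (true? α) (λ _ _ → refl) C (All.tabulate (λ {l} _ → test-spec (encodeLiterals C) (cons nil nil) nil l)) (≤-trans h 3≤ℓ) false

  rounds-args : Fin 3 → Fin 5
  rounds-args = lookup (1F ∷ 2F ∷ 0F ∷ [])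

  models-args : Fin 2 → Fin 7
  models-args = lookup (0F ∷ 2F ∷ [])

  -- Variables: 0 the tape, 1 the input.  The result is a pair of a flag,
  -- nil on success, and an assignment.
  trialₜ : ℕ → ℕ → ℕ → Tm 2
  trialₜ d k R = bind (varsₜ (head (get 1F))) (bind (cons (head (get 2F)) (get 1F)) (bind (tail (get 3F))
    (bind (ren rounds-args (roundsₜ d k R)) (bind (fillₜ (head (get 0F)) (tail (get 0F)))
      (cons (cond (ren models-args modelsₜ) nil yesₜ) (get 0F))))))

  encode-empty : ∀ n → encodeℕ n ≡ encodePartial (replicate n nothing)
  encode-empty zero    = refl
  encode-empty (suc n) = cong (cons nil) (encode-empty n)

  outcome : ∀ {n} → Formula n → ℕ → ℕ → ℕ → Tree → Assignment n
  outcome {n} Φ d k R τ = let (ρ , τ′) = walk Φ d k (rounds n R) (replicate n nothing , τ) in fillTree ρ τ′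

  trialₜ-spec : ∀ {n ℓ} (Φ : Formula n) → n ≤ ℓ → 3 ≤ ℓ → length Φ ≤ ℓ → All (λ C → length C ≤ 3) Φ →
    ∀ d k R γ → γ 1F ≡ cons (encodeℕ n) (encodeFormula Φ) →
    ⟦ trialₜ d k R ⟧ ℓ γ ≡ cons (fromBool (not (models Φ (outcome Φ d k R (γ 0F))))) (encodeAssignment (outcome Φ d k R (γ 0F)))
  trialₜ-spec {n} {ℓ} Φ n≤ℓ 3≤ℓ Φ≤ℓ 3cnf d k R γ e = cong₂ cons
      (trans (cong (λ z → if isCons z then nil else cons nil nil) (modelsₜ-spec Φ n≤ℓ 3≤ℓ Φ≤ℓ 3cnf (γ₅ ∘ models-args) (outcome Φ d k R (γ 0F)) filled eΦ)) (flip (models Φ (outcome Φ d k R (γ 0F)))))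
      filled
    where
    σ₀ = replicate n nothing , γ 0F
    γ₁ = γ ▸ ⟦ varsₜ (head (get 1F)) ⟧ ℓ γ
    γ₂ = γ₁ ▸ cons (hd (γ 1F)) (γ 0F)
    γ₃ = γ₂ ▸ tl (γ 1F)
    γ₄ = γ₃ ▸ ⟦ ren rounds-args (roundsₜ d k R) ⟧ ℓ γ₃
    γ₅ = γ₄ ▸ ⟦ fillₜ (head (get 0F)) (tail (get 0F)) ⟧ ℓ γ₄
    eΦ : tl (γ 1F) ≡ encodeFormula Φ
    eΦ = cong tl e
    walked : ⟦ roundsₜ d k R ⟧ ℓ (γ₃ ∘ rounds-args) ≡ encodeState (walk Φ d k (rounds n R) σ₀)
    walked = roundsₜ-spec Φ n≤ℓ 3≤ℓ Φ≤ℓ 3cnf d k R (γ₃ ∘ rounds-args) σ₀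
      (cong (λ z → cons z (γ 0F)) (trans (cong hd e) (encode-empty n))) (varsₜ-spec (head (get 1F)) {ℓ} {γ} n n≤ℓ (cong hd e)) eΦ
    filled : ⟦ fillₜ (head (get 0F)) (tail (get 0F)) ⟧ ℓ γ₄ ≡ encodeAssignment (outcome Φ d k R (γ 0F))
    filled = trans (fillₜ-spec (head (get 0F)) (tail (get 0F)) {ℓ} {γ₄} (proj₁ (walk Φ d k (rounds n R) σ₀)) n≤ℓ (cong hd walked))
      (cong (λ z → encodeAssignment (fillTree (proj₁ (walk Φ d k (rounds n R) σ₀)) (tl z))) walked)
    flip : ∀ b → (if isCons (fromBool b) then nil else cons nil nil) ≡ fromBool (not b)
    flip true  = refl
    flip false = refl

  consesₜ : ∀ {Γ} → ℕ → Tm Γ → Tm Γ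
  consesₜ zero    t = t
  consesₜ (suc m) t = cons nil (consesₜ m t)

  counterₜ : ℕ → Tm 1
  counterₜ m = fold (head (get 0F)) nil (consesₜ m (get 1F))

  counterₜ-spec : ∀ {ℓ γ} m n {t} → n ≤ ℓ → γ 0F ≡ cons (encodeℕ n) t → ⟦ counterₜ m ⟧ ℓ γ ≡ encodeℕ (n * m)
  counterₜ-spec {ℓ} {γ} m n h e = trans (cong (λ z → loop ℓ body′ (hd z) nil) e) (trans (go ℓ n 0 h) (cong encodeℕ (+-identityʳ (n * m))))
    where
    body′ : Tree → Tree → Tree
    body′ x a = ⟦ consesₜ m (get 1F) ⟧ ℓ (γ ▸ a ▸ x)
    conses : ∀ m x c → ⟦ consesₜ m (get 1F) ⟧ ℓ (γ ▸ encodeℕ c ▸ x) ≡ encodeℕ (m + c)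
    conses zero    x c = refl
    conses (suc m) x c = cong (cons nil) (conses m x c)
    go : ∀ ℓ n c → n ≤ ℓ → loop ℓ body′ (encodeℕ n) (encodeℕ c) ≡ encodeℕ (n * m + c)
    go ℓ zero c h = loop-nil ℓ
    go (suc ℓ) (suc n) c (s≤s h) = trans (cong (loop ℓ body′ (encodeℕ n)) (conses m nil c)) (trans (go ℓ n (m + c) h)
      (cong encodeℕ (trans (sym (+-assoc (n * m) m c)) (cong (_+ c) (+-comm (n * m) m)))))

  select-spec : ∀ k {m} (ω : Vec Bool (k + m)) →
    selectT k (encodeVec fromBool ω) ≡ proj₁ (select k ω) × iter k tl (encodeVec fromBool ω) ≡ encodeVec fromBool (proj₂ (select k ω))
  select-spec zero    ω       = refl , refl
  select-spec (suc k) (b ∷ ω) = cong₂ _∧_ (isCons-fromBool b) (proj₁ (select-spec k ω)) , proj₂ (select-spec k ω)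

  fill-spec : ∀ {n} (ρ : Partial n) ω → fillTree ρ (encodeVec fromBool ω) ≡ fill ρ ω
  fill-spec []            []      = refl
  fill-spec (just b ∷ ρ)  (_ ∷ ω) = cong (b ∷_) (fill-spec ρ ω)
  fill-spec (nothing ∷ ρ) (b ∷ ω) = cong₂ _∷_ (isCons-fromBool b) (fill-spec ρ ω)

  trial-walk : ∀ {n} (Φ : Formula n) d k s ρ (ω : Vec Bool (tape k s)) → let (ρ′ , τ) = walk Φ d k s (ρ , encodeVec fromBool ω) in
    fillTree ρ′ τ ≡ trial Φ d k s ρ ω
  trial-walk Φ d k []      ρ ω = fill-spec ρ ω
  trial-walk Φ d k (x ∷ s) ρ ω with select k ω | select-spec k ω
  ... | c , g ∷ ω′ | e₁ , e₂ rewrite e₁ | e₂ | isCons-fromBool g = trial-walk Φ d k s (advance Φ d ρ x c g) ω′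

  tape-rounds : ∀ n k R → tape k (rounds n R) ≡ n * suc (R * suc k)
  tape-rounds n k R = trans (lem (rounds n R)) (trans (cong (λ z → z * suc k + n) (len R))
      (trans (cong (_+ n) (trans (cong (_* suc k) (*-comm R n)) (*-assoc n R (suc k)))) (trans (+-comm (n * (R * suc k)) n) (sym (*-suc n (R * suc k))))))
    where
    lem : ∀ (s : List (Fin n)) → tape k s ≡ length s * suc k + n
    lem []      = refl
    lem (x ∷ s) = trans (cong (λ z → k + suc z) (lem s)) (trans (+-suc k (length s * suc k + n)) (cong suc (sym (+-assoc k (length s * suc k) n))))
    len : ∀ R → length (rounds n R) ≡ R * n
    len zero    = refl
    len (suc R) = trans (length-++ (allFin n)) (cong₂ _+_ (length-tabulate id) (len R))

-- Expected duration and partial correctness of while-programs.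

module Runtime where

  open Arithmetic
  open Machine
  open Algorithm
  open import Data.Integer using (+_)
  open import Data.Nat as ℕ using (ℕ; zero; suc; s≤s)
  import Data.Nat.Properties as ℕP
  open import Data.Rational hiding (_≟_; NonZero)
  open import Data.Rational.Properties hiding (_≟_)
  open import Tactic.RingSolver

  duration : ∀ {r} → ℕ → Config r → ℚ
  duration N κ = 𝔼 N (λ ω → + time ω κ / 1)

  module _ {r : ℕ} where

    duration-≥0 : ∀ N (κ : Config r) → 0ℚ ≤ duration N κ
    duration-≥0 N κ = Functional.≥0 (𝔼-functional N) λ ω → subst (0ℚ ≤_) (sym (/1≡ι (time ω κ))) (0≤ι (time ω κ))

    duration-halted : ∀ N (σ : Store r) → duration N ([] , σ) ≡ 0ℚ
    duration-halted zero    σ = refl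
    duration-halted (suc N) σ = cong (½ *_) (cong₂ _+_ (𝔼-const N 0ℚ) (𝔼-const N 0ℚ))

    duration-step : ∀ N c K (σ : Store r) →
      duration (suc N) (c ∷ K , σ) ≡ 1ℚ + ½ * (duration N (step false (c ∷ K , σ)) + duration N (step true (c ∷ K , σ)))
    duration-step N c K σ = trans (cong₂ (λ a b → ½ * (a + b)) (one false) (one true))
      (trans (lem ½ (t false) (t true)) (cong (λ z → z + ½ * (t false + t true)) (½-avg 1ℚ)))
      where
      t : Bool → ℚ
      t b = duration N (step b (c ∷ K , σ))
      one : ∀ b → 𝔼 N (λ ω → + suc (time ω (step b (c ∷ K , σ))) / 1) ≡ 1ℚ + t b
      one b = trans (Functional.ext (𝔼-functional N) (λ ω → trans (/1≡ι (suc (time ω (step b (c ∷ K , σ))))) (cong (λ z → 1ℚ + z) (sym (/1≡ι (time ω (step b (c ∷ K , σ))))))))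
        (trans (Functional.add (𝔼-functional N) (λ _ → 1ℚ) (λ ω → + time ω (step b (c ∷ K , σ)) / 1)) (cong (λ z → z + t b) (𝔼-const N 1ℚ)))
      lem : ∀ h a b → h * ((1ℚ + a) + (1ℚ + b)) ≡ h * (1ℚ + 1ℚ) + h * (a + b)
      lem = solve-∀ ℚ-ring

    duration-mono : ∀ N (κ : Config r) → duration N κ ≤ duration (suc N) κ
    duration-mono zero    κ = duration-≥0 1 κ
    duration-mono (suc N) ([] , σ) = ≤-reflexive (trans (duration-halted (suc N) σ) (sym (duration-halted (suc (suc N)) σ)))
    duration-mono (suc N) (c ∷ K , σ) = subst₂ _≤_ (sym (duration-step N c K σ)) (sym (duration-step (suc N) c K σ))
      (+-monoʳ-≤ 1ℚ (*-monoˡ 0≤½ (+-mono-≤ (duration-mono N _) (duration-mono N _))))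

    duration-flip : ∀ N c K (σ : Store r) →
      duration N (c ∷ K , σ) ≤ 1ℚ + ½ * (duration N (step false (c ∷ K , σ)) + duration N (step true (c ∷ K , σ)))
    duration-flip zero    c K σ = 0≤+ 0≤1 (0≤* 0≤½ (0≤+ (duration-≥0 0 (step false (c ∷ K , σ))) (duration-≥0 0 (step true (c ∷ K , σ)))))
    duration-flip (suc N) c K σ = ≤-trans (≤-reflexive (duration-step N c K σ))
      (+-monoʳ-≤ 1ℚ (*-monoˡ 0≤½ (+-mono-≤ (duration-mono N _) (duration-mono N _))))

    duration-move : ∀ N c K (σ : Store r) {κ} → (∀ b → step b (c ∷ K , σ) ≡ κ) → duration (suc N) (c ∷ K , σ) ≡ 1ℚ + duration N κ
    duration-move N c K σ {κ} e = trans (duration-step N c K σ)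
      (cong (λ z → 1ℚ + z) (trans (cong₂ (λ a b → ½ * (duration N a + duration N b)) (e false) (e true)) (½-avg (duration N κ))))

    -- The number `N` of coins stays the same although steps are made. By `duration-mono` this only
    -- weakens the estimate, and it saves keeping account of the coins.
    duration-⇒ : ∀ N {κ κ′ : Config r} {t} → κ ⇒[ t ] κ′ → duration N κ ≤ ι t + duration N κ′
    duration-⇒ N {κ} {t = t} stop = ≤-by (ι t) (0≤ι t) (+-comm (ι t) (duration N κ))
    duration-⇒ zero {κ′ = κ′} {t} (move e m) = 0≤+ (0≤ι t) (duration-≥0 zero κ′)
    duration-⇒ (suc N) {κ′ = κ′} {suc t} (move {c} {K} {σ} e m) = ≤-trans (≤-reflexive (duration-move N c K σ e))
      (≤-trans (+-monoʳ-≤ 1ℚ (≤-trans (duration-⇒ N m) (+-monoʳ-≤ (ι t) (duration-mono N κ′))))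
        (≤-reflexive (sym (+-assoc 1ℚ (ι t) (duration (suc N) κ′)))))

    -- Step-indexed: some coin sequences keep the outer loop running forever, so its correctness is
    -- proved by induction on the number of coins.
    record Safe (P : Store r → Set) (N : ℕ) (κ : Config r) : Set where
      constructor safe
      field halts : ∀ M → M ℕ.≤ N → (ω : Vec Bool M) → proj₁ (run ω κ) ≡ [] → P (proj₂ (run ω κ))
    open Safe public

    safe-halted : ∀ {P N σ} → P σ → Safe P N ([] , σ)
    safe-halted {P} {N} {σ} p = safe λ M _ → go M
      where
      go : ∀ M (ω : Vec Bool M) → proj₁ (run ω ([] , σ)) ≡ [] → P (proj₂ (run ω ([] , σ)))
      go zero    []      _ = p
      go (suc M) (b ∷ ω) e = go M ω e

    safe-mono : ∀ {P N κ} → Safe P (suc N) κ → Safe P N κ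
    safe-mono s = safe λ M h → halts s M (ℕP.m≤n⇒m≤1+n h)

    safe-step : ∀ {P N c K} {σ : Store r} → (∀ b → Safe P N (step b (c ∷ K , σ))) → Safe P (suc N) (c ∷ K , σ)
    safe-step h = safe λ { zero _ [] () ; (suc M) (s≤s l) (b ∷ ω) e → halts (h b) M l ω e }

    safe-flip : ∀ {P N c K} {σ : Store r} → (∀ b → Safe P N (step b (c ∷ K , σ))) → Safe P N (c ∷ K , σ)
    safe-flip h = safe-mono (safe-step h)

    safe-⇒ : ∀ {P N} {κ κ′ : Config r} {t} → κ ⇒[ t ] κ′ → Safe P N κ′ → Safe P N κ
    safe-⇒ stop s = s
    safe-⇒ {P} {N} (move {c} {K} {σ} e m) s = safe-flip (λ b → subst (Safe P N) (sym (e b)) (safe-⇒ m s))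

  gen-body : Cmd
  gen-body = (rb ≔ `flip) ⨾ block ((tp , cons′ rb tp) ∷ (ra , tl′ ra) ∷ [])

  gen : Cmd
  gen = `while ra gen-body

  pushVec : ∀ {n} → Vec Bool n → Tree → Tree
  pushVec []      τ = τ
  pushVec (b ∷ ω) τ = pushVec ω (cons (fromBool b) τ)

  appendVec : ∀ {n} → Vec Bool n → Tree → Tree
  appendVec []      τ = τ
  appendVec (b ∷ ω) τ = cons (fromBool b) (appendVec ω τ)

  appendVec-nil : ∀ {n} (ω : Vec Bool n) → appendVec ω nil ≡ encodeVec fromBool ω
  appendVec-nil []      = refl
  appendVec-nil (b ∷ ω) = cong (cons (fromBool b)) (appendVec-nil ω)

  private
    avg-swap : ∀ h a b c d → h * (h * (a + b) + h * (c + d)) ≡ h * (h * (a + c) + h * (b + d))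
    avg-swap = solve-∀ ℚ-ring

  𝔼-snoc : ∀ L (V : Tree → ℚ) τ →
    ½ * (𝔼 L (λ ω → V (appendVec ω (cons (fromBool false) τ))) + 𝔼 L (λ ω → V (appendVec ω (cons (fromBool true) τ)))) ≡ 𝔼 (suc L) (λ ω → V (appendVec ω τ))
  𝔼-snoc zero    V τ = refl
  𝔼-snoc (suc L) V τ = trans (avg-swap ½ (H false false) (H true false) (H false true) (H true true))
    (cong₂ (λ a b → ½ * (a + b)) (𝔼-snoc L (V ∘ cons (fromBool false)) τ) (𝔼-snoc L (V ∘ cons (fromBool true)) τ))
    where
    H : Bool → Bool → ℚ
    H b b′ = 𝔼 L (λ ω → V (cons (fromBool b) (appendVec ω (cons (fromBool b′) τ))))

  -- The tape holds the coins in reverse order, which does not change its distribution.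
  𝔼-push : ∀ L (V : Tree → ℚ) τ → 𝔼 L (λ ω → V (pushVec ω τ)) ≡ 𝔼 L (λ ω → V (appendVec ω τ))
  𝔼-push zero    V τ = refl
  𝔼-push (suc L) V τ = trans (cong₂ (λ a b → ½ * (a + b)) (𝔼-push L V _) (𝔼-push L V _)) (𝔼-snoc L V τ)

  module _ (i k s c : Tree) (K : List Cmd) where

    private
      at : Tree → Tree → Tree → Config 7
      at a b τ = gen ∷ K , store i k s a b c τ

      after-flip : ∀ a b τ → (block ((tp , cons′ rb tp) ∷ (ra , tl′ ra) ∷ []) ∷ gen ∷ K , store i k s a b c τ) ⇒[ 5 ] at (tl a) b (cons b τ)
      after-flip a b τ = runs-block ((tp , cons′ rb tp) ∷ (ra , tl′ ra) ∷ []) _ (gen ∷ K)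

    -- `V` bounds what happens after the tape is written, as a function of the tape. Each coin takes
    -- eight steps: loop test, sequencing, flip and a block of five.
    gen-duration : ∀ N (V : Tree → ℚ) → (∀ b τ → duration N (K , store i k s nil b c τ) ≤ V τ) →
      ∀ L b τ → duration N (at (encodeℕ L) b τ) ≤ ι (suc (8 ℕ.* L)) + 𝔼 L (λ ω → V (pushVec ω τ))
    gen-duration N V h zero b τ = ≤-trans (duration-⇒ N {t = 1} (move (λ _ → refl) stop)) (+-monoʳ-≤ (ι 1) (h b τ))
    gen-duration N V h (suc L) b τ = ≤-trans (duration-⇒ N {t = 2} (move (λ _ → refl) (move (λ _ → refl) stop)))
        (≤-trans (+-monoʳ-≤ (ι 2) (≤-trans (duration-flip N (rb ≔ `flip) _ _) (+-monoʳ-≤ 1ℚ (*-monoˡ 0≤½ (+-mono-≤ (branch false) (branch true))))))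
          (≤-reflexive (trans (lem ½ (ι 2) (ι 5) (ι (suc (8 ℕ.* L))) (E false) (E true)) (cong₂ _+_
            (trans (cong (λ z → (ι 2 + 1ℚ) + z * (ι 5 + ι (suc (8 ℕ.* L)))) ½+½) (trans (cong (λ z → (ι 2 + 1ℚ) + z) (*-identityˡ (ι 5 + ι (suc (8 ℕ.* L)))))
              (trans (cong (λ z → (ι 2 + 1ℚ) + z) (sym (ι-+ 5 (suc (8 ℕ.* L))))) (trans (sym (ι-+ 3 (5 ℕ.+ suc (8 ℕ.* L)))) (cong ι num)))))
            refl))))
      where
      E : Bool → ℚ
      E b = 𝔼 L (λ ω → V (pushVec ω (cons (fromBool b) τ)))
      ½+½ : ½ + ½ ≡ 1ℚ
      ½+½ = refl
      num : 3 ℕ.+ (5 ℕ.+ suc (8 ℕ.* L)) ≡ suc (8 ℕ.* suc L)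
      num = trans (ℕP.+-suc 8 (8 ℕ.* L)) (cong suc (sym (ℕP.*-suc 8 L)))
      branch : ∀ b → duration N (block ((tp , cons′ rb tp) ∷ (ra , tl′ ra) ∷ []) ∷ gen ∷ K , store i k s (encodeℕ (suc L)) (fromBool b) c τ)
                   ≤ ι 5 + (ι (suc (8 ℕ.* L)) + E b)
      branch b = ≤-trans (duration-⇒ N (after-flip (encodeℕ (suc L)) (fromBool b) τ)) (+-monoʳ-≤ (ι 5) (gen-duration N V h L (fromBool b) (cons (fromBool b) τ)))
      lem : ∀ h two five g x y → two + (1ℚ + h * ((five + (g + x)) + (five + (g + y)))) ≡ ((two + 1ℚ) + (h + h) * (five + g)) + h * (x + y)
      lem = solve-∀ ℚ-ring

    gen-safe : ∀ {P N} → (∀ b τ → Safe P N (K , store i k s nil b c τ)) → ∀ L b τ → Safe P N (at (encodeℕ L) b τ)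
    gen-safe h zero    b τ = safe-⇒ {t = 1} (move (λ _ → refl) stop) (h b τ)
    gen-safe {P} {N} h (suc L) b τ = safe-⇒ {t = 2} (move (λ _ → refl) (move (λ _ → refl) stop))
      (safe-flip λ b → safe-⇒ (after-flip (encodeℕ (suc L)) (fromBool b) τ) (gen-safe h L (fromBool b) (cons (fromBool b) τ)))

-- Repeating trials until one succeeds.

module Solver where

  open Arithmetic
  open Machine
  open Algorithm
  open Runtime
  open import Data.Fin.Patterns
  open import Data.Nat as ℕ using (ℕ; zero; suc)
  import Data.Nat.Properties as ℕP
  open import Data.Rational hiding (_≟_; NonZero)
  open import Data.Rational.Properties hiding (_≟_)
  open import Tactic.RingSolver

  -- The clock starts as long as the input's spine, which covers the clauses, plus three cells,
  -- enough for the literals of a clause; `wind` then adds one cell per variable.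
  prepare fetch load unpack : Block 7
  prepare = (clk , copy io) ∷ (clk , cons′ clk clk) ∷ (clk , cons′ clk clk) ∷ (clk , cons′ clk clk) ∷ (rb , nil′) ∷ (st , cons′ io rb) ∷ (ra , hd′ io) ∷ []
  fetch   = (ra , hd′ st) ∷ (st , tl′ st) ∷ (tp , nil′) ∷ []
  load    = (st , cons′ tp st) ∷ []
  unpack  = (ra , hd′ st) ∷ (rb , tl′ ra) ∷ (ra , hd′ ra) ∷ (st , tl′ st) ∷ (st , tl′ st) ∷ []

  wind : Cmd
  wind = block ((clk , cons′ clk clk) ∷ (ra , tl′ ra) ∷ [])

  private
    succeeded : ∀ {x d B} → d ≡ 0ℚ → x ≤ ι 1 + d → x ≤ 1ℚ + (B + (- B) * 1ℚ)
    succeeded {x} {d} {B} refl h = subst (x ≤_) (lem B) h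
      where
      lem : ∀ B → (1ℚ + 0ℚ) + 0ℚ ≡ 1ℚ + (B + (- B) * 1ℚ)
      lem = solve-∀ ℚ-ring

    failed : ∀ {x B} → x ≤ B → x ≤ 1ℚ + (B + (- B) * 0ℚ)
    failed {x} {B} h = ≤-trans h (≤-by 1ℚ 0≤1 (lem B))
      where
      lem : ∀ B → 1ℚ + (B + (- B) * 0ℚ) ≡ B + 1ℚ
      lem = solve-∀ ℚ-ring

  module _ (u : Tm 1) (v : Tm 2) where

    -- The input stays at the bottom of the stack for the next attempt. Register 0 is overwritten
    -- only on success, and the failure flag in `ra` serves as the loop test.
    finish attempt solver : Cmd
    finish = block load ⨾ compile v toℕ ⨾ block unpack ⨾ `if ra (block []) (block ((io , copy rb) ∷ []))
    attempt = compile u toℕ ⨾ block fetch ⨾ gen ⨾ finish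
    solver = block prepare ⨾ `while ra wind ⨾ block ((ra , cons′ io io) ∷ []) ⨾ `while ra attempt

    program : Program
    program = record { extraRegisters = 6 ; body = solver }

    then-⇒ : ∀ {r} {c d : Command r} {t σ σ′ K} → Runs c t σ σ′ → ((c ⨾ d) ∷ K , σ) ⇒[ suc t ] (d ∷ K , σ′)
    then-⇒ {d = d} {K = K} h = move (λ _ → refl) (h (d ∷ K))

    module _ (input κ : Tree) (L : ℕ) (ok : Tree → Bool) (answer : Tree → Tree)
             (u-spec : ⟦ u ⟧ (spine κ) (λ _ → input) ≡ encodeℕ L)
             (v-spec : ∀ τ → ⟦ v ⟧ (spine κ) (lookup (τ ∷ input ∷ [])) ≡ cons (fromBool (not (ok τ))) (answer τ)) where

      private
        ℓ = spine κ

        output : Tree → Tree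
        output τ = if ok τ then answer τ else input

        head-at : Tree → Tree → Tree → Tree → Tree → Config 7
        head-at o a b c τ = `while ra attempt ∷ [] , store o κ (cons input nil) a b c τ

      start-⇒ : ∀ K a b c τ → Σ[ b′ ∈ Tree ] Σ[ c′ ∈ Tree ]
        (attempt ∷ K , store input κ (cons input nil) a b c τ) ⇒[ 10 ℕ.+ cost u toℕ ℓ ]
        (gen ∷ finish ∷ K , store input κ (cons input nil) (encodeℕ L) b′ c′ nil)
      start-⇒ K a b c τ with correct input κ τ u toℕ {cons input nil} {λ _ → input} (λ { 0F → refl }) a b c
      ... | result {a₁} {b₁} {c₁} r = b₁ , c₁ , subst (λ z → (attempt ∷ K , store input κ (cons input nil) a b c τ) ⇒[ 10 ℕ.+ T ]
            (gen ∷ finish ∷ K , store input κ (cons input nil) z b₁ c₁ nil))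
          u-spec
          (⇒-weaken (ℕP.≤-reflexive (lem T)) (⇒-trans (then-⇒ r) (⇒-trans (then-⇒ (runs-block fetch _)) (move {t = 0} (λ _ → refl) stop))))
        where
        T = cost u toℕ ℓ
        lem : ∀ T → suc T ℕ.+ (8 ℕ.+ 1) ≡ 10 ℕ.+ T
        lem T = trans (cong suc (ℕP.+-comm T 9)) refl

      finish-⇒ : ∀ K b c τ → Σ[ b′ ∈ Tree ] Σ[ c′ ∈ Tree ]
        (finish ∷ K , store input κ (cons input nil) nil b c τ) ⇒[ 25 ℕ.+ cost v toℕ ℓ ]
        (K , store (output τ) κ (cons input nil) (fromBool (not (ok τ))) b′ c′ τ)
      finish-⇒ K b c τ with correct input κ τ v toℕ {cons τ (cons input nil)} {lookup (τ ∷ input ∷ [])} (λ { 0F → refl ; 1F → refl }) nil b c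
      ... | result {a₁} {b₁} {c₁} r = answer τ , c₁ , ⇒-weaken (ℕP.≤-reflexive (lem T))
          (⇒-trans (then-⇒ (runs-block load _)) (⇒-trans (then-⇒ r) (⇒-trans
            (subst (λ z → ((block unpack ⨾ `if ra (block []) (block ((io , copy rb) ∷ []))) ∷ K , store input κ (cons (⟦ v ⟧ ℓ γ) (cons τ (cons input nil))) a₁ b₁ c₁ τ) ⇒[ 12 ]
                     (`if ra (block []) (block ((io , copy rb) ∷ [])) ∷ K , store input κ (cons input nil) (hd z) (tl z) c₁ τ))
              (v-spec τ) (then-⇒ (runs-block unpack _)))
            (branch (ok τ)))))
        where
        γ : Env 2
        γ = lookup (τ ∷ input ∷ [])
        T = cost v toℕ ℓ
        branch : ∀ b → (`if ra (block []) (block ((io , copy rb) ∷ [])) ∷ K , store input κ (cons input nil) (fromBool (not b)) (answer τ) c₁ τ) ⇒[ 8 ]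
          (K , store (if b then answer τ else input) κ (cons input nil) (fromBool (not b)) (answer τ) c₁ τ)
        branch true  = move (λ _ → refl) (⇒-weaken (ℕP.m≤m+n 3 4) (runs-block ((io , copy rb) ∷ []) _ K))
        branch false = move (λ _ → refl) (⇒-weaken (ℕP.m≤m+n 1 6) (runs-block [] _ K))
        lem : ∀ T → 4 ℕ.+ (suc T ℕ.+ (12 ℕ.+ 8)) ≡ 25 ℕ.+ T
        lem T = trans (cong (5 ℕ.+_) (ℕP.+-comm T 20)) refl

      chance-of-success : ℚ
      chance-of-success = 𝔼 L (λ ω → indicator (ok (encodeVec fromBool ω)))

      module _ (B : ℚ) (0≤B : 0ℚ ≤ B) (T₁ T₂ T₃ : ℕ) (T₂-def : suc (8 ℕ.* L) ≡ T₂)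
               (starts : ∀ K a b c τ → Σ[ b′ ∈ Tree ] Σ[ c′ ∈ Tree ]
                 (attempt ∷ K , store input κ (cons input nil) a b c τ) ⇒[ T₁ ] (gen ∷ finish ∷ K , store input κ (cons input nil) (encodeℕ L) b′ c′ nil))
               (finishes : ∀ K b c τ → Σ[ b′ ∈ Tree ] Σ[ c′ ∈ Tree ]
                 (finish ∷ K , store input κ (cons input nil) nil b c τ) ⇒[ T₃ ] (K , store (output τ) κ (cons input nil) (fromBool (not (ok τ))) b′ c′ τ))
               (enough : ι (T₁ ℕ.+ (T₂ ℕ.+ T₃) ℕ.+ 2) ≤ chance-of-success * B) where

        -- `B` is a potential: one attempt, the two loop tests included, takes at most
        -- `chance-of-success * B` steps, and only a failure leaves a further expected `B`. The
        -- induction on `N` works because the loop test uses up a coin.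
        head-duration : ∀ N a a′ b c τ → duration N (head-at input (cons a a′) b c τ) ≤ B
        head-duration zero    a a′ b c τ = 0≤B
        head-duration (suc N) a a′ b c τ = ≤-trans (≤-reflexive (duration-move N (`while ra attempt) [] (store input κ (cons input nil) (cons a a′) b c τ) (λ _ → refl)))
            (≤-trans (+-monoʳ-≤ 1ℚ (≤-trans (duration-⇒ N m) (+-monoʳ-≤ (ι T₁)
              (≤-trans (subst (λ t → duration N (gen ∷ finish ∷ `while ra attempt ∷ [] , store input κ (cons input nil) (encodeℕ L) b₁ c₁ nil) ≤ ι t + 𝔼 L (λ ω → V (pushVec ω nil))) T₂-def
                (gen-duration input κ (cons input nil) c₁ (finish ∷ `while ra attempt ∷ []) N V finish-V L b₁ nil)) (+-monoʳ-≤ (ι T₂) expect)))))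
            (subst (_≤ B) (sym (lem₁ (ι T₁) (ι T₂) (ι T₃) B q)) (subst (λ z → z + (B - q * B) ≤ B) sums final)))
          where
          q = chance-of-success
          started = starts (`while ra attempt ∷ []) (cons a a′) b c τ
          b₁ = proj₁ started
          c₁ = proj₁ (proj₂ started)
          m = proj₂ (proj₂ started)
          V : Tree → ℚ
          V τ = ι T₃ + (1ℚ + (B + (- B) * indicator (ok τ)))
          finish-V : ∀ b τ → duration N (finish ∷ `while ra attempt ∷ [] , store input κ (cons input nil) nil b c₁ τ) ≤ V τ
          finish-V b τ = ≤-trans (duration-⇒ N m′) (+-monoʳ-≤ (ι T₃) (next (ok τ)))
            where
            finished = finishes (`while ra attempt ∷ []) b c₁ τ
            b₂ = proj₁ finished
            c₂ = proj₁ (proj₂ finished)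
            m′ = proj₂ (proj₂ finished)
            next : ∀ o → duration N (head-at (if o then answer τ else input) (fromBool (not o)) b₂ c₂ τ) ≤ 1ℚ + (B + (- B) * indicator o)
            next true = succeeded {B = B} (duration-halted N (store (answer τ) κ (cons input nil) nil b₂ c₂ τ)) (duration-⇒ N {t = 1} (move (λ _ → refl) stop))
            next false = failed {B = B} (head-duration N nil nil b₂ c₂ τ)
          module F = Functional (𝔼-functional L)
          expect : 𝔼 L (λ ω → V (pushVec ω nil)) ≤ ι T₃ + (1ℚ + (B + (- B) * q))
          expect = ≤-reflexive (trans (𝔼-push L V nil) (trans (F.ext (λ ω → cong V (appendVec-nil ω)))
            (trans (F.add (λ _ → ι T₃) (λ ω → 1ℚ + (B + (- B) * i ω))) (cong₂ _+_ (𝔼-const L (ι T₃))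
              (trans (F.add (λ _ → 1ℚ) (λ ω → B + (- B) * i ω)) (cong₂ _+_ (𝔼-const L 1ℚ)
                (trans (F.add (λ _ → B) (λ ω → (- B) * i ω)) (cong₂ _+_ (𝔼-const L B) (F.scale (- B) i)))))))))
            where
            i : Vec Bool L → ℚ
            i ω = indicator (ok (encodeVec fromBool ω))
          lem₁ : ∀ a b c B q → 1ℚ + (a + (b + (c + (1ℚ + (B + (- B) * q))))) ≡ ((a + (b + c)) + (1ℚ + (1ℚ + 0ℚ))) + (B - q * B)
          lem₁ = solve-∀ ℚ-ring
          sums : ι (T₁ ℕ.+ (T₂ ℕ.+ T₃) ℕ.+ 2) ≡ (ι T₁ + (ι T₂ + ι T₃)) + (1ℚ + (1ℚ + 0ℚ))
          sums = trans (ι-+ (T₁ ℕ.+ (T₂ ℕ.+ T₃)) 2) (cong (_+ ι 2) (trans (ι-+ T₁ (T₂ ℕ.+ T₃)) (cong (λ z → ι T₁ + z) (ι-+ T₂ T₃))))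
          final : ι (T₁ ℕ.+ (T₂ ℕ.+ T₃) ℕ.+ 2) + (B - q * B) ≤ B
          final = ≤-trans (+-monoˡ-≤ (B - q * B) enough) (≤-reflexive (lem₃ (q * B) B))
            where
            lem₃ : ∀ x B → x + (B - x) ≡ B
            lem₃ = solve-∀ ℚ-ring

      -- The loop can be left only after an attempt with `ok τ`.
      head-safe : ∀ {P} → (∀ τ b c → ok τ ≡ true → P (store (answer τ) κ (cons input nil) nil b c τ)) →
        ∀ N a a′ b c τ → Safe P N (head-at input (cons a a′) b c τ)
      head-safe h zero    a a′ b c τ = safe λ { zero _ [] () }
      head-safe {P} h (suc N) a a′ b c τ with start-⇒ (`while ra attempt ∷ []) (cons a a′) b c τ
      ... | b₁ , c₁ , m = safe-step λ _ → safe-⇒ m (gen-safe input κ (cons input nil) c₁ (finish ∷ `while ra attempt ∷ []) after L b₁ nil)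
        where
        after : ∀ b τ → Safe P N (finish ∷ `while ra attempt ∷ [] , store input κ (cons input nil) nil b c₁ τ)
        after b τ with finish-⇒ (`while ra attempt ∷ []) b c₁ τ
        ... | b₂ , c₂ , m′ = safe-⇒ m′ (next (ok τ) refl)
          where
          next : ∀ o → ok τ ≡ o → Safe P N (head-at (if o then answer τ else input) (fromBool (not o)) b₂ c₂ τ)
          next true  e = safe-⇒ {t = 1} (move (λ _ → refl) stop) (safe-halted (h τ b₂ c₂ e))
          next false e = head-safe h N nil nil b₂ c₂ τ

    clock : Tree → Tree → Tree
    clock κ nil        = κ
    clock κ (cons _ t) = clock (cons κ κ) t

    spine-clock : ∀ κ t → spine (clock κ t) ≡ spine t ℕ.+ spine κ
    spine-clock κ nil        = refl
    spine-clock κ (cons _ t) = trans (spine-clock (cons κ κ) t) (ℕP.+-suc (spine t) (spine κ))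

    wind-⇒ : ∀ i s c τ K κ a b → (`while ra wind ∷ K , store i κ s a b c τ) ⇒[ suc (6 ℕ.* spine a) ] (K , store i (clock κ a) s nil b c τ)
    wind-⇒ i s c τ K κ nil        b = move (λ _ → refl) stop
    wind-⇒ i s c τ K κ (cons x a) b = ⇒-weaken (ℕP.≤-reflexive (lem (spine a)))
      (move (λ _ → refl) (⇒-trans (runs-block ((clk , cons′ clk clk) ∷ (ra , tl′ ra) ∷ []) _ (`while ra wind ∷ K)) (wind-⇒ i s c τ K (cons κ κ) a b)))
      where
      lem : ∀ m → suc (5 ℕ.+ suc (6 ℕ.* m)) ≡ suc (6 ℕ.* suc m)
      lem m = cong suc (trans (ℕP.+-suc 5 (6 ℕ.* m)) (sym (ℕP.*-suc 6 m)))

    initial-clock : Tree → Tree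
    initial-clock t = let t₁ = cons t t ; t₂ = cons t₁ t₁ in clock (cons t₂ t₂) (hd t)

    program-⇒ : ∀ t → start program t ⇒[ 22 ℕ.+ 6 ℕ.* spine (hd t) ]
      (`while ra attempt ∷ [] , store t (initial-clock t) (cons t nil) (cons t t) nil nil nil)
    program-⇒ t = ⇒-weaken (ℕP.≤-reflexive (lem (6 ℕ.* spine (hd t)))) (⇒-trans (then-⇒ (runs-block prepare _))
      (move (λ _ → refl) (⇒-trans (wind-⇒ t (cons t nil) nil nil _ _ (hd t) nil) (then-⇒ (runs-block ((ra , cons′ io io) ∷ []) _)))))
      where
      lem : ∀ x → 16 ℕ.+ suc (suc x ℕ.+ 4) ≡ 22 ℕ.+ x
      lem x = cong (18 ℕ.+_) (ℕP.+-comm x 4)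

-- Polynomial bounds, and their domination by exponentials.

module Polynomials where

  open Arithmetic
  open Machine
  open LowerBound using (bernoulli-+)
  open import Data.Integer using (+_)
  open import Data.Nat as ℕ using (ℕ; zero; suc; s≤s)
  import Data.Nat.Properties as ℕP
  open import Data.Rational hiding (_≟_; NonZero)
  open import Data.Rational.Properties hiding (_≟_)
  import Function.Related.Propositional as Related
  open import Tactic.RingSolver

  -- The base `suc x` is at least 1, so degrees may be raised freely when bounds are added.
  record Polynomial (f : ℕ → ℕ) : Set where
    constructor polynomial
    field
      coefficient degree : ℕ
      bounds : ∀ x → f x ℕ.≤ coefficient ℕ.* suc x ℕ.^ degree
  open Polynomial public

  poly-const : ∀ c → Polynomial (λ _ → c)
  poly-const c = polynomial c 0 λ x → ℕP.≤-reflexive (sym (ℕP.*-identityʳ c))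

  poly-id : Polynomial id
  poly-id = polynomial 1 1 λ x → ℕP.≤-trans (ℕP.n≤1+n x) (ℕP.≤-reflexive (sym (trans (ℕP.*-identityˡ (suc x ℕ.* 1)) (ℕP.*-identityʳ (suc x)))))

  poly-+ : ∀ {f g} → Polynomial f → Polynomial g → Polynomial (λ x → f x ℕ.+ g x)
  poly-+ (polynomial a d h) (polynomial b e k) = polynomial (a ℕ.+ b) (d ℕ.+ e) λ x → ℕP.≤-trans
    (ℕP.+-mono-≤ (ℕP.≤-trans (h x) (ℕP.*-monoʳ-≤ a (ℕP.^-monoʳ-≤ (suc x) (ℕP.m≤m+n d e))))
                 (ℕP.≤-trans (k x) (ℕP.*-monoʳ-≤ b (ℕP.^-monoʳ-≤ (suc x) (ℕP.m≤n+m e d)))))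
    (ℕP.≤-reflexive (sym (ℕP.*-distribʳ-+ (suc x ℕ.^ (d ℕ.+ e)) a b)))

  poly-* : ∀ {f g} → Polynomial f → Polynomial g → Polynomial (λ x → f x ℕ.* g x)
  poly-* (polynomial a d h) (polynomial b e k) = polynomial (a ℕ.* b) (d ℕ.+ e) λ x → ℕP.≤-trans (ℕP.*-mono-≤ (h x) (k x))
    (ℕP.≤-reflexive (trans (ℕP.[m*n]*[o*p]≡[m*o]*[n*p] a (suc x ℕ.^ d) b (suc x ℕ.^ e))
      (cong (a ℕ.* b ℕ.*_) (sym (ℕP.^-distribˡ-+-* (suc x) d e)))))

  poly-≤ : ∀ {f g} → (∀ x → f x ℕ.≤ g x) → Polynomial g → Polynomial f
  poly-≤ h (polynomial a d k) = polynomial a d λ x → ℕP.≤-trans (h x) (k x)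

  loop-cost-≤ : ∀ ℓ t → loop-cost ℓ t ℕ.≤ 1 ℕ.+ ℓ ℕ.* (1 ℕ.+ t)
  loop-cost-≤ zero    t = ℕP.≤-refl
  loop-cost-≤ (suc ℓ) t = s≤s (ℕP.≤-trans (ℕP.+-monoʳ-≤ t (loop-cost-≤ ℓ t)) (ℕP.≤-reflexive (ℕP.+-suc t (ℓ ℕ.* (1 ℕ.+ t)))))

  -- Nested folds multiply, and `refutedₜ` nests at least two more per level; the bound is
  -- polynomial because the depth is fixed when the term is built.
  cost-poly : ∀ {Γ} (u : Tm Γ) ρ → Polynomial (cost u ρ)
  cost-poly (get i)      ρ = poly-const (10 ℕ.+ 2 ℕ.* ρ i)
  cost-poly nil          ρ = poly-const 5
  cost-poly (cons u v)   ρ = poly-+ (poly-+ (poly-const 20) (cost-poly u ρ)) (cost-poly v (suc ∘ ρ))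
  cost-poly (head u)     ρ = poly-+ (poly-const 20) (cost-poly u ρ)
  cost-poly (tail u)     ρ = poly-+ (poly-const 20) (cost-poly u ρ)
  cost-poly (cond w u v) ρ = poly-+ (poly-+ (poly-const 20) (cost-poly w ρ)) (poly-+ (cost-poly u ρ) (cost-poly v ρ))
  cost-poly (bind u v)   ρ = poly-+ (poly-+ (poly-const 20) (cost-poly u ρ)) (cost-poly v (bind-positions ρ))
  cost-poly (fold u v w) ρ = poly-+ (poly-+ (poly-+ (poly-const 40) (cost-poly u (suc ∘ ρ))) (cost-poly v (λ i → 2 ℕ.+ ρ i)))
    (poly-≤ (λ ℓ → loop-cost-≤ ℓ (80 ℕ.+ cost w (body-positions ρ) ℓ))
      (poly-+ (poly-const 1) (poly-* poly-id (poly-+ (poly-const 1) (poly-+ (poly-const 80) (cost-poly w (body-positions ρ)))))))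
  cost-poly (ren f u)    ρ = cost-poly u (ρ ∘ f)

  module _ {n : ℕ} where

    code-literal : Maybe (Literal n) → Fin (suc (n ℕ.* 2))
    code-literal nothing        = zero
    code-literal (just (x , b)) = suc (Fin.combine x (if b then suc zero else zero))

    code-literal-injective : ∀ {l m} → code-literal l ≡ code-literal m → l ≡ m
    code-literal-injective {nothing} {nothing} _ = refl
    code-literal-injective {just (x , b)} {just (y , c)} e with combine-injective x (bit b) y (bit c) (suc-injective e)
      where
      bit : Bool → Fin 2
      bit b = if b then suc zero else zero
    code-literal-injective {just (x , true)}  {just (.x , true)}  e | refl , _ = refl
    code-literal-injective {just (x , false)} {just (.x , false)} e | refl , _ = refl

    s : ℕ
    s = suc (n ℕ.* 2)

    pad : List (Literal n) → Maybe (Literal n) × Maybe (Literal n) × Maybe (Literal n)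
    pad []              = nothing , nothing , nothing
    pad (a ∷ [])        = just a , nothing , nothing
    pad (a ∷ b ∷ [])    = just a , just b , nothing
    pad (a ∷ b ∷ c ∷ _) = just a , just b , just c

    pad-injective : ∀ {C D} → length C ℕ.≤ 3 → length D ℕ.≤ 3 → pad C ≡ pad D → C ≡ D
    pad-injective {[]} {[]} _ _ _ = refl
    pad-injective {a ∷ []} {.a ∷ []} _ _ refl = refl
    pad-injective {a ∷ b ∷ []} {.a ∷ .b ∷ []} _ _ refl = refl
    pad-injective {a ∷ b ∷ c ∷ []} {.a ∷ .b ∷ .c ∷ []} _ _ refl = refl
    pad-injective {_ ∷ _ ∷ _ ∷ _ ∷ _} (s≤s (s≤s (s≤s ()))) _ _
    pad-injective {_} {_ ∷ _ ∷ _ ∷ _ ∷ _} _ (s≤s (s≤s (s≤s ()))) _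
    pad-injective {[]} {_ ∷ []} _ _ ()
    pad-injective {[]} {_ ∷ _ ∷ []} _ _ ()
    pad-injective {[]} {_ ∷ _ ∷ _ ∷ []} _ _ ()
    pad-injective {_ ∷ []} {[]} _ _ ()
    pad-injective {_ ∷ []} {_ ∷ _ ∷ []} _ _ ()
    pad-injective {_ ∷ []} {_ ∷ _ ∷ _ ∷ []} _ _ ()
    pad-injective {_ ∷ _ ∷ []} {[]} _ _ ()
    pad-injective {_ ∷ _ ∷ []} {_ ∷ []} _ _ ()
    pad-injective {_ ∷ _ ∷ []} {_ ∷ _ ∷ _ ∷ []} _ _ ()
    pad-injective {_ ∷ _ ∷ _ ∷ []} {[]} _ _ ()
    pad-injective {_ ∷ _ ∷ _ ∷ []} {_ ∷ []} _ _ ()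
    pad-injective {_ ∷ _ ∷ _ ∷ []} {_ ∷ _ ∷ []} _ _ ()

    code : List (Literal n) → Fin (s ℕ.* (s ℕ.* s))
    code C = let (a , b , c) = pad C in Fin.combine (code-literal a) (Fin.combine (code-literal b) (code-literal c))

    code-injective : ∀ {C D} → length C ℕ.≤ 3 → length D ℕ.≤ 3 → code C ≡ code D → C ≡ D
    code-injective {C} {D} h k e with pad C in p | pad D in q
    ... | a , b , c | a′ , b′ , c′ with combine-injective (code-literal a) _ (code-literal a′) _ e
    ...   | e₁ , e₂₃ with combine-injective (code-literal b) _ (code-literal b′) _ e₂₃
    ...     | e₂ , e₃ = pad-injective h k (trans p (trans (cong₂ _,_ (code-literal-injective e₁)
                          (cong₂ _,_ (code-literal-injective e₂) (code-literal-injective e₃))) (sym q)))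

    pairwise : ∀ {A : Set} {R : A → A → Set} {xs : List A} → AllPairs R xs → ∀ i j → i Fin.< j →
               R (Data.List.lookup xs i) (Data.List.lookup xs j)
    pairwise (h ∷ _)  zero    (suc j) _       = All.lookup h (∈-lookup j)
    pairwise (_ ∷ hs) (suc i) (suc j) (s≤s l) = pairwise hs i j l

    -- Clauses that differ as sets differ as lists, and a list of at most three literals, padded, is
    -- a triple over 2n + 1 symbols. The pigeonhole principle does the rest.
    clauses-≤ : ∀ {cs : List (Clause n)} → AllPairs (λ c d → ¬ SameClause c d) cs → All (λ c → length (literals c) ℕ.≤ 3) cs →
                length cs ℕ.≤ s ℕ.* (s ℕ.* s)
    clauses-≤ {cs} distinct 3cnf with ℕP.≤-total (length cs) (s ℕ.* (s ℕ.* s)) | ℕP.<-≤-connex (s ℕ.* (s ℕ.* s)) (length cs)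
    ... | inj₁ le | _ = le
    ... | inj₂ _  | inj₂ le = le
    ... | inj₂ _  | inj₁ lt with pigeonhole lt (λ i → code (literals (Data.List.lookup cs i)))
    ...   | i , j , i<j , e = ⊥-elim (pairwise distinct i j i<j (Related.≡⇒ (cong (_ ∈_) (code-injective (at i) (at j) e))))
      where
      at : ∀ i → length (literals (Data.List.lookup cs i)) ℕ.≤ 3
      at i = All.lookup 3cnf (∈-lookup i)

  private
    square-≤ : ∀ t → (1ℚ + t) * (1ℚ + t) ≡ (1ℚ + (1ℚ + 1ℚ) * t) + t * t
    square-≤ = solve-∀ ℚ-ring

  -- Induction on `e` with t = η / 3. By Bernoulli's inequality one factor n + 1 is at most (1 +
  -- 1/t)(1 + t)^n, the others are bounded by induction with t, and (1 + t)² ≤ 1 + 3 t = 1 + η. The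
  -- argument `i` carries the reciprocal of `η`.
  dominated : ∀ e η i → 0ℚ ≤ η → η ≤ 1ℚ → 0ℚ ≤ i → i * η ≡ 1ℚ →
              Σ[ C ∈ ℚ ] (0ℚ ≤ C × (∀ n → ι (suc n) ^ e ≤ C * (1ℚ + η) ^ n))
  dominated zero η i 0≤η η≤1 0≤i iη = 1ℚ , 0≤1 , λ n → ≤-trans (≤-trans (≤-reflexive (sym (1^ n))) (^-mono n 0≤1 (≤-by η 0≤η refl)))
    (≤-reflexive (sym (*-identityˡ ((1ℚ + η) ^ n))))
  dominated (suc e) η i 0≤η η≤1 0≤i iη = (1ℚ + i′) * C , 0≤* (0≤+ 0≤1 0≤i′) 0≤C , λ n → ≤-trans
      (*-mono (0≤ι (suc n)) (0≤* 0≤C (^-≥0 n 0≤1+t)) (linear n) (h n))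
      (≤-trans (≤-reflexive (lem₁ (1ℚ + i′) C ((1ℚ + t) ^ n))) (*-monoˡ (0≤* (0≤+ 0≤1 0≤i′) 0≤C)
        (≤-trans (≤-reflexive (sym (^-distrib-* (1ℚ + t) (1ℚ + t) n))) (^-mono n (0≤* 0≤1+t 0≤1+t) square))))
    where
    t = + 1 / 3 * η
    i′ = + 3 / 1 * i
    0≤t : 0ℚ ≤ t
    0≤t = 0≤* {+ 1 / 3} (≤ᵇ⇒≤ _) 0≤η
    0≤1+t = 0≤+ 0≤1 0≤t
    t≤η : t ≤ η
    t≤η = subst (t ≤_) (*-identityˡ η) (*-monoʳ {η} {+ 1 / 3} {1ℚ} 0≤η (≤ᵇ⇒≤ _))
    0≤i′ : 0ℚ ≤ i′
    0≤i′ = 0≤* {+ 3 / 1} (≤ᵇ⇒≤ _) 0≤i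
    swap : ∀ a b c d → (a * b) * (c * d) ≡ (a * c) * (b * d)
    swap = solve-∀ ℚ-ring
    i′t : i′ * t ≡ 1ℚ
    i′t = trans (swap (+ 3 / 1) i (+ 1 / 3) η) (trans (cong (λ z → (+ 3 / 1) * (+ 1 / 3) * z) iη) refl)
    rec = dominated e t i′ 0≤t (≤-trans t≤η η≤1) 0≤i′ i′t
    C = proj₁ rec
    0≤C = proj₁ (proj₂ rec)
    h = proj₂ (proj₂ rec)
    lem₁ : ∀ a c x → (a * x) * (c * x) ≡ (a * c) * (x * x)
    lem₁ = solve-∀ ℚ-ring
    lem₂ : ∀ i t n → (1ℚ + i) * (1ℚ + n * t) ≡ (1ℚ + (i * t) * n) + (i + n * t)
    lem₂ = solve-∀ ℚ-ring
    linear : ∀ n → ι (suc n) ≤ (1ℚ + i′) * (1ℚ + t) ^ n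
    linear n = ≤-trans (≤-by (i′ + ι n * t) (0≤+ 0≤i′ (0≤* (0≤ι n) 0≤t))
        (trans (lem₂ i′ t (ι n)) (cong (λ z → (1ℚ + z) + (i′ + ι n * t)) (trans (cong (_* ι n) i′t) (*-identityˡ (ι n))))))
      (*-monoˡ (0≤+ 0≤1 0≤i′) (bernoulli-+ n 0≤t))
    t+t+t : (1ℚ + (1ℚ + 1ℚ)) * t ≡ η
    t+t+t = trans (sym (*-assoc (+ 3 / 1) (+ 1 / 3) η)) (*-identityˡ η)
    square : (1ℚ + t) * (1ℚ + t) ≤ 1ℚ + η
    square = ≤-trans (≤-reflexive (square-≤ t)) (≤-trans (+-monoʳ-≤ (1ℚ + (1ℚ + 1ℚ) * t) (≤-trans (*-monoˡ 0≤t (≤-trans t≤η η≤1)) (≤-reflexive (*-identityʳ t))))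
      (≤-reflexive (trans (lem₃ t) (cong (λ z → 1ℚ + z) t+t+t))))
      where
      lem₃ : ∀ t → (1ℚ + (1ℚ + 1ℚ) * t) + t ≡ 1ℚ + (1ℚ + (1ℚ + 1ℚ)) * t
      lem₃ = solve-∀ ℚ-ring

-- The program, its correctness and its expected running time.

open Arithmetic
open Refutation
open Spending using (rounds)
open Trials using (tape)
open LowerBound
open Parameters
open Machine
open Algorithm
open Trial
open Runtime
open Solver
open Polynomials
open import Data.Integer using (+_)
import Data.List.Relation.Unary.All.Properties as All
import Data.List.Relation.Unary.Any.Properties as Any
open import Data.Nat as ℕ using (ℕ; zero; suc; s≤s)
import Data.Nat.Properties as ℕP
open import Data.Nat.Tactic.RingSolver using () renaming (solve-∀ to solve-ℕ)
open import Data.Rational hiding (_≟_; NonZero)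
open import Data.Rational.Properties hiding (_≟_)
open import Data.Vec using (replicate)
open import Tactic.RingSolver

[m*n]^k : ∀ m n k → (m ℕ.* n) ℕ.^ k ≡ m ℕ.^ k ℕ.* n ℕ.^ k
[m*n]^k m n zero    = refl
[m*n]^k m n (suc k) = trans (cong (m ℕ.* n ℕ.*_) ([m*n]^k m n k)) (ℕP.[m*n]*[o*p]≡[m*o]*[n*p] m n (m ℕ.^ k) (n ℕ.^ k))

models-complete : ∀ {n} {Φ : Formula n} {α} → Models α Φ → models Φ α ≡ true
models-complete {α = α} m = to T-≡ (All.all⁻ _ (All.map (λ c → Any.any⁺ _ (Any.map (λ {l} e → fromWitness {a? = lookup α (var l) ≟ᵇ proj₂ l} e) c)) m))

models-sound : ∀ {n} {Φ : Formula n} {α} → models Φ α ≡ true → Models α Φ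
models-sound {Φ = Φ} {α} e = All.map (λ {C} t → Any.map (λ {l} → toWitness {a? = lookup α (var l) ≟ᵇ proj₂ l}) (Any.any⁻ (true? α) C t)) (All.all⁺ _ Φ (from T-≡ e))

module _ {b η : ℚ} (𝒞 : Constants b η) where
  open Constants 𝒞

  u : Tm 1
  u = counterₜ (suc (R ℕ.* suc k))

  v : Tm 2
  v = trialₜ d k R

  ppsz : Program
  ppsz = program u v

  attempt-steps : ℕ → ℕ → ℕ
  attempt-steps L ℓ = (10 ℕ.+ cost u toℕ ℓ) ℕ.+ (suc (8 ℕ.* L) ℕ.+ (25 ℕ.+ cost v toℕ ℓ)) ℕ.+ 2

  steps : ℕ → ℕ → ℕ
  steps L ℓ = attempt-steps L ℓ ℕ.+ (22 ℕ.+ 6 ℕ.* ℓ)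

  steps-poly : Polynomial (λ ℓ → steps (ℓ ℕ.* suc (R ℕ.* suc k)) ℓ)
  steps-poly = poly-+ (poly-+ (poly-+ (poly-+ (poly-const 10) (cost-poly u toℕ))
      (poly-+ (poly-+ (poly-const 1) (poly-* (poly-const 8) (poly-* poly-id (poly-const (suc (R ℕ.* suc k))))))
        (poly-+ (poly-const 25) (cost-poly v toℕ)))) (poly-const 2))
    (poly-+ (poly-const 22) (poly-* (poly-const 6) poly-id))

  steps-≤ : ∀ {L L′ ℓ} → L ℕ.≤ L′ → steps L ℓ ℕ.≤ steps L′ ℓ
  steps-≤ {ℓ = ℓ} h = ℕP.+-monoˡ-≤ (22 ℕ.+ 6 ℕ.* ℓ) (ℕP.+-monoˡ-≤ 2 (ℕP.+-monoʳ-≤ (10 ℕ.+ cost u toℕ ℓ)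
    (ℕP.+-monoˡ-≤ (25 ℕ.+ cost v toℕ ℓ) (s≤s (ℕP.*-monoʳ-≤ 8 h)))))

  module _ {n : ℕ} (F : CNF n) (3cnf : Is3CNF F) where

    formula : Formula n
    formula = map literals (clauses F)

    3cnf′ : All (λ C → length C ℕ.≤ 3) formula
    3cnf′ = All.map⁺ 3cnf

    input : Tree
    input = cons (encodeℕ n) (encodeFormula formula)

    encode-input : encodeCNF F ≡ input
    encode-input = cong (λ z → cons (encodeℕ n) (encodeList z)) (map-∘ (clauses F))

    spine-encodeList : ∀ ts → spine (encodeList ts) ≡ length ts
    spine-encodeList []       = refl
    spine-encodeList (_ ∷ ts) = cong suc (spine-encodeList ts)

    spine-encodeℕ : ∀ m → spine (encodeℕ m) ≡ m
    spine-encodeℕ zero    = refl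
    spine-encodeℕ (suc m) = cong suc (spine-encodeℕ m)

    κ₀ : Tree
    κ₀ = initial-clock u v input

    ℓ₀ : ℕ
    ℓ₀ = n ℕ.+ (4 ℕ.+ length formula)

    spine-κ₀ : spine κ₀ ≡ ℓ₀
    spine-κ₀ = trans (spine-clock u v _ (encodeℕ n))
      (cong₂ (λ a c → a ℕ.+ (4 ℕ.+ c)) (spine-encodeℕ n) (trans (spine-encodeList (map encodeLiterals formula)) (length-map encodeLiterals formula)))

    -- The polynomial added in the proof is the difference between 14 (n + 1)^3 and n + 5 + (2n +
    -- 1)^3.
    ℓ₀-≤ : suc ℓ₀ ℕ.≤ 14 ℕ.* suc n ℕ.^ 3
    ℓ₀-≤ = ℕP.≤-trans (s≤s (ℕP.+-monoʳ-≤ n (ℕP.+-monoʳ-≤ 4 (subst (ℕ._≤ m ℕ.* (m ℕ.* m)) (sym (length-map literals (clauses F))) (clauses-≤ (distinctClauses F) 3cnf)))))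
        (ℕP.≤-trans (ℕP.m≤m+n (suc (n ℕ.+ (4 ℕ.+ m ℕ.* (m ℕ.* m)))) (6 ℕ.* (n ℕ.* (n ℕ.* n)) ℕ.+ 30 ℕ.* (n ℕ.* n) ℕ.+ 35 ℕ.* n ℕ.+ 8))
          (ℕP.≤-reflexive (lem n)))
      where
      m = suc (n ℕ.* 2)
      lem : ∀ n → (1 ℕ.+ (n ℕ.+ (4 ℕ.+ (1 ℕ.+ n ℕ.* 2) ℕ.* ((1 ℕ.+ n ℕ.* 2) ℕ.* (1 ℕ.+ n ℕ.* 2))))) ℕ.+ (6 ℕ.* (n ℕ.* (n ℕ.* n)) ℕ.+ 30 ℕ.* (n ℕ.* n) ℕ.+ 35 ℕ.* n ℕ.+ 8)
        ≡ 14 ℕ.* ((1 ℕ.+ n) ℕ.* ((1 ℕ.+ n) ℕ.* ((1 ℕ.+ n) ℕ.* 1)))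
      lem = solve-ℕ

    L : ℕ
    L = tape k (rounds n R)

    ok : Tree → Bool
    ok τ = models formula (outcome formula d k R τ)

    answer : Tree → Tree
    answer τ = encodeAssignment (outcome formula d k R τ)

    n≤ : n ℕ.≤ spine κ₀
    n≤ = subst (n ℕ.≤_) (sym spine-κ₀) (ℕP.m≤m+n n (4 ℕ.+ length formula))

    u-spec : ⟦ u ⟧ (spine κ₀) (λ _ → input) ≡ encodeℕ L
    u-spec = trans (counterₜ-spec {spine κ₀} {λ _ → input} (suc (R ℕ.* suc k)) n n≤ refl) (cong encodeℕ (sym (tape-rounds n k R)))

    v-spec : ∀ τ → ⟦ v ⟧ (spine κ₀) (lookup (τ ∷ input ∷ [])) ≡ cons (fromBool (not (ok τ))) (answer τ)
    v-spec τ = trialₜ-spec formula n≤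
      (subst (3 ℕ.≤_) (sym spine-κ₀) (ℕP.≤-trans (ℕP.m≤m+n 3 (suc (length formula))) (ℕP.m≤n+m (4 ℕ.+ length formula) n)))
      (subst (length formula ℕ.≤_) (sym spine-κ₀) (ℕP.≤-trans (ℕP.m≤n+m (length formula) 4) (ℕP.m≤n+m (4 ℕ.+ length formula) n)))
      3cnf′ d k R (lookup (τ ∷ input ∷ [])) refl

    Solved : Store 7 → Set
    Solved σ = ∃[ α ] (α Satisfies F × lookup σ zero ≡ encodeAssignment α)

    ppsz-correct : FindsSatisfyingAssignment ppsz F
    ppsz-correct N ω = halts (subst (λ t → Safe Solved N (start ppsz t)) (sym encode-input)
      (safe-⇒ (program-⇒ u v input)
        (head-safe u v input κ₀ L ok answer u-spec v-spec {Solved} solved N input input nil nil nil))) N ℕP.≤-refl ω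
      where
      solved : ∀ τ b c → ok τ ≡ true → Solved (store (answer τ) κ₀ (cons input nil) nil b c τ)
      solved τ b c e = outcome formula d k R τ , All.map⁻ (models-sound {Φ = formula} {outcome formula d k R τ} e) , refl

    q₀ : ℚ
    q₀ = chance-of-success u v input κ₀ L ok answer u-spec v-spec

    q₀-lower : Satisfiable F → μ ^ (K ℕ.* suc n) ≤ q₀
    q₀-lower (α , sat) = ≤-trans
      (success-lower 𝒞 formula 3cnf′ (indicator ∘ models formula) (λ β → 0≤indicator (models formula β))
        (λ β m → ≤-reflexive (cong indicator (sym (models-complete {Φ = formula} {β} m)))) α (All.map⁺ sat))
      (≤-reflexive (Functional.ext (𝔼-functional L) λ ω → cong (indicator ∘ models formula) (sym (trial-walk formula d k (rounds n R) (replicate n nothing) ω))))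

    q₀≤1 : q₀ ≤ 1ℚ
    q₀≤1 = ≤-trans (Functional.mono (𝔼-functional L) (λ ω → indicator≤1 (ok (encodeVec fromBool ω)))) (≤-reflexive (𝔼-const L 1ℚ))

    L≤ : L ℕ.≤ spine κ₀ ℕ.* suc (R ℕ.* suc k)
    L≤ = subst (ℕ._≤ spine κ₀ ℕ.* suc (R ℕ.* suc k)) (sym (tape-rounds n k R)) (ℕP.*-monoˡ-≤ (suc (R ℕ.* suc k)) n≤)

    A e : ℕ
    A = coefficient steps-poly
    e = degree steps-poly

    steps-bound : steps L (spine κ₀) ℕ.≤ (A ℕ.* 14 ℕ.^ e) ℕ.* suc n ℕ.^ (3 ℕ.* e)
    steps-bound = ℕP.≤-trans (steps-≤ {L} {spine κ₀ ℕ.* suc (R ℕ.* suc k)} {spine κ₀} L≤) (ℕP.≤-trans (bounds steps-poly (spine κ₀))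
      (ℕP.≤-trans (ℕP.*-monoʳ-≤ A (ℕP.^-monoˡ-≤ e (subst (λ z → suc z ℕ.≤ 14 ℕ.* suc n ℕ.^ 3) (sym spine-κ₀) ℓ₀-≤)))
        (ℕP.≤-reflexive (trans (cong (A ℕ.*_) (trans ([m*n]^k 14 (suc n ℕ.^ 3) e) (cong (14 ℕ.^ e ℕ.*_) (ℕP.^-*-assoc (suc n) 3 e))))
          (sym (ℕP.*-assoc A (14 ℕ.^ e) (suc n ℕ.^ (3 ℕ.* e))))))))

    -- One `B` pays for setting up the clock, the other for the loop; `steps` includes both.
    ppsz-duration : ∀ B → 0ℚ ≤ B → ι (steps L (spine κ₀)) ≤ q₀ * B → ExpectedTime ppsz on encodeCNF F AtMost (B + B)
    ppsz-duration B 0≤B enough N = subst (λ t → duration N (start ppsz t) ≤ B + B) (sym encode-input)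
      (≤-trans (duration-⇒ N (program-⇒ u v input)) (+-mono-≤
        (≤-trans (ι-mono init-≤) (≤-trans enough (≤-trans (*-monoʳ 0≤B q₀≤1) (≤-reflexive (*-identityˡ B)))))
        (head-duration u v input κ₀ L ok answer u-spec v-spec B 0≤B _ _ _ refl
          (start-⇒ u v input κ₀ L ok answer u-spec v-spec)
          (finish-⇒ u v input κ₀ L ok answer u-spec v-spec)
          (≤-trans (ι-mono (ℕP.m≤m+n (attempt-steps L (spine κ₀)) (22 ℕ.+ 6 ℕ.* spine κ₀))) enough) N input input nil nil nil)))
      where
      init-≤ : 22 ℕ.+ 6 ℕ.* spine (encodeℕ n) ℕ.≤ steps L (spine κ₀)
      init-≤ = ℕP.≤-trans (ℕP.+-monoʳ-≤ 22 (ℕP.*-monoʳ-≤ 6 (subst (ℕ._≤ spine κ₀) (sym (spine-encodeℕ n)) n≤))) (ℕP.m≤n+m (22 ℕ.+ 6 ℕ.* spine κ₀) (attempt-steps L (spine κ₀)))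

  -- A polynomial number of steps is at most a constant times (1 + η)^n, hence times (μ^K b)^n by
  -- `rate`. The success probability has the exponent K (n + 1) instead of K n; the extra factor `b`
  -- in the constant and 1 ≤ μ^K b make up for that.
  theorem : ∀ i → 0ℚ ≤ η → η ≤ 1ℚ → 0ℚ ≤ i → i * η ≡ 1ℚ → 0ℚ ≤ b →
    Σ[ P ∈ Program ] Σ[ C ∈ ℚ ] (∀ (n : ℕ) (F : CNF n) → Is3CNF F → Satisfiable F →
      FindsSatisfyingAssignment P F × (ExpectedTime P on encodeCNF F AtMost (C * b ^ n)))
  theorem i 0≤η η≤1 0≤i iη 0≤b = ppsz , C + C , λ n F 3cnf sat → ppsz-correct F 3cnf ,
      subst (λ z → ExpectedTime ppsz on encodeCNF F AtMost z) (sym (*-distribʳ-+ (b ^ n) C C))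
        (ppsz-duration F 3cnf (C * b ^ n) (0≤* 0≤C (^-≥0 n 0≤b)) (enough n F 3cnf sat))
    where
    A₀ e₀ : ℕ
    e₀ = degree steps-poly
    A₀ = coefficient steps-poly ℕ.* 14 ℕ.^ e₀
    dom = dominated (3 ℕ.* e₀) η i 0≤η η≤1 0≤i iη
    C₁ = proj₁ dom
    0≤C₁ = proj₁ (proj₂ dom)
    C = ι A₀ * C₁ * b
    0≤C : 0ℚ ≤ C
    0≤C = 0≤* (0≤* (0≤ι A₀) 0≤C₁) 0≤b
    y = μ ^ K
    0≤y = ^-≥0 K 0≤μ
    1≤yb : 1ℚ ≤ y * b
    1≤yb = ≤-trans (≤-by η 0≤η refl) rate
    regroup : ∀ a c b y p r → (y * p) * ((a * c * b) * r) ≡ (a * c) * ((y * b) * (p * r))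
    regroup = solve-∀ ℚ-ring
    enough : ∀ n (F : CNF n) 3cnf → Satisfiable F → ι (steps (L F 3cnf) (spine (κ₀ F 3cnf))) ≤ q₀ F 3cnf * (C * b ^ n)
    enough n F 3cnf sat = ≤-trans (ι-mono (steps-bound F 3cnf)) (≤-trans (≤-reflexive (trans (ι-* A₀ (suc n ℕ.^ (3 ℕ.* e₀))) (cong (ι A₀ *_) (ι-^ (suc n) (3 ℕ.* e₀)))))
      (≤-trans (*-monoˡ (0≤ι A₀) (proj₂ (proj₂ dom) n)) (≤-trans (≤-reflexive (sym (*-assoc (ι A₀) C₁ ((1ℚ + η) ^ n))))
        (≤-trans (*-monoˡ (0≤* (0≤ι A₀) 0≤C₁) (≤-trans (^-mono n (0≤+ 0≤1 0≤η) rate) (≤-trans (≤-reflexive (trans (^-distrib-* y b n) (sym (*-identityˡ (y ^ n * b ^ n)))))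
          (*-monoʳ (0≤* (^-≥0 n 0≤y) (^-≥0 n 0≤b)) 1≤yb))))
        (≤-trans (≤-reflexive (trans (sym (regroup (ι A₀) C₁ b y (y ^ n) (b ^ n))) (cong (_* (C * b ^ n)) (trans (sym (^-* μ (suc n) K)) (cong (μ ^_) (ℕP.*-comm (suc n) K))))))
          (*-monoʳ (0≤* 0≤C (^-≥0 n 0≤b)) (q₀-lower F 3cnf sat)))))))

theorem3 : Σ[ P ∈ Program ] Σ[ C ∈ ℚ ] (∀ (n : ℕ) (F : CNF n) → Is3CNF F → Satisfiable F →
    FindsSatisfyingAssignment P F ×
    (ExpectedTime P on encodeCNF F AtMost (C * (+ 132065 / 100000) ^ n)))
-- 500 is the reciprocal of `η`.
theorem3 = theorem constants (+ 500 / 1) (≤ᵇ⇒≤ _) (≤ᵇ⇒≤ _) (≤ᵇ⇒≤ _) refl (≤ᵇ⇒≤ _)
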